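{- Every $f\in \mathcal{POR}$ is $\Sigma^b_1$-representable in $\textsf{\textbf{RS}}^1_2$.
   Context: $\mathbb S$ is the set of finite binary strings and $\mathbb O=\mathbb B^{\mathbb S}$ the set of oracles. $\mathcal{POR}$ is the smallest class of functions $f:\mathbb S^k\times\mathbb O\to\mathbb S$ containing the empty function, projections, word-successors, the conditional function, and the query function $Q(x,\eta)=\eta(x)$, closed under composition and bounded recursion on notation. $\textsf{\textbf{RS}}^1_2$ is the bounded theory over the word language $\mathcal{RL}$ (with $\epsilon,\mathtt 0,\mathtt 1$, concatenation, self-concatenation, $=$, prefix $\subseteq$, and a unary predicate $\mathtt{Flip}$) with basic string axioms and $\Sigma^b_1$-induction on notation. A function $f$ is $\Sigma^b_1$-representable in $\textsf{\textbf{RS}}^1_2$ if there is a $\Sigma^b_1$-formula $F(\vec x,y)$ with (1) $\textsf{\textbf{RS}}^1_2\vdash(\forall\vec x)(\exists y)F(\vec x,y)$, (2) $\textsf{\textbf{RS}}^1_2\vdash(\forall\vec x)(\forall y)(\forall z)(F(\vec x,y)\wedge F(\vec x,z)\to y=z)$, (3) for all strings $\sigma_1,\dots,\sigma_j,\tau$ and $\eta\in\mathbb O$: $f(\sigma_1,\dots,\sigma_j,\eta)=\tau$ iff $\eta$ belongs to the set of oracles for which $F(\overline{\sigma_1},\dots,\overline{\sigma_j},\overline{\tau})$ is true in the standard string model with $\mathtt{Flip}(t)$ interpreted as $\eta(t)=\mathbb 1$. -}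

module Defs where

open import Data.Nat using (ℕ; zero; suc; _≤?_)
open import Data.Fin using (Fin; zero; suc)
open import Data.Bool using (Bool; true; false)
open import Data.List using (List; []; _∷_; map)
open import Data.List.Membership.Propositional using (_∈_)
open import Data.Product using (Σ; _×_; _,_)
open import Data.Sum using (_⊎_)
open import Data.Empty using (⊥)
open import Relation.Nullary using (yes; no)
open import Relation.Binary.PropositionalEquality using (_≡_)

-- Strings 𝕊 (finite binary words), built by word-successors on the right:
-- the word b₁…bₖ is ((ε ∙ b₁) ∙ …) ∙ bₖ ; false = 0, true = 1.

data 𝕊 : Set where
  ε   : 𝕊
  _∙_ : 𝕊 → Bool → 𝕊

infixl 6 _∙_

𝕆 : Set
𝕆 = 𝕊 → Bool

_++ˢ_ : 𝕊 → 𝕊 → 𝕊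
x ++ˢ ε       = x
x ++ˢ (y ∙ b) = (x ++ˢ y) ∙ b

_⊗_ : 𝕊 → 𝕊 → 𝕊
x ⊗ ε       = ε
x ⊗ (y ∙ b) = (x ⊗ y) ++ˢ x

len : 𝕊 → ℕ
len ε       = zero
len (x ∙ _) = suc (len x)

data _⊑_ : 𝕊 → 𝕊 → Set where
  ⊑-refl : ∀ {x} → x ⊑ x
  ⊑-step : ∀ {x y b} → x ⊑ y → x ⊑ (y ∙ b)

truncLen : 𝕊 → ℕ → 𝕊
truncLen ε       n = ε
truncLen (w ∙ b) n with suc (len w) ≤? n
... | yes _ = w ∙ b
... | no  _ = truncLen w n

_∣_ : 𝕊 → 𝕊 → 𝕊
w ∣ z = truncLen w (len z)

data Term (n : ℕ) : Set where
  var  : Fin n → Term n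
  tε   : Term n
  t0   : Term n
  t1   : Term n
  _⌢_  : Term n → Term n → Term n
  _×ᵗ_ : Term n → Term n → Term n

data Formula (n : ℕ) : Set where
  _≐_  : Term n → Term n → Formula n
  _⊆ᵗ_ : Term n → Term n → Formula n
  Flip : Term n → Formula n
  ⊥ᶠ   : Formula n
  _⇒_  : Formula n → Formula n → Formula n
  _∧ᶠ_ : Formula n → Formula n → Formula n
  _∨ᶠ_ : Formula n → Formula n → Formula n
  ∀ᶠ   : Formula (suc n) → Formula n
  ∃ᶠ   : Formula (suc n) → Formula n

infixr 4 _⇒_
infixr 5 _∨ᶠ_
infixr 6 _∧ᶠ_
infix 7 _≐_ _⊆ᵗ_
infixl 8 _⌢_ _×ᵗ_

¬ᶠ_ : ∀ {n} → Formula n → Formula n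
¬ᶠ φ = φ ⇒ ⊥ᶠ

_⇔ᶠ_ : ∀ {n} → Formula n → Formula n → Formula n
φ ⇔ᶠ ψ = (φ ⇒ ψ) ∧ᶠ (ψ ⇒ φ)

ext : ∀ {m n} → (Fin m → Fin n) → Fin (suc m) → Fin (suc n)
ext ρ zero    = zero
ext ρ (suc i) = suc (ρ i)

renT : ∀ {m n} → (Fin m → Fin n) → Term m → Term n
renT ρ (var i)  = var (ρ i)
renT ρ tε       = tε
renT ρ t0       = t0
renT ρ t1       = t1
renT ρ (s ⌢ t)  = renT ρ s ⌢ renT ρ t
renT ρ (s ×ᵗ t) = renT ρ s ×ᵗ renT ρ t

renF : ∀ {m n} → (Fin m → Fin n) → Formula m → Formula n
renF ρ (s ≐ t)  = renT ρ s ≐ renT ρ t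
renF ρ (s ⊆ᵗ t) = renT ρ s ⊆ᵗ renT ρ t
renF ρ (Flip t) = Flip (renT ρ t)
renF ρ ⊥ᶠ       = ⊥ᶠ
renF ρ (φ ⇒ ψ)  = renF ρ φ ⇒ renF ρ ψ
renF ρ (φ ∧ᶠ ψ) = renF ρ φ ∧ᶠ renF ρ ψ
renF ρ (φ ∨ᶠ ψ) = renF ρ φ ∨ᶠ renF ρ ψ
renF ρ (∀ᶠ φ)   = ∀ᶠ (renF (ext ρ) φ)
renF ρ (∃ᶠ φ)   = ∃ᶠ (renF (ext ρ) φ)

wkT : ∀ {n} → Term n → Term (suc n)
wkT = renT suc

wkF : ∀ {n} → Formula n → Formula (suc n)
wkF = renF suc

exts : ∀ {m n} → (Fin m → Term n) → Fin (suc m) → Term (suc n)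
exts σ zero    = var zero
exts σ (suc i) = wkT (σ i)

subT : ∀ {m n} → (Fin m → Term n) → Term m → Term n
subT σ (var i)  = σ i
subT σ tε       = tε
subT σ t0       = t0
subT σ t1       = t1
subT σ (s ⌢ t)  = subT σ s ⌢ subT σ t
subT σ (s ×ᵗ t) = subT σ s ×ᵗ subT σ t

subF : ∀ {m n} → (Fin m → Term n) → Formula m → Formula n
subF σ (s ≐ t)  = subT σ s ≐ subT σ t
subF σ (s ⊆ᵗ t) = subT σ s ⊆ᵗ subT σ t
subF σ (Flip t) = Flip (subT σ t)
subF σ ⊥ᶠ       = ⊥ᶠ
subF σ (φ ⇒ ψ)  = subF σ φ ⇒ subF σ ψ
subF σ (φ ∧ᶠ ψ) = subF σ φ ∧ᶠ subF σ ψ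
subF σ (φ ∨ᶠ ψ) = subF σ φ ∨ᶠ subF σ ψ
subF σ (∀ᶠ φ)   = ∀ᶠ (subF (exts σ) φ)
subF σ (∃ᶠ φ)   = ∃ᶠ (subF (exts σ) φ)

_[_] : ∀ {n} → Formula (suc n) → Term n → Formula n
φ [ t ] = subF σ φ
  where
  σ : _ → _
  σ zero    = t
  σ (suc i) = var i

∀ⁿ : (n : ℕ) → Formula n → Formula zero
∀ⁿ zero    φ = φ
∀ⁿ (suc n) φ = ∀ⁿ n (∀ᶠ φ)

lift₀ : ∀ {n} → Formula zero → Formula n
lift₀ = renF (λ ())

_⪯_ : ∀ {n} → Term n → Term n → Formula n
x ⪯ t = (t1 ×ᵗ x) ⊆ᵗ (t1 ×ᵗ t)

_⊆*_ : ∀ {n} → Term n → Term n → Formula n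
x ⊆* t = ∃ᶠ ((var zero ⊆ᵗ wkT t) ∧ᶠ ((var zero ⌢ wkT x) ⊆ᵗ wkT t))

∀⊆* : ∀ {n} → Term n → Formula (suc n) → Formula n
∀⊆* t φ = ∀ᶠ ((var zero ⊆* wkT t) ⇒ φ)

∃⊆* : ∀ {n} → Term n → Formula (suc n) → Formula n
∃⊆* t φ = ∃ᶠ ((var zero ⊆* wkT t) ∧ᶠ φ)

∃⪯ : ∀ {n} → Term n → Formula (suc n) → Formula n
∃⪯ t φ = ∃ᶠ ((var zero ⪯ wkT t) ∧ᶠ φ)

data Σᵇ₀ : ∀ {n} → Formula n → Set where
  eq   : ∀ {n} (s t : Term n) → Σᵇ₀ (s ≐ t)
  pre  : ∀ {n} (s t : Term n) → Σᵇ₀ (s ⊆ᵗ t)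
  flp  : ∀ {n} (t : Term n) → Σᵇ₀ (Flip t)
  bot  : ∀ {n} → Σᵇ₀ {n} ⊥ᶠ
  imp  : ∀ {n} {φ ψ : Formula n} → Σᵇ₀ φ → Σᵇ₀ ψ → Σᵇ₀ (φ ⇒ ψ)
  and  : ∀ {n} {φ ψ : Formula n} → Σᵇ₀ φ → Σᵇ₀ ψ → Σᵇ₀ (φ ∧ᶠ ψ)
  or   : ∀ {n} {φ ψ : Formula n} → Σᵇ₀ φ → Σᵇ₀ ψ → Σᵇ₀ (φ ∨ᶠ ψ)
  all* : ∀ {n} (t : Term n) {φ} → Σᵇ₀ φ → Σᵇ₀ (∀⊆* t φ)
  ex*  : ∀ {n} (t : Term n) {φ} → Σᵇ₀ φ → Σᵇ₀ (∃⊆* t φ)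

data Σᵇ₁ : ∀ {n} → Formula n → Set where
  base : ∀ {n} {φ : Formula n} → Σᵇ₀ φ → Σᵇ₁ φ
  and  : ∀ {n} {φ ψ : Formula n} → Σᵇ₁ φ → Σᵇ₁ ψ → Σᵇ₁ (φ ∧ᶠ ψ)
  or   : ∀ {n} {φ ψ : Formula n} → Σᵇ₁ φ → Σᵇ₁ ψ → Σᵇ₁ (φ ∨ᶠ ψ)
  all* : ∀ {n} (t : Term n) {φ} → Σᵇ₁ φ → Σᵇ₁ (∀⊆* t φ)
  ex*  : ∀ {n} (t : Term n) {φ} → Σᵇ₁ φ → Σᵇ₁ (∃⊆* t φ)
  ex⪯  : ∀ {n} (t : Term n) {φ} → Σᵇ₁ φ → Σᵇ₁ (∃⪯ t φ)

private
  x₁ y₀ : Term 2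
  x₁ = var (suc zero)
  y₀ = var zero
  x₀ : Term 1
  x₀ = var zero

data Basic : Formula zero → Set where
  b1  : Basic (∀ᶠ (x₀ ⌢ tε ≐ x₀))
  b2  : Basic (∀ᶠ (∀ᶠ (x₁ ⌢ (y₀ ⌢ t0) ≐ (x₁ ⌢ y₀) ⌢ t0)))
  b3  : Basic (∀ᶠ (∀ᶠ (x₁ ⌢ (y₀ ⌢ t1) ≐ (x₁ ⌢ y₀) ⌢ t1)))
  b4  : Basic (∀ᶠ (x₀ ×ᵗ tε ≐ tε))
  b5  : Basic (∀ᶠ (∀ᶠ (x₁ ×ᵗ (y₀ ⌢ t0) ≐ (x₁ ×ᵗ y₀) ⌢ x₁)))
  b6  : Basic (∀ᶠ (∀ᶠ (x₁ ×ᵗ (y₀ ⌢ t1) ≐ (x₁ ×ᵗ y₀) ⌢ x₁)))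
  b7  : Basic (∀ᶠ ((x₀ ⊆ᵗ tε) ⇔ᶠ (x₀ ≐ tε)))
  b8  : Basic (∀ᶠ (∀ᶠ ((x₁ ⊆ᵗ y₀ ⌢ t0) ⇔ᶠ ((x₁ ⊆ᵗ y₀) ∨ᶠ (x₁ ≐ y₀ ⌢ t0)))))
  b9  : Basic (∀ᶠ (∀ᶠ ((x₁ ⊆ᵗ y₀ ⌢ t1) ⇔ᶠ ((x₁ ⊆ᵗ y₀) ∨ᶠ (x₁ ≐ y₀ ⌢ t1)))))
  b10 : Basic (∀ᶠ (∀ᶠ ((x₁ ⌢ t0 ≐ y₀ ⌢ t0) ⇒ (x₁ ≐ y₀))))
  b11 : Basic (∀ᶠ (∀ᶠ ((x₁ ⌢ t1 ≐ y₀ ⌢ t1) ⇒ (x₁ ≐ y₀))))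
  b12 : Basic (∀ᶠ (∀ᶠ (¬ᶠ (x₁ ⌢ t0 ≐ y₀ ⌢ t1))))
  b13 : Basic (∀ᶠ (¬ᶠ (x₀ ⌢ t0 ≐ tε)))
  b14 : Basic (∀ᶠ (¬ᶠ (x₀ ⌢ t1 ≐ tε)))

stepSub : ∀ {n} → Term (suc n) → Fin (suc n) → Term (suc n)
stepSub b zero    = var zero ⌢ b
stepSub b (suc i) = var (suc i)

IndAx : ∀ {n} → Formula (suc n) → Formula n
IndAx B =
  ((B [ tε ]) ∧ᶠ ∀ᶠ (B ⇒ (subF (stepSub t0) B ∧ᶠ subF (stepSub t1) B)))
  ⇒ ∀ᶠ B

data Ax : (n : ℕ) → Formula n → Set where
  basic : ∀ {n φ} → Basic φ → Ax n (lift₀ φ)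
  ind   : ∀ {n} (B : Formula (suc n)) → Σᵇ₁ B → Ax n (IndAx B)

infix 3 _⊢_
data _⊢_ : ∀ {n} → List (Formula n) → Formula n → Set where
  hyp   : ∀ {n} {Γ : List (Formula n)} {φ} → φ ∈ Γ → Γ ⊢ φ
  ax    : ∀ {n} {Γ : List (Formula n)} {φ} → Ax n φ → Γ ⊢ φ
  ⊥E    : ∀ {n} {Γ : List (Formula n)} {φ} → Γ ⊢ ⊥ᶠ → Γ ⊢ φ
  raa   : ∀ {n} {Γ : List (Formula n)} {φ} → (¬ᶠ φ ∷ Γ) ⊢ ⊥ᶠ → Γ ⊢ φ
  ⇒I    : ∀ {n} {Γ : List (Formula n)} {φ ψ} → (φ ∷ Γ) ⊢ ψ → Γ ⊢ φ ⇒ ψ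
  ⇒E    : ∀ {n} {Γ : List (Formula n)} {φ ψ} → Γ ⊢ φ ⇒ ψ → Γ ⊢ φ → Γ ⊢ ψ
  ∧I    : ∀ {n} {Γ : List (Formula n)} {φ ψ} → Γ ⊢ φ → Γ ⊢ ψ → Γ ⊢ φ ∧ᶠ ψ
  ∧E₁   : ∀ {n} {Γ : List (Formula n)} {φ ψ} → Γ ⊢ φ ∧ᶠ ψ → Γ ⊢ φ
  ∧E₂   : ∀ {n} {Γ : List (Formula n)} {φ ψ} → Γ ⊢ φ ∧ᶠ ψ → Γ ⊢ ψ
  ∨I₁   : ∀ {n} {Γ : List (Formula n)} {φ ψ} → Γ ⊢ φ → Γ ⊢ φ ∨ᶠ ψ
  ∨I₂   : ∀ {n} {Γ : List (Formula n)} {φ ψ} → Γ ⊢ ψ → Γ ⊢ φ ∨ᶠ ψ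
  ∨E    : ∀ {n} {Γ : List (Formula n)} {φ ψ χ} →
          Γ ⊢ φ ∨ᶠ ψ → (φ ∷ Γ) ⊢ χ → (ψ ∷ Γ) ⊢ χ → Γ ⊢ χ
  ∀I    : ∀ {n} {Γ : List (Formula n)} {φ} → map wkF Γ ⊢ φ → Γ ⊢ ∀ᶠ φ
  ∀E    : ∀ {n} {Γ : List (Formula n)} {φ} → Γ ⊢ ∀ᶠ φ → (t : Term n) → Γ ⊢ φ [ t ]
  ∃I    : ∀ {n} {Γ : List (Formula n)} {φ} (t : Term n) → Γ ⊢ φ [ t ] → Γ ⊢ ∃ᶠ φ
  ∃E    : ∀ {n} {Γ : List (Formula n)} {φ ψ} →
          Γ ⊢ ∃ᶠ φ → (φ ∷ map wkF Γ) ⊢ wkF ψ → Γ ⊢ ψ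
  refl= : ∀ {n} {Γ : List (Formula n)} (t : Term n) → Γ ⊢ t ≐ t
  subst= : ∀ {n} {Γ : List (Formula n)} {s t : Term n} (φ : Formula (suc n)) →
           Γ ⊢ s ≐ t → Γ ⊢ φ [ s ] → Γ ⊢ φ [ t ]

RS¹₂⊢_ : Formula zero → Set
RS¹₂⊢ φ = [] ⊢ φ

⟦_⟧ᵗ : ∀ {n} → Term n → (Fin n → 𝕊) → 𝕊
⟦ var i ⟧ᵗ  ρ = ρ i
⟦ tε ⟧ᵗ     ρ = ε
⟦ t0 ⟧ᵗ     ρ = ε ∙ false
⟦ t1 ⟧ᵗ     ρ = ε ∙ true
⟦ s ⌢ t ⟧ᵗ  ρ = ⟦ s ⟧ᵗ ρ ++ˢ ⟦ t ⟧ᵗ ρ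
⟦ s ×ᵗ t ⟧ᵗ ρ = ⟦ s ⟧ᵗ ρ ⊗ ⟦ t ⟧ᵗ ρ

_∷ᵉ_ : ∀ {n} {A : Set} → A → (Fin n → A) → Fin (suc n) → A
(a ∷ᵉ ρ) zero    = a
(a ∷ᵉ ρ) (suc i) = ρ i

⟦_⟧ᶠ : ∀ {n} → Formula n → 𝕆 → (Fin n → 𝕊) → Set
⟦ s ≐ t ⟧ᶠ  η ρ = ⟦ s ⟧ᵗ ρ ≡ ⟦ t ⟧ᵗ ρ
⟦ s ⊆ᵗ t ⟧ᶠ η ρ = ⟦ s ⟧ᵗ ρ ⊑ ⟦ t ⟧ᵗ ρ
⟦ Flip t ⟧ᶠ η ρ = η (⟦ t ⟧ᵗ ρ) ≡ true
⟦ ⊥ᶠ ⟧ᶠ     η ρ = ⊥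
⟦ φ ⇒ ψ ⟧ᶠ  η ρ = ⟦ φ ⟧ᶠ η ρ → ⟦ ψ ⟧ᶠ η ρ
⟦ φ ∧ᶠ ψ ⟧ᶠ η ρ = ⟦ φ ⟧ᶠ η ρ × ⟦ ψ ⟧ᶠ η ρ
⟦ φ ∨ᶠ ψ ⟧ᶠ η ρ = ⟦ φ ⟧ᶠ η ρ ⊎ ⟦ ψ ⟧ᶠ η ρ
⟦ ∀ᶠ φ ⟧ᶠ   η ρ = (s : 𝕊) → ⟦ φ ⟧ᶠ η (s ∷ᵉ ρ)
⟦ ∃ᶠ φ ⟧ᶠ   η ρ = Σ 𝕊 (λ s → ⟦ φ ⟧ᶠ η (s ∷ᵉ ρ))

_⊨_ : 𝕆 → Formula zero → Set
η ⊨ φ = ⟦ φ ⟧ᶠ η (λ ())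

num : 𝕊 → Term zero
num ε           = tε
num (s ∙ false) = num s ⌢ t0
num (s ∙ true)  = num s ⌢ t1

-- The class 𝒫𝒪ℛ (codes of arity k) and their interpretation.
-- Argument conventions: for arity k, arguments are  Fin k → 𝕊.
--  * rec g h₀ h₁ t : arity (suc k); argument zero is the recursion
--    argument y, argument (suc i) is xᵢ.
--    h_b has arity suc (suc k): zero = f(x⃗,y), suc zero = y, suc (suc i) = xᵢ.
--    t is an ℛℒ-term with var zero = y, var (suc i) = xᵢ.
--  * cond: arguments 0,1,2,3 = x, y, z₀, z₁.

data POR : ℕ → Set where
  E    : POR 1
  P    : ∀ {k} → Fin k → POR k
  S₀   : POR 1
  S₁   : POR 1
  C    : POR 4
  Q    : POR 1
  comp : ∀ {k m} → POR k → (Fin k → POR m) → POR m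
  rec  : ∀ {k} → POR k → POR (suc (suc k)) → POR (suc (suc k)) →
         Term (suc k) → POR (suc k)

bit : Bool → 𝕊
bit b = ε ∙ b

mutual
  ⟦_⟧ : ∀ {k} → POR k → (Fin k → 𝕊) → 𝕆 → 𝕊
  ⟦ E ⟧ x η = ε
  ⟦ P i ⟧ x η = x i
  ⟦ S₀ ⟧ x η = x zero ∙ false
  ⟦ S₁ ⟧ x η = x zero ∙ true
  ⟦ C ⟧ x η = cond (x zero) (x (suc zero)) (x (suc (suc zero))) (x (suc (suc (suc zero))))
  ⟦ Q ⟧ x η = bit (η (x zero))
  ⟦ comp h g ⟧ x η = ⟦ h ⟧ (λ i → ⟦ g i ⟧ x η) η
  ⟦ rec g h₀ h₁ t ⟧ x η = recEval g h₀ h₁ t (λ i → x (suc i)) η (x zero)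

  recEval : ∀ {k} → POR k → POR (suc (suc k)) → POR (suc (suc k)) →
            Term (suc k) → (Fin k → 𝕊) → 𝕆 → 𝕊 → 𝕊
  recEval g h₀ h₁ t x η ε = ⟦ g ⟧ x η
  recEval g h₀ h₁ t x η (y ∙ false) =
    ⟦ h₀ ⟧ (recEval g h₀ h₁ t x η y ∷ᵉ (y ∷ᵉ x)) η ∣ ⟦ t ⟧ᵗ (y ∷ᵉ x)
  recEval g h₀ h₁ t x η (y ∙ true) =
    ⟦ h₁ ⟧ (recEval g h₀ h₁ t x η y ∷ᵉ (y ∷ᵉ x)) η ∣ ⟦ t ⟧ᵗ (y ∷ᵉ x)

  cond : 𝕊 → 𝕊 → 𝕊 → 𝕊 → 𝕊
  cond ε       y z₀ z₁ = y
  cond (_ ∙ false) y z₀ z₁ = z₀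
  cond (_ ∙ true)  y z₀ z₁ = z₁

-- Σᵇ₁-representability in RS¹₂.
-- F : Formula (suc j); var zero = y (the output), var (suc i) = xᵢ.

uniq : ∀ {j} → Formula (suc j) → Formula (suc (suc j))
uniq F = (renF ρy F ∧ᶠ renF ρz F) ⇒ (var (suc zero) ≐ var zero)
  where
  ρy : Fin _ → Fin _
  ρy zero    = suc zero
  ρy (suc i) = suc (suc i)
  ρz : Fin _ → Fin _
  ρz zero    = zero
  ρz (suc i) = suc (suc i)

instNum : ∀ {j} → Formula (suc j) → (Fin j → 𝕊) → 𝕊 → Formula zero
instNum F σ τ = subF (num τ ∷ᵉ (λ i → num (σ i))) F

Σᵇ₁-Representable : ∀ {j} → ((Fin j → 𝕊) → 𝕆 → 𝕊) → Set
Σᵇ₁-Representable {j} f =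
  Σ (Formula (suc j)) λ F →
    Σᵇ₁ F
    × RS¹₂⊢ ∀ⁿ j (∃ᶠ F)
    × RS¹₂⊢ ∀ⁿ j (∀ᶠ (∀ᶠ (uniq F)))
    × (∀ (σ : Fin j → 𝕊) (τ : 𝕊) (η : 𝕆) →
         (f σ η ≡ τ → η ⊨ instNum F σ τ) × (η ⊨ instNum F σ τ → f σ η ≡ τ))

module Submission where

open import Defs
open import Data.Bool using (Bool; true; false; if_then_else_; _≟_)
open import Data.Empty using (⊥-elim)
open import Data.Fin using (Fin; zero; suc; _↑ʳ_; _↑ˡ_)
open import Data.List using (List; []; _∷_; map)
open import Data.List.Membership.Propositional using (_∈_)
open import Data.List.Membership.Propositional.Properties using (∈-map⁺; ∈-map⁻)
open import Data.List.Relation.Unary.All using (All; []; _∷_)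
open import Data.List.Relation.Unary.Any using (here; there)
open import Data.Nat using (ℕ; zero; suc; _+_; _*_; _∸_; _≤_; _≤?_; z≤n; s≤s)
open import Data.Nat.Properties
  using (≤-refl; ≤-trans; ≤-reflexive; ≤-antisym; ≤-total; ≤-pred; n≤1+n; 1+n≰n; m≤m+n; m≤n+m; ≰⇒>;
         m≤n⇒m<n∨m≡n; +-comm; +-mono-≤; *-mono-≤; *-suc; *-zeroʳ; *-identityˡ; *-identityʳ;
         suc-injective; m+[n∸m]≡n)
open import Data.Product using (Σ; _×_; _,_; proj₁; proj₂)
open import Data.Sum using (_⊎_; inj₁; inj₂)
open import Function using (_∘_; id)
open import Relation.Binary.PropositionalEquality using (_≡_; refl; sym; trans; cong; cong₂; subst; subst₂)
open import Relation.Nullary using (Dec; yes; no; ¬_)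

-- Each f ∈ 𝒫𝒪ℛ gets a Σᵇ₁ graph formula together with a term bounding its values; the bound is what
-- makes the existential quantifiers introduced by composition legal, since terms are monotone for ⪯.
-- The substantial case is bounded recursion on notation.  The values at all prefixes of the recursion
-- word Y are recorded in one word w made of blocks of a fixed length |L|, where L bounds all values;
-- the value v is stored as v 1 0…0, from which it can be read off as the part before the last 1.
-- Block 0 holds ε and block |u| + 1 the value at the prefix u of Y, so that every block but the first
-- arises from its predecessor by the same step function.  Σᵇ₁-induction along the prefixes u of Y gives
-- a word w for each u, and the agreement of the first |u| + 2 blocks of any two such words.

-- Induction is available only for Σᵇ₁ formulas, which contain no implication above the Σᵇ₀ level.
-- So "if `u` is a prefix of `Y`" enters an induction formula as the disjunct `¬ᶠ (u ⊆ᵗ Y)`, and two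
-- tables are compared through the existence of a common prefix: equality of all coded values would
-- be an implication between Σᵇ₁ formulas. A fixed block length exists because every recursion step
-- is truncated: its value is bounded by a term in the current word and the parameters alone, so
-- bounds do not compound along the recursion, and by monotonicity the bound at `Y` serves all
-- prefixes of `Y`. Decoding a block rests on left cancellation for concatenation. The axioms cancel
-- only a single last letter, so this law and the arithmetic of lengths are first derived by
-- induction. Totality, uniqueness and the bound of a graph formula are demanded under every
-- substitution and in every context, so that a formula built from others can use them in the middle
-- of a derivation.

private variable
  k m n : ℕ
  Γ Δ : List (Formula n)
  φ ψ χ θ : Formula n
  s t u v w x y z x′ y′ z′ c d : Term n

-- Substitution in terms, formulas and derivations

none : {A : Set} → Fin 0 → A
none ()

subT-cong : {σ τ : Fin m → Term n} → (∀ i → σ i ≡ τ i) → ∀ t → subT σ t ≡ subT τ t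
subT-cong e (var i)  = e i
subT-cong e tε       = refl
subT-cong e t0       = refl
subT-cong e t1       = refl
subT-cong e (s ⌢ t)  = cong₂ _⌢_ (subT-cong e s) (subT-cong e t)
subT-cong e (s ×ᵗ t) = cong₂ _×ᵗ_ (subT-cong e s) (subT-cong e t)

subT-subT : (τ : Fin m → Term n) (σ : Fin k → Term m) → ∀ t → subT τ (subT σ t) ≡ subT (subT τ ∘ σ) t
subT-subT τ σ (var i)  = refl
subT-subT τ σ tε       = refl
subT-subT τ σ t0       = refl
subT-subT τ σ t1       = refl
subT-subT τ σ (s ⌢ t)  = cong₂ _⌢_ (subT-subT τ σ s) (subT-subT τ σ t)
subT-subT τ σ (s ×ᵗ t) = cong₂ _×ᵗ_ (subT-subT τ σ s) (subT-subT τ σ t)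

subT-var : (t : Term n) → subT var t ≡ t
subT-var (var i)  = refl
subT-var tε       = refl
subT-var t0       = refl
subT-var t1       = refl
subT-var (s ⌢ t)  = cong₂ _⌢_ (subT-var s) (subT-var t)
subT-var (s ×ᵗ t) = cong₂ _×ᵗ_ (subT-var s) (subT-var t)

renT≡subT : (ρ : Fin m → Fin n) → ∀ t → renT ρ t ≡ subT (var ∘ ρ) t
renT≡subT ρ (var i)  = refl
renT≡subT ρ tε       = refl
renT≡subT ρ t0       = refl
renT≡subT ρ t1       = refl
renT≡subT ρ (s ⌢ t)  = cong₂ _⌢_ (renT≡subT ρ s) (renT≡subT ρ t)
renT≡subT ρ (s ×ᵗ t) = cong₂ _×ᵗ_ (renT≡subT ρ s) (renT≡subT ρ t)

subT-renT : (σ : Fin m → Term n) (ρ : Fin k → Fin m) → ∀ t → subT σ (renT ρ t) ≡ subT (σ ∘ ρ) t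
subT-renT σ ρ t = trans (cong (subT σ) (renT≡subT ρ t)) (subT-subT σ (var ∘ ρ) t)

renT-subT : (ρ : Fin m → Fin n) (σ : Fin k → Term m) → ∀ t → renT ρ (subT σ t) ≡ subT (renT ρ ∘ σ) t
renT-subT ρ σ t = trans (renT≡subT ρ (subT σ t))
  (trans (subT-subT (var ∘ ρ) σ t) (subT-cong (λ i → sym (renT≡subT ρ (σ i))) t))

exts-cong : {σ τ : Fin m → Term n} → (∀ i → σ i ≡ τ i) → ∀ i → exts σ i ≡ exts τ i
exts-cong e zero    = refl
exts-cong e (suc i) = cong wkT (e i)

exts-wkT : (σ : Fin m → Term n) → ∀ t → subT (exts σ) (wkT t) ≡ wkT (subT σ t)
exts-wkT σ t = trans (subT-renT (exts σ) suc t) (sym (renT-subT suc σ t))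

exts-exts : (τ : Fin m → Term n) (σ : Fin k → Term m) → ∀ i → subT (exts τ) (exts σ i) ≡ exts (subT τ ∘ σ) i
exts-exts τ σ zero    = refl
exts-exts τ σ (suc i) = exts-wkT τ (σ i)

exts-var : ∀ i → exts (var {n}) i ≡ var i
exts-var zero    = refl
exts-var (suc i) = refl

exts-ren : (ρ : Fin m → Fin n) → ∀ i → exts (var ∘ ρ) i ≡ var (ext ρ i)
exts-ren ρ zero    = refl
exts-ren ρ (suc i) = refl

subF-cong : {σ τ : Fin m → Term n} → (∀ i → σ i ≡ τ i) → ∀ φ → subF σ φ ≡ subF τ φ
subF-cong e (s ≐ t)  = cong₂ _≐_ (subT-cong e s) (subT-cong e t)
subF-cong e (s ⊆ᵗ t) = cong₂ _⊆ᵗ_ (subT-cong e s) (subT-cong e t)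
subF-cong e (Flip t) = cong Flip (subT-cong e t)
subF-cong e ⊥ᶠ       = refl
subF-cong e (φ ⇒ ψ)  = cong₂ _⇒_ (subF-cong e φ) (subF-cong e ψ)
subF-cong e (φ ∧ᶠ ψ) = cong₂ _∧ᶠ_ (subF-cong e φ) (subF-cong e ψ)
subF-cong e (φ ∨ᶠ ψ) = cong₂ _∨ᶠ_ (subF-cong e φ) (subF-cong e ψ)
subF-cong e (∀ᶠ φ)   = cong ∀ᶠ (subF-cong (exts-cong e) φ)
subF-cong e (∃ᶠ φ)   = cong ∃ᶠ (subF-cong (exts-cong e) φ)

subF-subF : (τ : Fin m → Term n) (σ : Fin k → Term m) → ∀ φ → subF τ (subF σ φ) ≡ subF (subT τ ∘ σ) φ
subF-subF τ σ (s ≐ t)  = cong₂ _≐_ (subT-subT τ σ s) (subT-subT τ σ t)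
subF-subF τ σ (s ⊆ᵗ t) = cong₂ _⊆ᵗ_ (subT-subT τ σ s) (subT-subT τ σ t)
subF-subF τ σ (Flip t) = cong Flip (subT-subT τ σ t)
subF-subF τ σ ⊥ᶠ       = refl
subF-subF τ σ (φ ⇒ ψ)  = cong₂ _⇒_ (subF-subF τ σ φ) (subF-subF τ σ ψ)
subF-subF τ σ (φ ∧ᶠ ψ) = cong₂ _∧ᶠ_ (subF-subF τ σ φ) (subF-subF τ σ ψ)
subF-subF τ σ (φ ∨ᶠ ψ) = cong₂ _∨ᶠ_ (subF-subF τ σ φ) (subF-subF τ σ ψ)
subF-subF τ σ (∀ᶠ φ)   = cong ∀ᶠ (trans (subF-subF (exts τ) (exts σ) φ) (subF-cong (exts-exts τ σ) φ))
subF-subF τ σ (∃ᶠ φ)   = cong ∃ᶠ (trans (subF-subF (exts τ) (exts σ) φ) (subF-cong (exts-exts τ σ) φ))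

subF-var : (φ : Formula n) → subF var φ ≡ φ
subF-var (s ≐ t)  = cong₂ _≐_ (subT-var s) (subT-var t)
subF-var (s ⊆ᵗ t) = cong₂ _⊆ᵗ_ (subT-var s) (subT-var t)
subF-var (Flip t) = cong Flip (subT-var t)
subF-var ⊥ᶠ       = refl
subF-var (φ ⇒ ψ)  = cong₂ _⇒_ (subF-var φ) (subF-var ψ)
subF-var (φ ∧ᶠ ψ) = cong₂ _∧ᶠ_ (subF-var φ) (subF-var ψ)
subF-var (φ ∨ᶠ ψ) = cong₂ _∨ᶠ_ (subF-var φ) (subF-var ψ)
subF-var (∀ᶠ φ)   = cong ∀ᶠ (trans (subF-cong exts-var φ) (subF-var φ))
subF-var (∃ᶠ φ)   = cong ∃ᶠ (trans (subF-cong exts-var φ) (subF-var φ))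

renF≡subF : (ρ : Fin m → Fin n) → ∀ φ → renF ρ φ ≡ subF (var ∘ ρ) φ
renF≡subF ρ (s ≐ t)  = cong₂ _≐_ (renT≡subT ρ s) (renT≡subT ρ t)
renF≡subF ρ (s ⊆ᵗ t) = cong₂ _⊆ᵗ_ (renT≡subT ρ s) (renT≡subT ρ t)
renF≡subF ρ (Flip t) = cong Flip (renT≡subT ρ t)
renF≡subF ρ ⊥ᶠ       = refl
renF≡subF ρ (φ ⇒ ψ)  = cong₂ _⇒_ (renF≡subF ρ φ) (renF≡subF ρ ψ)
renF≡subF ρ (φ ∧ᶠ ψ) = cong₂ _∧ᶠ_ (renF≡subF ρ φ) (renF≡subF ρ ψ)
renF≡subF ρ (φ ∨ᶠ ψ) = cong₂ _∨ᶠ_ (renF≡subF ρ φ) (renF≡subF ρ ψ)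
renF≡subF ρ (∀ᶠ φ)   = cong ∀ᶠ (trans (renF≡subF (ext ρ) φ) (sym (subF-cong (exts-ren ρ) φ)))
renF≡subF ρ (∃ᶠ φ)   = cong ∃ᶠ (trans (renF≡subF (ext ρ) φ) (sym (subF-cong (exts-ren ρ) φ)))

subF-fuse : {τ : Fin m → Term n} {σ : Fin k → Term m} {θ : Fin k → Term n} →
            (∀ i → subT τ (σ i) ≡ θ i) → ∀ φ → subF τ (subF σ φ) ≡ subF θ φ
subF-fuse e φ = trans (subF-subF _ _ φ) (subF-cong e φ)

subF-renF : {τ : Fin m → Term n} {ρ : Fin k → Fin m} {θ : Fin k → Term n} →
            (∀ i → τ (ρ i) ≡ θ i) → ∀ φ → subF τ (renF ρ φ) ≡ subF θ φ
subF-renF e φ = trans (cong (subF _) (renF≡subF _ φ)) (subF-fuse e φ)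

wkF-subF : {σ : Fin k → Term m} {θ : Fin k → Term (suc m)} →
           (∀ i → wkT (σ i) ≡ θ i) → ∀ φ → wkF (subF σ φ) ≡ subF θ φ
wkF-subF {σ = σ} e φ = trans (renF≡subF suc (subF σ φ))
  (subF-fuse (λ i → trans (sym (renT≡subT suc (σ i))) (e i)) φ)

exts-wkF : (σ : Fin m → Term n) → ∀ φ → subF (exts σ) (wkF φ) ≡ wkF (subF σ φ)
exts-wkF σ φ = trans (subF-renF (λ _ → refl) φ) (sym (wkF-subF (λ _ → refl) φ))

exts≗ : (σ : Fin m → Term n) → ∀ i → exts σ i ≡ (var zero ∷ᵉ (wkT ∘ σ)) i
exts≗ σ zero    = refl
exts≗ σ (suc i) = refl

∷ᵉ-wkT : (t : Term n) (σ : Fin m → Term n) → ∀ s → subT (t ∷ᵉ σ) (wkT s) ≡ subT σ s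
∷ᵉ-wkT t σ s = subT-renT (t ∷ᵉ σ) suc s

inst≡ : (φ : Formula (suc n)) (t : Term n) → φ [ t ] ≡ subF (t ∷ᵉ var) φ
inst≡ φ t = subF-cong (λ { zero → refl ; (suc i) → refl }) φ

inst-exts : (σ : Fin m → Term n) (φ : Formula (suc m)) (t : Term n) →
            (subF (exts σ) φ) [ t ] ≡ subF (t ∷ᵉ σ) φ
inst-exts σ φ t = trans (inst≡ (subF (exts σ) φ) t)
  (subF-fuse (λ { zero → refl ; (suc i) → trans (∷ᵉ-wkT t var (σ i)) (subT-var (σ i)) }) φ)

subF-inst : (σ : Fin m → Term n) (φ : Formula (suc m)) (t : Term m) →
            subF σ (φ [ t ]) ≡ (subF (exts σ) φ) [ subT σ t ]
subF-inst σ φ t = trans (cong (subF σ) (inst≡ φ t))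
  (trans (subF-fuse (λ { zero → refl ; (suc i) → refl }) φ) (sym (inst-exts σ φ (subT σ t))))

data Bit {n} : Term n → Set where
  𝟘 : Bit t0
  𝟙 : Bit t1

Bit-wk : {c : Term n} → Bit c → Bit (wkT c)
Bit-wk 𝟘 = 𝟘
Bit-wk 𝟙 = 𝟙

stepSub-exts : (c : Term (suc n)) (σ : Fin m → Term n) → ∀ i →
               subT (stepSub c) (exts σ i) ≡ ((var zero ⌢ c) ∷ᵉ (wkT ∘ σ)) i
stepSub-exts c σ zero    = refl
stepSub-exts c σ (suc i) = trans (subT-renT (stepSub c) suc (σ i)) (sym (renT≡subT suc (σ i)))

subF-stepSub : (σ : Fin m → Term n) (B : Formula (suc m)) {c : Term (suc m)} {d : Term (suc n)} →
               subT (exts σ) c ≡ d →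
               subF (exts σ) (subF (stepSub c) B) ≡ subF (stepSub d) (subF (exts σ) B)
subF-stepSub σ B {c} refl = trans
  (subF-fuse {θ = (var zero ⌢ subT (exts σ) c) ∷ᵉ (wkT ∘ σ)} (λ { zero → refl ; (suc i) → refl }) B)
  (sym (subF-fuse (stepSub-exts (subT (exts σ) c) σ) B))

-- The induction schema admits parameters, so a substituted instance is again an instance. This is
-- the case that closes derivations under substitution.
subF-IndAx : (σ : Fin m → Term n) (B : Formula (suc m)) → subF σ (IndAx B) ≡ IndAx (subF (exts σ) B)
subF-IndAx σ B = cong₂ (λ a b → (a ∧ᶠ ∀ᶠ (subF (exts σ) B ⇒ b)) ⇒ ∀ᶠ (subF (exts σ) B))
  (subF-inst σ B tε)
  (cong₂ _∧ᶠ_ (subF-stepSub σ B refl) (subF-stepSub σ B refl))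

-- Bounded quantifiers are abbreviations containing weakened terms, and substitution commutes with
-- weakening only up to a proved equation.
⊆*-sub : (σ : Fin m → Term n) (t : Term m) →
         subF (exts σ) (var zero ⊆* wkT t) ≡ (var zero ⊆* wkT (subT σ t))
⊆*-sub σ t = cong (λ s → ∃ᶠ ((var zero ⊆ᵗ s) ∧ᶠ ((var zero ⌢ var (suc zero)) ⊆ᵗ s)))
  (trans (exts-wkT (exts σ) (wkT t)) (cong wkT (exts-wkT σ t)))

Σ₀-sub : (σ : Fin m → Term n) {φ : Formula m} → Σᵇ₀ φ → Σᵇ₀ (subF σ φ)
Σ₀-sub σ (eq s t)  = eq _ _
Σ₀-sub σ (pre s t) = pre _ _
Σ₀-sub σ (flp t)   = flp _
Σ₀-sub σ bot       = bot
Σ₀-sub σ (imp p q) = imp (Σ₀-sub σ p) (Σ₀-sub σ q)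
Σ₀-sub σ (and p q) = and (Σ₀-sub σ p) (Σ₀-sub σ q)
Σ₀-sub σ (or p q)  = or (Σ₀-sub σ p) (Σ₀-sub σ q)
Σ₀-sub σ (all* t {φ} p) =
  subst (λ ψ → Σᵇ₀ (∀ᶠ (ψ ⇒ subF (exts σ) φ))) (sym (⊆*-sub σ t)) (all* (subT σ t) (Σ₀-sub (exts σ) p))
Σ₀-sub σ (ex* t {φ} p) =
  subst (λ ψ → Σᵇ₀ (∃ᶠ (ψ ∧ᶠ subF (exts σ) φ))) (sym (⊆*-sub σ t)) (ex* (subT σ t) (Σ₀-sub (exts σ) p))

Σ₁-sub : (σ : Fin m → Term n) {φ : Formula m} → Σᵇ₁ φ → Σᵇ₁ (subF σ φ)
Σ₁-sub σ (base p)  = base (Σ₀-sub σ p)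
Σ₁-sub σ (and p q) = and (Σ₁-sub σ p) (Σ₁-sub σ q)
Σ₁-sub σ (or p q)  = or (Σ₁-sub σ p) (Σ₁-sub σ q)
Σ₁-sub σ (all* t {φ} p) =
  subst (λ ψ → Σᵇ₁ (∀ᶠ (ψ ⇒ subF (exts σ) φ))) (sym (⊆*-sub σ t)) (all* (subT σ t) (Σ₁-sub (exts σ) p))
Σ₁-sub σ (ex* t {φ} p) =
  subst (λ ψ → Σᵇ₁ (∃ᶠ (ψ ∧ᶠ subF (exts σ) φ))) (sym (⊆*-sub σ t)) (ex* (subT σ t) (Σ₁-sub (exts σ) p))
Σ₁-sub σ (ex⪯ t {φ} p) =
  subst (λ s → Σᵇ₁ (∃ᶠ ((var zero ⪯ s) ∧ᶠ subF (exts σ) φ))) (sym (exts-wkT σ t))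
      (ex⪯ (subT σ t) (Σ₁-sub (exts σ) p))

Σ₁-ren : (ρ : Fin m → Fin n) {φ : Formula m} → Σᵇ₁ φ → Σᵇ₁ (renF ρ φ)
Σ₁-ren ρ {φ} p = subst Σᵇ₁ (sym (renF≡subF ρ φ)) (Σ₁-sub (var ∘ ρ) p)

cast : {Γ : List (Formula n)} {φ ψ : Formula n} → φ ≡ ψ → Γ ⊢ φ → Γ ⊢ ψ
cast refl d = d

-- Contexts are related by inclusion so that this also yields weakening (σ = var).
subD : {Γ : List (Formula m)} {φ : Formula m} → Γ ⊢ φ →
       (σ : Fin m → Term n) {Δ : List (Formula n)} → (∀ {γ} → γ ∈ Γ → subF σ γ ∈ Δ) → Δ ⊢ subF σ φ

under-∷ : {Γ : List (Formula m)} {Δ : List (Formula n)} {σ : Fin m → Term n} {ψ : Formula m} →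
          (∀ {γ} → γ ∈ Γ → subF σ γ ∈ Δ) → ∀ {γ} → γ ∈ (ψ ∷ Γ) → subF σ γ ∈ (subF σ ψ ∷ Δ)
under-∷ i (here refl) = here refl
under-∷ i (there p)   = there (i p)

under-wk : {Γ : List (Formula m)} {Δ : List (Formula n)} (σ : Fin m → Term n) →
           (∀ {γ} → γ ∈ Γ → subF σ γ ∈ Δ) → ∀ {γ} → γ ∈ map wkF Γ → subF (exts σ) γ ∈ map wkF Δ
under-wk {Δ = Δ} σ i p with ∈-map⁻ wkF p
... | γ , q , refl = subst (_∈ map wkF Δ) (sym (exts-wkF σ γ)) (∈-map⁺ wkF (i q))

subD (hyp p) σ i = hyp (i p)
subD (ax (basic {φ = φ} b)) σ i = cast (trans (renF≡subF (λ ()) φ) (sym (subF-renF (λ ()) φ))) (ax (basic b))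
subD (ax (ind B p)) σ i = cast (sym (subF-IndAx σ B)) (ax (ind (subF (exts σ) B) (Σ₁-sub (exts σ) p)))
subD (⊥E d) σ i = ⊥E (subD d σ i)
subD (raa d) σ i = raa (subD d σ (under-∷ i))
subD (⇒I d) σ i = ⇒I (subD d σ (under-∷ i))
subD (⇒E d e) σ i = ⇒E (subD d σ i) (subD e σ i)
subD (∧I d e) σ i = ∧I (subD d σ i) (subD e σ i)
subD (∧E₁ d) σ i = ∧E₁ (subD d σ i)
subD (∧E₂ d) σ i = ∧E₂ (subD d σ i)
subD (∨I₁ d) σ i = ∨I₁ (subD d σ i)
subD (∨I₂ d) σ i = ∨I₂ (subD d σ i)
subD (∨E d e f) σ i = ∨E (subD d σ i) (subD e σ (under-∷ i)) (subD f σ (under-∷ i))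
subD (∀I d) σ i = ∀I (subD d (exts σ) (under-wk σ i))
subD (∀E {φ = φ} d t) σ i = cast (sym (subF-inst σ φ t)) (∀E (subD d σ i) (subT σ t))
subD (∃I {φ = φ} t d) σ i = ∃I (subT σ t) (cast (subF-inst σ φ t) (subD d σ i))
subD (∃E {ψ = ψ} d e) σ i =
  ∃E (subD d σ i) (cast (exts-wkF σ ψ) (subD e (exts σ) (under-∷ (under-wk σ i))))
subD (refl= t) σ i = refl= (subT σ t)
subD (subst= {s = s} {t} φ d e) σ i = cast (sym (subF-inst σ φ t))
  (subst= (subF (exts σ) φ) (subD d σ i) (cast (subF-inst σ φ s) (subD e σ i)))

weaken : {Γ Δ : List (Formula n)} {φ : Formula n} → (∀ {γ} → γ ∈ Γ → γ ∈ Δ) → Γ ⊢ φ → Δ ⊢ φ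
weaken {Δ = Δ} {φ} i d = cast (subF-var φ) (subD d var (λ {γ} p → subst (_∈ Δ) (sym (subF-var γ)) (i p)))

wk₁ : {Γ : List (Formula n)} {φ ψ : Formula n} → Γ ⊢ φ → ψ ∷ Γ ⊢ φ
wk₁ = weaken there

up : {Γ : List (Formula n)} {φ : Formula n} → Γ ⊢ φ → map wkF Γ ⊢ wkF φ
up {Γ = Γ} {φ} d = cast (sym (renF≡subF suc φ))
  (subD d (var ∘ suc) (λ {γ} p → subst (_∈ map wkF Γ) (renF≡subF suc γ) (∈-map⁺ wkF p)))

up₁ : {Γ : List (Formula n)} {φ : Formula n} {ψ : Formula (suc n)} → Γ ⊢ φ → ψ ∷ map wkF Γ ⊢ wkF φ
up₁ d = wk₁ (up d)

-- Substitution followed by cuts. Lemmas on words are proved once for variables, where `wkT` and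
-- `subT` compute, and this rule carries them to arbitrary terms and contexts.
use : {Γ : List (Formula m)} {φ : Formula m} → Γ ⊢ φ →
      (σ : Fin m → Term n) {Δ : List (Formula n)} → All (λ γ → Δ ⊢ subF σ γ) Γ → Δ ⊢ subF σ φ
use d σ []       = subD d σ (λ ())
use d σ (e ∷ es) = ⇒E (use (⇒I d) σ es) e

-- Quantifier rules for instances subF σ φ, avoiding iterated substitutions.

∀I′ : {Γ : List (Formula n)} (σ : Fin m → Term n) (φ : Formula (suc m)) →
      map wkF Γ ⊢ subF (var zero ∷ᵉ (wkT ∘ σ)) φ → Γ ⊢ subF σ (∀ᶠ φ)
∀I′ σ φ d = ∀I (cast (sym (subF-cong (exts≗ σ) φ)) d)

∀E′ : {Γ : List (Formula n)} (σ : Fin m → Term n) (φ : Formula (suc m)) →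
      Γ ⊢ subF σ (∀ᶠ φ) → ∀ t → Γ ⊢ subF (t ∷ᵉ σ) φ
∀E′ σ φ d t = cast (inst-exts σ φ t) (∀E d t)

∃I′ : {Γ : List (Formula n)} (σ : Fin m → Term n) (φ : Formula (suc m)) →
      ∀ t → Γ ⊢ subF (t ∷ᵉ σ) φ → Γ ⊢ subF σ (∃ᶠ φ)
∃I′ σ φ t d = ∃I t (cast (sym (inst-exts σ φ t)) d)

∃E′ : {Γ : List (Formula n)} (σ : Fin m → Term n) (φ : Formula (suc m)) {ψ : Formula n} →
      Γ ⊢ subF σ (∃ᶠ φ) → (subF (var zero ∷ᵉ (wkT ∘ σ)) φ ∷ map wkF Γ) ⊢ wkF ψ → Γ ⊢ ψ
∃E′ {Γ = Γ} σ φ {ψ} d e =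
  ∃E d (subst (λ χ → (χ ∷ map wkF Γ) ⊢ wkF ψ) (sym (subF-cong (exts≗ σ) φ)) e)

open-∀ : {φ : Formula (suc n)} → [] ⊢ ∀ᶠ φ → [] ⊢ φ
open-∀ {φ = φ} d = cast (trans (inst≡ (renF (ext suc) φ) (var zero))
  (trans (subF-renF (λ { zero → refl ; (suc i) → refl }) φ) (subF-var φ))) (∀E (up d) (var zero))

-- The parameters `σ` stay apart from the schematic formula `B`: the Σᵇ₁ check concerns `B` only,
-- and base, step and conclusion are single substitution instances of it.
induct : {Γ : List (Formula n)} (σ : Fin m → Term n) (B : Formula (suc m)) → Σᵇ₁ B →
         Γ ⊢ subF (tε ∷ᵉ σ) B →
         (∀ {c} → Bit c → (subF (var zero ∷ᵉ (wkT ∘ σ)) B ∷ map wkF Γ) ⊢ subF ((var zero ⌢ c) ∷ᵉ (wkT ∘ σ))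
             B) →
         ∀ t → Γ ⊢ subF (t ∷ᵉ σ) B
induct {Γ = Γ} σ B p z s t = cast (inst-exts σ B t) (∀E (⇒E (ax (ind (subF (exts σ) B) (Σ₁-sub (exts σ) p)))
  (∧I (cast (sym (inst-exts σ B tε)) z) (∀I (⇒I (∧I (step 𝟘) (step 𝟙)))))) t)
  where
  step : ∀ {c} → Bit c → (subF (exts σ) B ∷ map wkF Γ) ⊢ subF (stepSub c) (subF (exts σ) B)
  step {c} b = subst (λ χ → (χ ∷ map wkF Γ) ⊢ subF (stepSub c) (subF (exts σ) B))
    (sym (subF-cong (exts≗ σ) B)) (cast (sym (subF-fuse (stepSub-exts c σ) B)) (s b))

inductC : (B : Formula (suc n)) → Σᵇ₁ B → [] ⊢ subF (tε ∷ᵉ var) B →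
          (∀ {c} → Bit c → (B ∷ []) ⊢ subF (stepSub c) B) → [] ⊢ B
inductC B p z s = open-∀ (⇒E (ax (ind B p))
  (∧I (cast (sym (inst≡ B tε)) z) (∀I (⇒I (∧I (s 𝟘) (s 𝟙))))))

-- Substitution and truth in the standard model

semT : (t : Term m) {σ : Fin m → Term n} {ρ : Fin n → 𝕊} {ρ′ : Fin m → 𝕊} →
       (∀ i → ⟦ σ i ⟧ᵗ ρ ≡ ρ′ i) → ⟦ subT σ t ⟧ᵗ ρ ≡ ⟦ t ⟧ᵗ ρ′
semT (var i) e  = e i
semT tε e       = refl
semT t0 e       = refl
semT t1 e       = refl
semT (s ⌢ t) e  = cong₂ _++ˢ_ (semT s e) (semT t e)
semT (s ×ᵗ t) e = cong₂ _⊗_ (semT s e) (semT t e)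

semExts : {σ : Fin m → Term n} {ρ : Fin n → 𝕊} {ρ′ : Fin m → 𝕊} → (∀ i → ⟦ σ i ⟧ᵗ ρ ≡ ρ′ i) →
          ∀ s i → ⟦ exts σ i ⟧ᵗ (s ∷ᵉ ρ) ≡ (s ∷ᵉ ρ′) i
semExts e s zero = refl
semExts {σ = σ} {ρ} e s (suc i) = trans (cong (λ t → ⟦ t ⟧ᵗ (s ∷ᵉ ρ)) (renT≡subT suc (σ i)))
  (trans (semT (σ i) (λ _ → refl)) (e i))

-- Both directions are proved together because an implication exchanges them.
semF : (φ : Formula m) {σ : Fin m → Term n} {ρ : Fin n → 𝕊} {ρ′ : Fin m → 𝕊} {η : 𝕆} →
       (∀ i → ⟦ σ i ⟧ᵗ ρ ≡ ρ′ i) →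
       (⟦ subF σ φ ⟧ᶠ η ρ → ⟦ φ ⟧ᶠ η ρ′) × (⟦ φ ⟧ᶠ η ρ′ → ⟦ subF σ φ ⟧ᶠ η ρ)
semF (s ≐ t) e  = (λ p → trans (sym (semT s e)) (trans p (semT t e))) ,
                  (λ p → trans (semT s e) (trans p (sym (semT t e))))
semF (s ⊆ᵗ t) e = subst₂ _⊑_ (semT s e) (semT t e) , subst₂ _⊑_ (sym (semT s e)) (sym (semT t e))
semF (Flip t) {η = η} e = (λ p → trans (cong η (sym (semT t e))) p) , (λ p → trans (cong η (semT t e)) p)
semF ⊥ᶠ e       = id , id
semF (φ ⇒ ψ) e  = (λ f → proj₁ (semF ψ e) ∘ f ∘ proj₂ (semF φ e)) ,
    (λ f → proj₂ (semF ψ e) ∘ f ∘ proj₁ (semF φ e))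
semF (φ ∧ᶠ ψ) e = (λ (p , q) → proj₁ (semF φ e) p , proj₁ (semF ψ e) q) ,
                  (λ (p , q) → proj₂ (semF φ e) p , proj₂ (semF ψ e) q)
semF (φ ∨ᶠ ψ) e = (λ { (inj₁ p) → inj₁ (proj₁ (semF φ e) p) ; (inj₂ p) → inj₂ (proj₁ (semF ψ e) p) }) ,
                  (λ { (inj₁ p) → inj₁ (proj₂ (semF φ e) p) ; (inj₂ p) → inj₂ (proj₂ (semF ψ e) p) })
semF (∀ᶠ φ) {σ} e = (λ f s → proj₁ (semF φ (semExts {σ = σ} e s)) (f s)) ,
                    (λ f s → proj₂ (semF φ (semExts {σ = σ} e s)) (f s))
semF (∃ᶠ φ) {σ} e = (λ (s , p) → s , proj₁ (semF φ (semExts {σ = σ} e s)) p) ,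
                    (λ (s , p) → s , proj₂ (semF φ (semExts {σ = σ} e s)) p)

semR : (φ : Formula m) {ρ : Fin m → Fin n} {ε₁ : Fin n → 𝕊} {ε₂ : Fin m → 𝕊} {η : 𝕆} →
       (∀ i → ε₁ (ρ i) ≡ ε₂ i) →
       (⟦ renF ρ φ ⟧ᶠ η ε₁ → ⟦ φ ⟧ᶠ η ε₂) × (⟦ φ ⟧ᶠ η ε₂ → ⟦ renF ρ φ ⟧ᶠ η ε₁)
semR φ {ρ} {ε₁} {η = η} e =
  (λ p → proj₁ (semF φ {σ = var ∘ ρ} e) (subst (λ ψ → ⟦ ψ ⟧ᶠ η ε₁) (renF≡subF ρ φ) p)) ,
  (λ p → subst (λ ψ → ⟦ ψ ⟧ᶠ η ε₁) (sym (renF≡subF ρ φ)) (proj₂ (semF φ {σ = var ∘ ρ} e) p))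

-- Words inside RS¹₂

infixr 5 _▸_
_▸_ : {A : Set} → A → (Fin n → A) → Fin (suc n) → A
_▸_ = _∷ᵉ_

v0 : Term (suc n)
v0 = var zero
v1 : Term (suc (suc n))
v1 = wkT v0
v2 : Term (suc (suc (suc n)))
v2 = wkT v1
v3 : Term (suc (suc (suc (suc n))))
v3 = wkT v2
v4 : Term (suc (suc (suc (suc (suc n)))))
v4 = wkT v3

h0 : φ ∷ Γ ⊢ φ
h0 = hyp (here refl)
h1 : ψ ∷ φ ∷ Γ ⊢ φ
h1 = wk₁ h0
h2 : χ ∷ ψ ∷ φ ∷ Γ ⊢ φ
h2 = wk₁ h1
h3 : θ ∷ χ ∷ ψ ∷ φ ∷ Γ ⊢ φ
h3 = wk₁ h2

sym≐ : Γ ⊢ s ≐ t → Γ ⊢ t ≐ s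
sym≐ {s = s} {t} d = use core (t ▸ s ▸ none) (d ∷ [])
  where
  core : (v1 ≐ v0) ∷ [] ⊢ v0 ≐ v1 {0}
  core = subst= (v0 ≐ v2) h0 (refl= v1)

infixr 4 _⟫_
_⟫_ : Γ ⊢ s ≐ t → Γ ⊢ t ≐ u → Γ ⊢ s ≐ u
_⟫_ {s = s} {t} {u} d e = use core (u ▸ t ▸ s ▸ none) (d ∷ e ∷ [])
  where
  core : (v2 ≐ v1) ∷ (v1 ≐ v0) ∷ [] ⊢ v2 ≐ v0 {2}
  core = subst= (v3 ≐ v0) h1 h0

⌢-cong : Γ ⊢ s ≐ t → Γ ⊢ x ≐ y → Γ ⊢ s ⌢ x ≐ t ⌢ y
⌢-cong {s = s} {t} {x} {y} d e = use core (y ▸ x ▸ t ▸ s ▸ none) (d ∷ e ∷ [])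
  where
  core : (v3 ≐ v2) ∷ (v1 ≐ v0) ∷ [] ⊢ v3 ⌢ v1 ≐ v2 ⌢ v0 {3}
  core = subst= (wkT v3 ⌢ v2 ≐ v3 ⌢ v0) h1 (subst= (wkT v3 ⌢ v2 ≐ v0 ⌢ v2) h0 (refl= _))

×-cong : Γ ⊢ s ≐ t → Γ ⊢ x ≐ y → Γ ⊢ s ×ᵗ x ≐ t ×ᵗ y
×-cong {s = s} {t} {x} {y} d e = use core (y ▸ x ▸ t ▸ s ▸ none) (d ∷ e ∷ [])
  where
  core : (v3 ≐ v2) ∷ (v1 ≐ v0) ∷ [] ⊢ v3 ×ᵗ v1 ≐ v2 ×ᵗ v0 {3}
  core = subst= (wkT v3 ×ᵗ v2 ≐ v3 ×ᵗ v0) h1 (subst= (wkT v3 ×ᵗ v2 ≐ v0 ×ᵗ v2) h0 (refl= _))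

⊆-resp : Γ ⊢ s ≐ t → Γ ⊢ x ≐ y → Γ ⊢ s ⊆ᵗ x → Γ ⊢ t ⊆ᵗ y
⊆-resp {s = s} {t} {x} {y} d e f = use core (y ▸ x ▸ t ▸ s ▸ none) (d ∷ e ∷ f ∷ [])
  where
  core : (v3 ≐ v2) ∷ (v1 ≐ v0) ∷ (v3 ⊆ᵗ v1) ∷ [] ⊢ v2 ⊆ᵗ v0 {3}
  core = subst= (v3 ⊆ᵗ v0) h1 (subst= (v0 ⊆ᵗ v2) h0 h2)

-- The length of a word in unary, as a word of ones. Thus `⪯` is the prefix order on such words, and
-- equal lengths are an equation between them.
∥_∥ : Term n → Term n
∥ t ∥ = t1 ×ᵗ t

len-cong : Γ ⊢ x ≐ y → Γ ⊢ ∥ x ∥ ≐ ∥ y ∥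
len-cong = ×-cong (refl= t1)

⌢ε : ∀ x → Γ ⊢ x ⌢ tε ≐ x
⌢ε x = use (open-∀ (ax (basic b1))) (x ▸ none) []

⌢-bit : Bit c → ∀ x y → Γ ⊢ x ⌢ (y ⌢ c) ≐ (x ⌢ y) ⌢ c
⌢-bit 𝟘 x y = use (open-∀ (open-∀ (ax (basic b2)))) (y ▸ x ▸ none) []
⌢-bit 𝟙 x y = use (open-∀ (open-∀ (ax (basic b3)))) (y ▸ x ▸ none) []

×ε : ∀ x → Γ ⊢ x ×ᵗ tε ≐ tε
×ε x = use (open-∀ (ax (basic b4))) (x ▸ none) []

×-bit : Bit c → ∀ x y → Γ ⊢ x ×ᵗ (y ⌢ c) ≐ (x ×ᵗ y) ⌢ x
×-bit 𝟘 x y = use (open-∀ (open-∀ (ax (basic b5)))) (y ▸ x ▸ none) []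
×-bit 𝟙 x y = use (open-∀ (open-∀ (ax (basic b6)))) (y ▸ x ▸ none) []

⊆ε⇒ : Γ ⊢ x ⊆ᵗ tε → Γ ⊢ x ≐ tε
⊆ε⇒ {x = x} d = ⇒E (∧E₁ (use (open-∀ (ax (basic b7))) (x ▸ none) [])) d

⊆ε⇐ : Γ ⊢ x ≐ tε → Γ ⊢ x ⊆ᵗ tε
⊆ε⇐ {x = x} d = ⇒E (∧E₂ (use (open-∀ (ax (basic b7))) (x ▸ none) [])) d

⊆-bit : Bit c → ∀ x y → Γ ⊢ (x ⊆ᵗ y ⌢ c) ⇔ᶠ ((x ⊆ᵗ y) ∨ᶠ (x ≐ y ⌢ c))
⊆-bit 𝟘 x y = use (open-∀ (open-∀ (ax (basic b8)))) (y ▸ x ▸ none) []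
⊆-bit 𝟙 x y = use (open-∀ (open-∀ (ax (basic b9)))) (y ▸ x ▸ none) []

⊆-bit⇒ : Bit c → Γ ⊢ x ⊆ᵗ y ⌢ c → Γ ⊢ (x ⊆ᵗ y) ∨ᶠ (x ≐ y ⌢ c)
⊆-bit⇒ b d = ⇒E (∧E₁ (⊆-bit b _ _)) d

⊆-bit⇐ : Bit c → Γ ⊢ (x ⊆ᵗ y) ∨ᶠ (x ≐ y ⌢ c) → Γ ⊢ x ⊆ᵗ y ⌢ c
⊆-bit⇐ b d = ⇒E (∧E₂ (⊆-bit b _ _)) d

bit-injective : Bit c → Γ ⊢ x ⌢ c ≐ y ⌢ c → Γ ⊢ x ≐ y
bit-injective {x = x} {y} 𝟘 d = ⇒E (use (open-∀ (open-∀ (ax (basic b10)))) (y ▸ x ▸ none) []) d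
bit-injective {x = x} {y} 𝟙 d = ⇒E (use (open-∀ (open-∀ (ax (basic b11)))) (y ▸ x ▸ none) []) d

0≢1 : Γ ⊢ x ⌢ t0 ≐ y ⌢ t1 → Γ ⊢ ⊥ᶠ
0≢1 {x = x} {y} d = ⇒E (use (open-∀ (open-∀ (ax (basic b12)))) (y ▸ x ▸ none) []) d

bit≢ε : Bit c → Γ ⊢ x ⌢ c ≐ tε → Γ ⊢ ⊥ᶠ
bit≢ε {x = x} 𝟘 d = ⇒E (use (open-∀ (ax (basic b13))) (x ▸ none) []) d
bit≢ε {x = x} 𝟙 d = ⇒E (use (open-∀ (ax (basic b14))) (x ▸ none) []) d

ε⌢ : ∀ x → Γ ⊢ tε ⌢ x ≐ x
ε⌢ x = use core (x ▸ none) []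
  where
  core : [] ⊢ tε ⌢ v0 ≐ v0 {0}
  core = inductC (tε ⌢ v0 ≐ v0) (base (eq _ _)) (⌢ε tε) (λ b → ⌢-bit b _ _ ⟫ ⌢-cong h0 (refl= _))

assoc : ∀ x y z → Γ ⊢ x ⌢ (y ⌢ z) ≐ (x ⌢ y) ⌢ z
assoc x y z = use core (z ▸ y ▸ x ▸ none) []
  where
  core : [] ⊢ v2 ⌢ (v1 ⌢ v0) ≐ (v2 ⌢ v1) ⌢ v0 {2}
  core = inductC _ (base (eq _ _)) (⌢-cong (refl= _) (⌢ε _) ⟫ sym≐ (⌢ε _))
    (λ b → ⌢-cong (refl= _) (⌢-bit b _ _) ⟫ ⌢-bit b _ _ ⟫ ⌢-cong h0 (refl= _) ⟫ sym≐ (⌢-bit b _ _))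

×-⌢ : ∀ x y z → Γ ⊢ x ×ᵗ (y ⌢ z) ≐ (x ×ᵗ y) ⌢ (x ×ᵗ z)
×-⌢ x y z = use core (z ▸ y ▸ x ▸ none) []
  where
  core : [] ⊢ v2 ×ᵗ (v1 ⌢ v0) ≐ (v2 ×ᵗ v1) ⌢ (v2 ×ᵗ v0 {2})
  core = inductC _ (base (eq _ _))
    (×-cong (refl= _) (⌢ε _) ⟫ sym≐ (⌢ε _) ⟫ ⌢-cong (refl= _) (sym≐ (×ε _)))
    (λ b → ×-cong (refl= _) (⌢-bit b _ _) ⟫ ×-bit b _ _ ⟫ ⌢-cong h0 (refl= _)
           ⟫ sym≐ (assoc _ _ _) ⟫ ⌢-cong (refl= _) (sym≐ (×-bit b _ _)))

×bit : Bit c → ∀ x → Γ ⊢ x ×ᵗ c ≐ x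
×bit b x = ×-cong (refl= _) (sym≐ (ε⌢ _)) ⟫ ×-bit b _ _ ⟫ ⌢-cong (×ε _) (refl= _) ⟫ ε⌢ _

-- `c ×ᵗ y` is a string of letters `c` as long as `y`, and the product axioms consume the right
-- factor letter by letter without distinguishing the letters.
×× : Bit c → ∀ x y → Γ ⊢ x ×ᵗ (c ×ᵗ y) ≐ x ×ᵗ y
×× 𝟘 x y = use core (y ▸ x ▸ none) []
  where
  core : [] ⊢ v1 ×ᵗ (t0 ×ᵗ v0) ≐ v1 ×ᵗ v0 {1}
  core = inductC _ (base (eq _ _)) (×-cong (refl= _) (×ε _))
    (λ b → ×-cong (refl= _) (×-bit b _ _) ⟫ ×-bit 𝟘 _ _ ⟫ ⌢-cong h0 (refl= _) ⟫ sym≐ (×-bit b _ _))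
×× 𝟙 x y = use core (y ▸ x ▸ none) []
  where
  core : [] ⊢ v1 ×ᵗ (t1 ×ᵗ v0) ≐ v1 ×ᵗ v0 {1}
  core = inductC _ (base (eq _ _)) (×-cong (refl= _) (×ε _))
    (λ b → ×-cong (refl= _) (×-bit b _ _) ⟫ ×-bit 𝟙 _ _ ⟫ ⌢-cong h0 (refl= _) ⟫ sym≐ (×-bit b _ _))

-- The prefix relation

⊆-refl : ∀ x → Γ ⊢ x ⊆ᵗ x
⊆-refl x = use core (x ▸ none) []
  where
  core : [] ⊢ v0 {0} ⊆ᵗ v0
  core = inductC (v0 ⊆ᵗ v0) (base (pre _ _)) (⊆ε⇐ (refl= _)) (λ b → ⊆-bit⇐ b (∨I₂ (refl= _)))

≐⇒⊆ : Γ ⊢ x ≐ y → Γ ⊢ x ⊆ᵗ y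
≐⇒⊆ d = ⊆-resp (refl= _) d (⊆-refl _)

⊆-⌢ : ∀ x z → Γ ⊢ x ⊆ᵗ x ⌢ z
⊆-⌢ x z = use core (z ▸ x ▸ none) []
  where
  core : [] ⊢ v1 ⊆ᵗ v1 ⌢ v0 {1}
  core = inductC _ (base (pre _ _)) (≐⇒⊆ (sym≐ (⌢ε _)))
    (λ b → ⊆-resp (refl= _) (sym≐ (⌢-bit b _ _)) (⊆-bit⇐ b (∨I₁ h0)))

≐⌢⇒⊆ : Γ ⊢ x ⌢ z ≐ y → Γ ⊢ x ⊆ᵗ y
≐⌢⇒⊆ d = ⊆-resp (refl= _) d (⊆-⌢ _ _)

-- The remainder is sought among the subwords of the longer word. This keeps the formula Σᵇ₀, so
-- that it may stand inside the implication on which `⊆⇒extends` does induction.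
extends : Formula 2
extends = ∃⊆* v0 (v2 ⌢ v0 ≐ v1)

extendsBody : Formula 3
extendsBody = (v0 ⊆* v1) ∧ᶠ (v2 ⌢ v0 ≐ v1)

extendsI : ∀ z → Γ ⊢ x ⌢ z ≐ y → Γ ⊢ subF (y ▸ x ▸ none) extends
extendsI {x = x} {y} z d = ∃I′ (y ▸ x ▸ none) extendsBody z
    (∧I (∃I′ (z ▸ y ▸ x ▸ none) ((v0 ⊆ᵗ v2) ∧ᶠ ((v0 ⌢ v1) ⊆ᵗ v2)) x
  (∧I (≐⌢⇒⊆ d) (≐⇒⊆ d))) d)

extendsE : Γ ⊢ subF (y ▸ x ▸ none) extends → (wkT x ⌢ v0 ≐ wkT y) ∷ map wkF Γ ⊢ wkF ψ → Γ ⊢ ψ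
extendsE {y = y} {x} d e = ∃E′ (y ▸ x ▸ none) extendsBody d (⇒E (wk₁ (⇒I e)) (∧E₂ h0))

⊆⇒extends : Γ ⊢ x ⊆ᵗ y → Γ ⊢ subF (y ▸ x ▸ none) extends
⊆⇒extends {x = x} {y} d = ⇒E (use core (y ▸ x ▸ none) []) d
  where
  core : [] ⊢ (v1 ⊆ᵗ v0) ⇒ extends
  core = inductC _ (base (imp (pre _ _) (ex* _ (eq _ _))))
    (⇒I (extendsI tε (⌢ε _ ⟫ ⊆ε⇒ h0)))
    (λ {c} b → ⇒I (∨E (⊆-bit⇒ b h0)
      (extendsE (⇒E h2 h0) (cast (sym (wkF-subF {σ = (v0 ⌢ c) ▸ v1 ▸ none} (λ _ → refl) extends))
         (extendsI (v0 ⌢ _) (⌢-bit (Bit-wk b) _ _ ⟫ ⌢-cong h0 (refl= _)))))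
      (extendsI tε (⌢ε _ ⟫ h0))))

⊆E : Γ ⊢ x ⊆ᵗ y → (wkT x ⌢ v0 ≐ wkT y) ∷ map wkF Γ ⊢ wkF ψ → Γ ⊢ ψ
⊆E d e = extendsE (⊆⇒extends d) e

ε-⊆ : ∀ (x : Term n) → Γ ⊢ tε ⊆ᵗ x
ε-⊆ x = ⊆-resp (refl= _) (ε⌢ x) (⊆-⌢ tε x)

⊆-trans : Γ ⊢ x ⊆ᵗ y → Γ ⊢ y ⊆ᵗ z → Γ ⊢ x ⊆ᵗ z
⊆-trans {x = x} {y} {z} d e = use core (z ▸ y ▸ x ▸ none) (d ∷ e ∷ [])
  where
  core : (v2 ⊆ᵗ v1) ∷ (v1 ⊆ᵗ v0) ∷ [] ⊢ v2 ⊆ᵗ v0 {2}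
  core = ⊆E h0 (⊆E h2 (≐⌢⇒⊆ (assoc _ _ _ ⟫ ⌢-cong h1 (refl= _) ⟫ h0)))

⊆-linear : Γ ⊢ x ⊆ᵗ z → Γ ⊢ y ⊆ᵗ z → Γ ⊢ (x ⊆ᵗ y) ∨ᶠ (y ⊆ᵗ x)
⊆-linear {x = x} {z} {y} d e = ⇒E (⇒E (use core (z ▸ y ▸ x ▸ none) []) d) e
  where
  core : [] ⊢ (v2 ⊆ᵗ v0) ⇒ (v1 ⊆ᵗ v0 {2}) ⇒ ((v2 ⊆ᵗ v1) ∨ᶠ (v1 ⊆ᵗ v2))
  core = inductC _ (base (imp (pre _ _) (imp (pre _ _) (or (pre _ _) (pre _ _)))))
    (⇒I (⇒I (∨I₁ (≐⇒⊆ (⊆ε⇒ h1 ⟫ sym≐ (⊆ε⇒ h0))))))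
    (λ b → ⇒I (⇒I (∨E (⊆-bit⇒ b h1)
      (∨E (⊆-bit⇒ b h1)
        (⇒E (⇒E (wk₁ h3) h1) h0)
        (∨I₁ (⊆-resp (refl= _) (sym≐ h0) h3)))
      (∨I₂ (⊆-resp (refl= _) (sym≐ h0) h1)))))

-- Lengths and the order by length

len-⌢ : ∀ x y → Γ ⊢ ∥ x ⌢ y ∥ ≐ ∥ x ∥ ⌢ ∥ y ∥
len-⌢ x y = ×-⌢ t1 x y

len-comm : ∀ x y → Γ ⊢ ∥ x ∥ ⌢ ∥ y ∥ ≐ ∥ y ∥ ⌢ ∥ x ∥
len-comm x y = use core (y ▸ x ▸ none) []
  where
  comm1 : [] ⊢ t1 ⌢ ∥ v0 ∥ ≐ ∥ v0 {0} ∥ ⌢ t1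
  comm1 = inductC _ (base (eq _ _)) (⌢-cong (refl= _) (×ε _) ⟫ ⌢ε _ ⟫ sym≐ (⌢-cong (×ε _) (refl= _) ⟫ ε⌢ _))
    (λ b → ⌢-cong (refl= _) (×-bit b _ _) ⟫ assoc _ _ _ ⟫ ⌢-cong h0 (refl= _) ⟫ sym≐
        (⌢-cong (×-bit b _ _) (refl= _)))
  core : [] ⊢ ∥ v1 ∥ ⌢ ∥ v0 ∥ ≐ ∥ v0 {1} ∥ ⌢ ∥ v1 ∥
  core = inductC _ (base (eq _ _)) (⌢-cong (refl= _) (×ε _) ⟫ ⌢ε _ ⟫ sym≐ (⌢-cong (×ε _) (refl= _) ⟫ ε⌢ _))
    (λ b → ⌢-cong (refl= _) (×-bit b _ _) ⟫ assoc _ _ _ ⟫ ⌢-cong h0 (refl= _) ⟫ sym≐ (assoc _ _ _)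
         ⟫ ⌢-cong (refl= _) (sym≐ (use comm1 (v1 ▸ none) [])) ⟫ assoc _ _ _ ⟫ ⌢-cong (sym≐ (×-bit b _ _))
             (refl= _))

len-comm-⌢ : ∀ x y → Γ ⊢ ∥ x ⌢ y ∥ ≐ ∥ y ⌢ x ∥
len-comm-⌢ x y = len-⌢ x y ⟫ len-comm x y ⟫ sym≐ (len-⌢ y x)

len-cancelʳ : Γ ⊢ x ⌢ ∥ z ∥ ≐ y ⌢ ∥ z ∥ → Γ ⊢ x ≐ y
len-cancelʳ {x = x} {z} {y} d = ⇒E (use core (z ▸ y ▸ x ▸ none) []) d
  where
  core : [] ⊢ (v2 ⌢ ∥ v0 {2} ∥ ≐ v1 ⌢ ∥ v0 ∥) ⇒ (v2 ≐ v1)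
  core = inductC _ (base (imp (eq _ _) (eq _ _)))
    (⇒I (sym≐ (⌢-cong (refl= _) (×ε _) ⟫ ⌢ε _) ⟫ h0 ⟫ ⌢-cong (refl= _) (×ε _) ⟫ ⌢ε _))
    (λ b → ⇒I (⇒E h1 (bit-injective 𝟙 (sym≐ (⌢-cong (refl= _) (×-bit b _ _) ⟫ assoc _ _ _)
      ⟫ h0 ⟫ (⌢-cong (refl= _) (×-bit b _ _) ⟫ assoc _ _ _)))))

len≐ε : Γ ⊢ ∥ x ∥ ≐ tε → Γ ⊢ x ≐ tε
len≐ε {x = x} d = ⇒E (use core (x ▸ none) []) d
  where
  core : [] ⊢ (∥ v0 {0} ∥ ≐ tε) ⇒ (v0 ≐ tε)
  core = inductC _ (base (imp (eq _ _) (eq _ _))) (⇒I (refl= _))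
    (λ b → ⇒I (⊥E (bit≢ε 𝟙 (sym≐ (×-bit b _ _) ⟫ h0))))

⌢-len : Γ ⊢ x ⌢ z ≐ y → Γ ⊢ ∥ x ∥ ≐ ∥ y ∥ → Γ ⊢ z ≐ tε
⌢-len {x = x} {z} d e = len≐ε (len-cancelʳ (len-comm z x ⟫ sym≐ (len-⌢ x z) ⟫ len-cong d ⟫ sym≐ e ⟫ sym≐
    (ε⌢ _)))

⊆-len : Γ ⊢ x ⊆ᵗ y → Γ ⊢ ∥ x ∥ ≐ ∥ y ∥ → Γ ⊢ x ≐ y
⊆-len {x = x} {y} d e = use core (y ▸ x ▸ none) (d ∷ e ∷ [])
  where
  core : (v1 ⊆ᵗ v0) ∷ (∥ v1 ∥ ≐ ∥ v0 ∥) ∷ [] ⊢ v1 ≐ v0 {1}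
  core = ⊆E h0 (sym≐ (⌢ε _) ⟫ ⌢-cong (refl= _) (sym≐ (⌢-len h0 h2)) ⟫ h0)

prefix-unique : Γ ⊢ x ⊆ᵗ z → Γ ⊢ y ⊆ᵗ z → Γ ⊢ ∥ x ∥ ≐ ∥ y ∥ → Γ ⊢ x ≐ y
prefix-unique d e f = ∨E (⊆-linear d e) (⊆-len h0 (wk₁ f)) (sym≐ (⊆-len h0 (wk₁ (sym≐ f))))

⊆⇒⪯ : Γ ⊢ x ⊆ᵗ y → Γ ⊢ x ⪯ y
⊆⇒⪯ {x = x} {y} d = use core (y ▸ x ▸ none) (d ∷ [])
  where
  core : (v1 ⊆ᵗ v0) ∷ [] ⊢ v1 ⪯ v0 {1}
  core = ⊆E h0 (≐⌢⇒⊆ (sym≐ (len-⌢ _ _) ⟫ len-cong h0))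

⌢-monoʳ : ∀ x → Γ ⊢ y ⊆ᵗ z → Γ ⊢ x ⌢ y ⊆ᵗ x ⌢ z
⌢-monoʳ {y = y} {z} x d = use core (z ▸ y ▸ x ▸ none) (d ∷ [])
  where
  core : (v1 ⊆ᵗ v0) ∷ [] ⊢ v2 ⌢ v1 ⊆ᵗ v2 ⌢ v0 {2}
  core = ⊆E h0 (≐⌢⇒⊆ (sym≐ (assoc _ _ _) ⟫ ⌢-cong (refl= _) h0))

⪯-refl : ∀ x → Γ ⊢ x ⪯ x
⪯-refl x = ⊆-refl _

len≐⇒⪯ : Γ ⊢ ∥ x ∥ ≐ ∥ y ∥ → Γ ⊢ x ⪯ y
len≐⇒⪯ = ≐⇒⊆

≐⇒⪯ : Γ ⊢ x ≐ y → Γ ⊢ x ⪯ y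
≐⇒⪯ d = len≐⇒⪯ (len-cong d)

⪯-⌢ˡ : ∀ x y → Γ ⊢ x ⪯ (x ⌢ y)
⪯-⌢ˡ x y = ⊆⇒⪯ (⊆-⌢ x y)

⪯-⌢ʳ : ∀ x y → Γ ⊢ y ⪯ (x ⌢ y)
⪯-⌢ʳ x y = ⊆-trans (⪯-⌢ˡ y x) (≐⇒⊆ (len-comm-⌢ y x))

⪯-⌢ : Γ ⊢ x ⪯ x′ → Γ ⊢ y ⪯ y′ → Γ ⊢ (x ⌢ y) ⪯ (x′ ⌢ y′)
⪯-⌢ d e = ⊆-resp (sym≐ (len-⌢ _ _)) (sym≐ (len-⌢ _ _))
  (⊆-trans (⌢-monoʳ _ e) (⊆-resp (len-comm _ _) (len-comm _ _) (⌢-monoʳ _ d)))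

-- The factors are enlarged one at a time. For the right one, `y` is replaced by `∥ y ∥`, which
-- leaves the product unchanged and turns the comparison of lengths into a prefix relation that
-- distributivity can use.
⪯-× : Γ ⊢ x ⪯ x′ → Γ ⊢ y ⪯ y′ → Γ ⊢ (x ×ᵗ y) ⪯ (x′ ×ᵗ y′)
⪯-× {x = x} {x′} {y} {y′} d e = ⊆-trans
  (⇒E (use left (y ▸ x′ ▸ x ▸ none) []) d) (⊆⇒⪯ (⊆-resp (×× 𝟙 _ _) (×× 𝟙 _ _)
      (use right (∥ y′ ∥ ▸ ∥ y ∥ ▸ x′ ▸ none) (e ∷ []))))
  where
  left : [] ⊢ (v2 ⪯ v1) ⇒ ((v2 ×ᵗ v0) ⪯ (v1 ×ᵗ v0 {2}))
  left = inductC _ (base (imp (pre _ _) (pre _ _)))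
    (⇒I (≐⇒⪯ (×ε _ ⟫ sym≐ (×ε _))))
    (λ b → ⇒I (⊆-resp (len-cong (sym≐ (×-bit b _ _))) (len-cong (sym≐ (×-bit b _ _))) (⪯-⌢ (⇒E h1 h0) h0)))
  right : (v1 ⊆ᵗ v0) ∷ [] ⊢ v2 ×ᵗ v1 ⊆ᵗ v2 ×ᵗ v0 {2}
  right = ⊆E h0 (≐⌢⇒⊆ (sym≐ (×-⌢ _ _ _) ⟫ ×-cong (refl= _) h0))

⪯-mono : ∀ (t : Term m) {σ τ : Fin m → Term n} → (∀ i → Γ ⊢ σ i ⪯ τ i) → Γ ⊢ subT σ t ⪯ subT τ t
⪯-mono (var i) d  = d i
⪯-mono tε d       = ⪯-refl _
⪯-mono t0 d       = ⪯-refl _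
⪯-mono t1 d       = ⪯-refl _
⪯-mono (s ⌢ t) d  = ⪯-⌢ (⪯-mono s d) (⪯-mono t d)
⪯-mono (s ×ᵗ t) d = ⪯-× (⪯-mono s d) (⪯-mono t d)

⪯-total : ∀ x y → Γ ⊢ (x ⪯ y) ∨ᶠ (y ⪯ x)
⪯-total x y = ⊆-linear (⪯-⌢ˡ x y) (⪯-⌢ʳ x y)

⊆-antisym : Γ ⊢ x ⊆ᵗ y → Γ ⊢ y ⊆ᵗ x → Γ ⊢ x ≐ y
⊆-antisym {x = x} {y} d e = use core (y ▸ x ▸ none) (d ∷ e ∷ [])
  where
  core : (v1 ⊆ᵗ v0) ∷ (v0 ⊆ᵗ v1) ∷ [] ⊢ v1 ≐ v0 {1}
  core = ⊆E h0 (⊆E h2 (sym≐ (⌢ε _) ⟫ ⌢-cong (refl= _) (sym≐ (⊆ε⇒ (≐⌢⇒⊆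
    (⌢-len (assoc _ _ _ ⟫ ⌢-cong h1 (refl= _) ⟫ h0) (refl= _))))) ⟫ h1))

first-bit-bit : Bit c → Γ ⊢ x ≐ tε → Γ ⊢ (t0 ⊆ᵗ x ⌢ c) ∨ᶠ (t1 ⊆ᵗ x ⌢ c)
first-bit-bit 𝟘 d = ∨I₁ (≐⇒⊆ (sym≐ (⌢-cong d (refl= _) ⟫ ε⌢ _)))
first-bit-bit 𝟙 d = ∨I₂ (≐⇒⊆ (sym≐ (⌢-cong d (refl= _) ⟫ ε⌢ _)))

first-bit : ∀ x → Γ ⊢ (x ≐ tε) ∨ᶠ ((t0 ⊆ᵗ x) ∨ᶠ (t1 ⊆ᵗ x))
first-bit x = use core (x ▸ none) []
  where
  core : [] ⊢ (v0 {0} ≐ tε) ∨ᶠ ((t0 ⊆ᵗ v0) ∨ᶠ (t1 ⊆ᵗ v0))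
  core = inductC _ (base (or (eq _ _) (or (pre _ _) (pre _ _)))) (∨I₁ (refl= _))
    (λ b → ∨E h0
      (∨I₂ (first-bit-bit b h0))
      (∨I₂ (∨E h0 (∨I₁ (⊆-trans h0 (⊆-⌢ _ _))) (∨I₂ (⊆-trans h0 (⊆-⌢ _ _))))))

snoc-⊈ : Bit c → Γ ⊢ x ⌢ c ⊆ᵗ x → Γ ⊢ ⊥ᶠ
snoc-⊈ b d = bit≢ε b (ε⌢ _ ⟫ ⌢-len (⊆-antisym d (⊆-⌢ _ _)) (refl= _))

-- If `c` and `d` differed, `x ⌢ (u ⌢ c)` and `x ⌢ (u ⌢ d)` would be prefixes of the same word, of
-- equal length but with different last letters.
bits-agree : Bit c → Bit d → Γ ⊢ x ⌢ y ≐ x ⌢ z → Γ ⊢ u ⌢ c ⊆ᵗ y → Γ ⊢ u ⌢ d ⊆ᵗ z → Γ ⊢ u ⌢ c ⊆ᵗ z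
bits-agree 𝟘 𝟘 e p q = q
bits-agree 𝟙 𝟙 e p q = q
bits-agree {u = u} b@𝟘 b′@𝟙 e p q = ⊥E (0≢1 (sym≐ (assoc _ _ _) ⟫
  prefix-unique (⊆-trans (⌢-monoʳ _ p) (≐⇒⊆ e)) (⌢-monoʳ _ q)
    (len-⌢ _ _ ⟫ ⌢-cong (refl= _) (len-⌢ u _ ⟫ ⌢-cong (refl= _) (×bit b _ ⟫ sym≐ (×bit b′ _)) ⟫ sym≐
        (len-⌢ u _)) ⟫ sym≐ (len-⌢ _ _))
  ⟫ assoc _ _ _))
bits-agree {u = u} b@𝟙 b′@𝟘 e p q = ⊥E (0≢1 (sym≐ (assoc _ _ _) ⟫ sym≐
  (prefix-unique (⊆-trans (⌢-monoʳ _ p) (≐⇒⊆ e)) (⌢-monoʳ _ q)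
    (len-⌢ _ _ ⟫ ⌢-cong (refl= _) (len-⌢ u _ ⟫ ⌢-cong (refl= _) (×bit b _ ⟫ sym≐ (×bit b′ _)) ⟫ sym≐
        (len-⌢ u _)) ⟫ sym≐ (len-⌢ _ _)))
  ⟫ assoc _ _ _))

-- By induction every prefix of y is one of z: after x u, the common word x y = x z has a single next letter.
⌢-cancelˡ : Γ ⊢ x ⌢ y ≐ x ⌢ z → Γ ⊢ y ≐ z
⌢-cancelˡ {x = x} {y} {z} d = ⊆-len
  (⇒E (⇒E (use core (y ▸ z ▸ y ▸ x ▸ none) []) d) (⊆-refl y))
  (len-cancelʳ (len-comm y x ⟫ sym≐ (len-⌢ x y) ⟫ len-cong d ⟫ len-⌢ x z ⟫ len-comm x z))
  where
  core : [] ⊢ (v3 ⌢ v2 ≐ v3 ⌢ v1) ⇒ (v0 {3} ⊆ᵗ v2) ⇒ (v0 ⊆ᵗ v1)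
  core = inductC _ (base (imp (eq _ _) (imp (pre _ _) (pre _ _))))
    (⇒I (⇒I (⊆-resp (refl= _) (ε⌢ _) (⊆-⌢ _ _))))
    (λ b → ⇒I (⇒I (⊆E (⇒E (⇒E h2 h1) (⊆-trans (⊆-⌢ _ _) h0))
      (∨E (first-bit v0)
        (⊥E (snoc-⊈ (Bit-wk b) (⊆-resp (assoc _ _ _) (h3 ⟫ ⌢-cong (refl= _)
           (sym≐ h1 ⟫ ⌢-cong (refl= _) h0 ⟫ ⌢ε _)) (⌢-monoʳ _ h2))))
        (∨E h0
          (bits-agree (Bit-wk b) 𝟘 (wk₁ h3) h3 (⊆-resp (refl= _) h2 (⌢-monoʳ _ h0)))
          (bits-agree (Bit-wk b) 𝟙 (wk₁ h3) h3 (⊆-resp (refl= _) h2 (⌢-monoʳ _ h0))))))))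

-- Words of zeros and the end marker

ε-zeros : Γ ⊢ x ≐ tε → Γ ⊢ x ≐ t0 ×ᵗ x
ε-zeros d = d ⟫ sym≐ (×ε _) ⟫ ×-cong (refl= _) (sym≐ d)

-- The equation `x ≐ t0 ×ᵗ x` expresses, without a quantifier, that `x` consists of zeros.
⊆-zeros : Γ ⊢ x ⊆ᵗ t0 ×ᵗ y → Γ ⊢ x ≐ t0 ×ᵗ x
⊆-zeros {x = x} {y} d = ⇒E (use core (y ▸ x ▸ none) []) d
  where
  core : [] ⊢ (v1 ⊆ᵗ t0 ×ᵗ v0 {1}) ⇒ (v1 ≐ t0 ×ᵗ v1)
  core = inductC _ (base (imp (pre _ _) (eq _ _)))
    (⇒I (ε-zeros (⊆ε⇒ (⊆-resp (refl= _) (×ε _) h0))))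
    (λ b → ⇒I (∨E (⊆-bit⇒ 𝟘 (⊆-resp (refl= _) (×-bit b _ _) h0))
      (⇒E h2 h0)
      (h0 ⟫ sym≐ (×-bit b _ _) ⟫ sym≐ (×× 𝟘 _ _) ⟫ ×-cong (refl= _) (×-bit b _ _ ⟫ sym≐ h0))))

-- If v1 were a proper prefix of v′1, the zeros after v1 would contain the last bit of v′1.
marker-⊈ : Γ ⊢ (v ⌢ t1) ⌢ (t0 ×ᵗ x) ≐ (w ⌢ t1) ⌢ (t0 ×ᵗ y) → Γ ⊢ (v ⌢ t1) ⊆ᵗ w → Γ ⊢ ⊥ᶠ
marker-⊈ {v = v} {x} {w} {y} d e = use core (y ▸ w ▸ x ▸ v ▸ none) (d ∷ e ∷ [])
  where
  core : ((v3 ⌢ t1) ⌢ (t0 ×ᵗ v2) ≐ (v1 ⌢ t1) ⌢ (t0 ×ᵗ v0)) ∷ ((v3 ⌢ t1) ⊆ᵗ v1) ∷ [] ⊢ ⊥ᶠ {4}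
  core = ⊆E h1 (0≢1 (sym≐ (×-bit 𝟙 _ _) ⟫ sym≐ (⊆-zeros (≐⌢⇒⊆ (⌢-cancelˡ
    (assoc _ _ _ ⟫ ⌢-cong (assoc _ _ _ ⟫ ⌢-cong h0 (refl= _)) (refl= _) ⟫ sym≐ h1))))))

-- `v ⌢ t1` and `w ⌢ t1` are prefixes of one word, hence comparable, and `marker-⊈` excludes that
-- either is strictly shorter.
marker-unique : Γ ⊢ (v ⌢ t1) ⌢ (t0 ×ᵗ x) ≐ (w ⌢ t1) ⌢ (t0 ×ᵗ y) → Γ ⊢ v ≐ w
marker-unique d = ∨E (⊆-linear (⊆-⌢ _ _) (⊆-resp (refl= _) (sym≐ d) (⊆-⌢ _ _)))
  (∨E (⊆-bit⇒ 𝟙 h0)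
    (⊥E (marker-⊈ (wk₁ (wk₁ d)) h0))
    (bit-injective 𝟙 h0))
  (∨E (⊆-bit⇒ 𝟙 h0)
    (⊥E (marker-⊈ (wk₁ (wk₁ (sym≐ d))) h0))
    (sym≐ (bit-injective 𝟙 h0)))

-- Words in the standard model

len-++ : ∀ x y → len (x ++ˢ y) ≡ len x + len y
len-++ x ε       = +-comm 0 (len x)
len-++ x (y ∙ b) = trans (cong suc (len-++ x y)) (sym (trans (+-comm (len x) (suc (len y)))
    (cong suc (+-comm (len y) (len x)))))

len-⊗ : ∀ x y → len (x ⊗ y) ≡ len x * len y
len-⊗ x ε       = sym (*-zeroʳ (len x))
len-⊗ x (y ∙ b) = trans (len-++ (x ⊗ y) x) (trans (cong (_+ len x) (len-⊗ x y))
  (trans (+-comm (len x * len y) (len x)) (sym (*-suc (len x) (len y)))))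

1ˢ : 𝕊
1ˢ = ε ∙ true

len-1⊗ : ∀ x → len (1ˢ ⊗ x) ≡ len x
len-1⊗ x = trans (len-⊗ 1ˢ x) (*-identityˡ (len x))

⊑⇒len≤ : ∀ {x y} → x ⊑ y → len x ≤ len y
⊑⇒len≤ ⊑-refl     = ≤-refl
⊑⇒len≤ (⊑-step p) = ≤-trans (⊑⇒len≤ p) (n≤1+n _)

len≡⇒1⊗≡ : ∀ x y → len x ≡ len y → 1ˢ ⊗ x ≡ 1ˢ ⊗ y
len≡⇒1⊗≡ ε ε e             = refl
len≡⇒1⊗≡ (x ∙ _) (y ∙ _) e = cong (_∙ true) (len≡⇒1⊗≡ x y (suc-injective e))

1⊗≡⇒len≡ : ∀ x y → 1ˢ ⊗ x ≡ 1ˢ ⊗ y → len x ≡ len y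
1⊗≡⇒len≡ x y e = trans (sym (len-1⊗ x)) (trans (cong len e) (len-1⊗ y))

len≤⇒1⊗⊑ : ∀ x y → len x ≤ len y → (1ˢ ⊗ x) ⊑ (1ˢ ⊗ y)
len≤⇒1⊗⊑ x y p with m≤n⇒m<n∨m≡n p
len≤⇒1⊗⊑ x y p | inj₂ e = subst ((1ˢ ⊗ x) ⊑_) (len≡⇒1⊗≡ x y e) ⊑-refl
len≤⇒1⊗⊑ x (y ∙ _) p | inj₁ (s≤s q) = ⊑-step (len≤⇒1⊗⊑ x y q)

1⊗⊑⇒len≤ : ∀ x y → (1ˢ ⊗ x) ⊑ (1ˢ ⊗ y) → len x ≤ len y
1⊗⊑⇒len≤ x y p = subst₂ _≤_ (len-1⊗ x) (len-1⊗ y) (⊑⇒len≤ p)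

⊑-unique : ∀ {x y z} → x ⊑ z → y ⊑ z → len x ≡ len y → x ≡ y
⊑-unique ⊑-refl ⊑-refl e         = refl
⊑-unique {x} ⊑-refl (⊑-step q) e = ⊥-elim (1+n≰n (≤-trans (≤-reflexive e) (⊑⇒len≤ q)))
⊑-unique (⊑-step p) ⊑-refl e     = ⊥-elim (1+n≰n (≤-trans (≤-reflexive (sym e)) (⊑⇒len≤ p)))
⊑-unique (⊑-step p) (⊑-step q) e = ⊑-unique p q e

⊑-++ : ∀ x y → x ⊑ (x ++ˢ y)
⊑-++ x ε       = ⊑-refl
⊑-++ x (y ∙ _) = ⊑-step (⊑-++ x y)

⊑-trans : ∀ {x y z} → x ⊑ y → y ⊑ z → x ⊑ z
⊑-trans p ⊑-refl     = p
⊑-trans p (⊑-step q) = ⊑-step (⊑-trans p q)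

truncLen-id : ∀ w n → len w ≤ n → truncLen w n ≡ w
truncLen-id ε n p = refl
truncLen-id (w ∙ b) n p with suc (len w) ≤? n
... | yes _ = refl
... | no ¬p = ⊥-elim (¬p p)

truncLen-⊑ : ∀ w n → truncLen w n ⊑ w
truncLen-⊑ ε n = ⊑-refl
truncLen-⊑ (w ∙ b) n with suc (len w) ≤? n
... | yes _ = ⊑-refl
... | no _  = ⊑-step (truncLen-⊑ w n)

truncLen-len : ∀ w n → n ≤ len w → len (truncLen w n) ≡ n
truncLen-len ε .0 z≤n = refl
truncLen-len (w ∙ b) n p with suc (len w) ≤? n
... | yes q = ≤-antisym q p
... | no ¬q = truncLen-len w n (≤-pred (≰⇒> ¬q))

truncLen-len≤ : ∀ w n → len (truncLen w n) ≤ n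
truncLen-len≤ ε n = z≤n
truncLen-len≤ (w ∙ b) n with suc (len w) ≤? n
... | yes q = q
... | no _  = truncLen-len≤ w n

semWk : (t : Term n) (y : 𝕊) (ρ : Fin n → 𝕊) → ⟦ wkT t ⟧ᵗ (y ∷ᵉ ρ) ≡ ⟦ t ⟧ᵗ ρ
semWk t y ρ = trans (cong (λ s → ⟦ s ⟧ᵗ (y ∷ᵉ ρ)) (renT≡subT suc t)) (semT t (λ _ → refl))

semT-mono : (t : Term n) {ρ ρ′ : Fin n → 𝕊} → (∀ i → len (ρ i) ≤ len (ρ′ i)) → len (⟦ t ⟧ᵗ ρ) ≤ len
    (⟦ t ⟧ᵗ ρ′)
semT-mono (var i) e  = e i
semT-mono tε e       = ≤-refl
semT-mono t0 e       = ≤-refl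
semT-mono t1 e       = ≤-refl
semT-mono (s ⌢ t) {ρ} {ρ′} e  = subst₂ _≤_ (sym (len-++ (⟦ s ⟧ᵗ ρ) _)) (sym (len-++ (⟦ s ⟧ᵗ ρ′) _))
    (+-mono-≤ (semT-mono s e) (semT-mono t e))
semT-mono (s ×ᵗ t) {ρ} {ρ′} e = subst₂ _≤_ (sym (len-⊗ (⟦ s ⟧ᵗ ρ) _)) (sym (len-⊗ (⟦ s ⟧ᵗ ρ′) _))
    (*-mono-≤ (semT-mono s e) (semT-mono t e))

-- Representable functions

Flip-resp : Γ ⊢ s ≐ t → Γ ⊢ Flip s → Γ ⊢ Flip t
Flip-resp {s = s} {t} d e = use core (t ▸ s ▸ none) (d ∷ e ∷ [])
  where
  core : (v1 ≐ v0) ∷ Flip v1 ∷ [] ⊢ Flip {2} v0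
  core = subst= (Flip v0) h0 h1

subT-≐ : ∀ (t : Term m) {σ τ : Fin m → Term n} → (∀ i → Γ ⊢ σ i ≐ τ i) → Γ ⊢ subT σ t ≐ subT τ t
subT-≐ (var i) e  = e i
subT-≐ tε e       = refl= _
subT-≐ t0 e       = refl= _
subT-≐ t1 e       = refl= _
subT-≐ (s ⌢ t) e  = ⌢-cong (subT-≐ s e) (subT-≐ t e)
subT-≐ (s ×ᵗ t) e = ×-cong (subT-≐ s e) (subT-≐ t e)

-- Replaces all variables simultaneously, also below quantifiers, which a single use of `subst=`
-- does not give. The premise of an implication is transported back along the reversed equations.
subF-≐ : ∀ (φ : Formula m) {σ τ : Fin m → Term n} → (∀ i → Γ ⊢ σ i ≐ τ i) → Γ ⊢ subF σ φ → Γ ⊢ subF τ φ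
subF-≐ (s ≐ t) e d  = sym≐ (subT-≐ s e) ⟫ d ⟫ subT-≐ t e
subF-≐ (s ⊆ᵗ t) e d = ⊆-resp (subT-≐ s e) (subT-≐ t e) d
subF-≐ (Flip t) e d = Flip-resp (subT-≐ t e) d
subF-≐ ⊥ᶠ e d       = d
subF-≐ (φ ⇒ ψ) e d  = ⇒I (subF-≐ ψ (wk₁ ∘ e) (⇒E (wk₁ d) (subF-≐ φ (sym≐ ∘ wk₁ ∘ e) h0)))
subF-≐ (φ ∧ᶠ ψ) e d = ∧I (subF-≐ φ e (∧E₁ d)) (subF-≐ ψ e (∧E₂ d))
subF-≐ (φ ∨ᶠ ψ) e d = ∨E d (∨I₁ (subF-≐ φ (wk₁ ∘ e) h0)) (∨I₂ (subF-≐ ψ (wk₁ ∘ e) h0))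
subF-≐ (∀ᶠ φ) {σ} {τ} e d = ∀I′ τ φ (subF-≐ φ
  {σ = v0 ▸ (wkT ∘ σ)} (λ { zero → refl= _ ; (suc i) → up (e i) })
  (∀E′ (wkT ∘ σ) φ (cast (wkF-subF (λ _ → refl) (∀ᶠ φ)) (up d)) v0))
subF-≐ (∃ᶠ φ) {σ} {τ} e d = ∃E′ σ φ d (cast (sym (wkF-subF (λ _ → refl) (∃ᶠ φ)))
  (∃I′ (wkT ∘ τ) φ v0 (subF-≐ φ {σ = v0 ▸ (wkT ∘ σ)} (λ { zero → refl= _ ; (suc i) → up₁ (e i) }) h0)))

excluded-middle : ∀ (φ : Formula n) → Γ ⊢ φ ∨ᶠ (¬ᶠ φ)
excluded-middle φ = raa (⇒E h0 (∨I₂ (⇒I (⇒E h1 (∨I₁ h0)))))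

cong-▸ : {A : Set} {a : A} {σ τ : Fin n → A} → (∀ i → σ i ≡ τ i) → ∀ i → (a ▸ σ) i ≡ (a ▸ τ) i
cong-▸ e zero    = refl
cong-▸ e (suc i) = e i

Fun : ℕ → Set
Fun n = (Fin n → 𝕊) → 𝕆 → 𝕊

-- In the defining formula, variable 0 is the value and variable i + 1 the i-th argument.
record Rel (n : ℕ) (f : Fun n) : Set where
  field
    F      : Formula (suc n)
    F-Σ₁   : Σᵇ₁ F
    B      : Term n
    tot    : ∀ {m} {Γ : List (Formula m)} (σ : Fin n → Term m) → Γ ⊢ subF σ (∃ᶠ F)
    uni    : ∀ {m} {Γ : List (Formula m)} (σ : Fin n → Term m) {y z} →
             Γ ⊢ subF (y ▸ σ) F → Γ ⊢ subF (z ▸ σ) F → Γ ⊢ y ≐ z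
    bnd    : ∀ {m} {Γ : List (Formula m)} (σ : Fin n → Term m) {y} →
             Γ ⊢ subF (y ▸ σ) F → Γ ⊢ y ⪯ subT σ B
    sem    : ∀ ρ η {y} → (⟦ F ⟧ᶠ η (y ∷ᵉ ρ) → f ρ η ≡ y) × (f ρ η ≡ y → ⟦ F ⟧ᶠ η (y ∷ᵉ ρ))
    semBnd : ∀ ρ η → len (f ρ η) ≤ len (⟦ B ⟧ᵗ ρ)

  totE : (σ : Fin n → Term m) → (subF (v0 ▸ (wkT ∘ σ)) F ∷ map wkF Γ) ⊢ wkF ψ → Γ ⊢ ψ
  totE σ d = ∃E′ σ F (tot σ) d

  totE′ : (σ : Fin n → Term m) {τ : Fin k → Term m} (ψ : Formula k) →
          (subF (v0 ▸ (wkT ∘ σ)) F ∷ map wkF Γ) ⊢ subF (wkT ∘ τ) ψ → Γ ⊢ subF τ ψ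
  totE′ σ ψ d = totE σ (cast (sym (wkF-subF (λ _ → refl) ψ)) d)

  uni′ : {σ τ : Fin n → Term m} → (∀ i → Γ ⊢ σ i ≐ τ i) →
         Γ ⊢ subF (y ▸ σ) F → Γ ⊢ subF (z ▸ τ) F → Γ ⊢ y ≐ z
  uni′ {τ = τ} e p q = uni τ (subF-≐ F (λ { zero → refl= _ ; (suc i) → e i }) p) q

  -- The formula sees the environment only pointwise, so the represented function does too.
  f-cong : ∀ {ρ ρ′} → (∀ i → ρ i ≡ ρ′ i) → ∀ η → f ρ η ≡ f ρ′ η
  f-cong {ρ} {ρ′} e η = sym (proj₁ (sem ρ′ η) (proj₁ (semF F {σ = var} (cong-▸ e))
    (subst (λ φ → ⟦ φ ⟧ᶠ η (f ρ η ∷ᵉ ρ)) (sym (subF-var F)) (proj₂ (sem ρ η) refl))))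

open Rel

Rel-resp : {f g : Fun n} → (∀ ρ η → f ρ η ≡ g ρ η) → Rel n f → Rel n g
Rel-resp e R = record
  { F = F R ; F-Σ₁ = F-Σ₁ R ; B = B R ; tot = tot R ; uni = uni R ; bnd = bnd R
  ; sem = λ ρ η → (λ p → trans (sym (e ρ η)) (proj₁ (sem R ρ η) p)) ,
      (λ p → proj₂ (sem R ρ η) (trans (e ρ η) p))
  ; semBnd = λ ρ η → subst (λ x → len x ≤ len (⟦ B R ⟧ᵗ ρ)) (e ρ η) (semBnd R ρ η)
  }

termR : (t : Term n) → Rel n (λ ρ η → ⟦ t ⟧ᵗ ρ)
termR {n} t = record
  { F      = v0 ≐ wkT t
  ; F-Σ₁   = base (eq _ _)
  ; B      = t
  ; tot    = λ σ → ∃I′ σ (v0 ≐ wkT t) (subT σ t) (at⁻ σ (refl= _))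
  ; uni    = λ σ d e → at σ d ⟫ sym≐ (at σ e)
  ; bnd    = λ σ d → ≐⇒⪯ (at σ d)
  ; sem    = λ ρ η {y} → (λ p → sym (trans p (semWk t y ρ))) , (λ p → sym (trans (semWk t y ρ) p))
  ; semBnd = λ ρ η → ≤-refl
  }
  where
  at : (σ : Fin n → Term m) → Γ ⊢ subF (y ▸ σ) (v0 ≐ wkT t) → Γ ⊢ y ≐ subT σ t
  at {y = y} σ = cast (cong (y ≐_) (∷ᵉ-wkT y σ t))
  at⁻ : (σ : Fin n → Term m) → Γ ⊢ y ≐ subT σ t → Γ ⊢ subF (y ▸ σ) (v0 ≐ wkT t)
  at⁻ {y = y} σ = cast (cong (y ≐_) (sym (∷ᵉ-wkT y σ t)))

subR : {f : Fun n} (τ : Fin n → Term m) → Rel n f → Rel m (λ ρ η → f (λ i → ⟦ τ i ⟧ᵗ ρ) η)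
subR {n} {m} τ R = record
  { F      = subF (exts τ) (F R)
  ; F-Σ₁   = Σ₁-sub (exts τ) (F-Σ₁ R)
  ; B      = subT τ (B R)
  ; tot    = λ σ → cast (sym (subF-fuse (λ _ → refl) (∃ᶠ (F R)))) (tot R (subT σ ∘ τ))
  ; uni    = λ σ d e → uni R (subT σ ∘ τ) (at σ d) (at σ e)
  ; bnd    = λ σ {y} d → cast (cong (y ⪯_) (sym (subT-subT σ τ (B R)))) (bnd R (subT σ ∘ τ) (at σ d))
  ; sem    = λ ρ η {y} →
      (λ p → proj₁ (sem R _ η) (proj₁ (semF (F R) {σ = exts τ} (semExts {σ = τ} (λ _ → refl) y)) p)) ,
      (λ p → proj₂ (semF (F R) {σ = exts τ} (semExts {σ = τ} (λ _ → refl) y)) (proj₂ (sem R _ η) p))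
  ; semBnd = λ ρ η → ≤-trans (semBnd R _ η) (≤-reflexive (cong len (sym (semT (B R) (λ _ → refl)))))
  }
  where
  at : (σ : Fin m → Term k) → Γ ⊢ subF (y ▸ σ) (subF (exts τ) (F R)) → Γ ⊢ subF (y ▸ (subT σ ∘ τ)) (F R)
  at {y = y} σ = cast (subF-fuse (λ { zero → refl ; (suc i) → ∷ᵉ-wkT y σ (τ i) }) (F R))

-- Composition

module Let {n} {g : Fun n} {h : Fun (suc n)} (G : Rel n g) (H : Rel (suc n) h) where

  -- Under the quantifier the intermediate value is variable 0 and the output variable 1; `F H`
  -- expects them in the opposite order.
  swap : Fin (suc (suc n)) → Fin (suc (suc n))
  swap zero          = suc zero
  swap (suc zero)    = zero
  swap (suc (suc i)) = suc (suc i)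

  body : Formula (suc (suc n))
  body = renF (ext suc) (F G) ∧ᶠ renF swap (F H)

  formula : Formula (suc n)
  formula = ∃⪯ (wkT (B G)) body

  atG : {σ : Fin n → Term m} → subF (z ▸ y ▸ σ) (renF (ext suc) (F G)) ≡ subF (z ▸ σ) (F G)
  atG = subF-renF (λ { zero → refl ; (suc i) → refl }) (F G)

  atH : {σ : Fin n → Term m} → subF (z ▸ y ▸ σ) (renF swap (F H)) ≡ subF (y ▸ z ▸ σ) (F H)
  atH = subF-renF (λ { zero → refl ; (suc zero) → refl ; (suc (suc i)) → refl }) (F H)

  intro : (σ : Fin n → Term m) → Γ ⊢ subF (z ▸ σ) (F G) → Γ ⊢ subF (y ▸ z ▸ σ) (F H) → Γ ⊢ subF (y ▸ σ)
      formula
  intro {z = z} {y} σ p q = ∃I′ (y ▸ σ) ((v0 ⪯ wkT (wkT (B G))) ∧ᶠ body) z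
    (∧I (cast (cong (z ⪯_) (sym (trans (∷ᵉ-wkT z (y ▸ σ) (wkT (B G))) (∷ᵉ-wkT y σ (B G))))) (bnd G σ p))
        (∧I (cast (sym atG) p) (cast (sym atH) q)))

  elim : (σ : Fin n → Term m) → Γ ⊢ subF (y ▸ σ) formula →
         (subF (wkT y ▸ v0 ▸ (wkT ∘ σ)) (F H) ∷ subF (v0 ▸ (wkT ∘ σ)) (F G) ∷ map wkF Γ) ⊢ wkF ψ → Γ ⊢ ψ
  elim {y = y} σ d e = ∃E′ (y ▸ σ) ((v0 ⪯ wkT (wkT (B G))) ∧ᶠ body) d
    (⇒E (⇒E (wk₁ (⇒I (⇒I e))) (cast eqG (∧E₁ (∧E₂ h0)))) (cast eqH (∧E₂ (∧E₂ h0))))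
    where
    eqG : subF (v0 ▸ (wkT ∘ (y ▸ σ))) (renF (ext suc) (F G)) ≡ subF (v0 ▸ (wkT ∘ σ)) (F G)
    eqG = subF-renF (λ { zero → refl ; (suc i) → refl }) (F G)
    eqH : subF (v0 ▸ (wkT ∘ (y ▸ σ))) (renF swap (F H)) ≡ subF (wkT y ▸ v0 ▸ (wkT ∘ σ)) (F H)
    eqH = subF-renF (λ { zero → refl ; (suc zero) → refl ; (suc (suc i)) → refl }) (F H)

  unique : (σ : Fin n → Term m) → Γ ⊢ subF (y ▸ σ) formula → Γ ⊢ subF (z ▸ σ) formula → Γ ⊢ y ≐ z
  unique {y = y} {z} σ d e = elim σ d (elim (wkT ∘ σ)
    (cast (wkF-subF (λ { zero → refl ; (suc i) → refl }) formula) (wk₁ (wk₁ (up e))))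
    (uni′ H {σ = v1 ▸ (wkT ∘ wkT ∘ σ)} {τ = v0 ▸ (wkT ∘ wkT ∘ σ)}
        (λ { zero → uni G (wkT ∘ wkT ∘ σ) (cast (wkF-subF (λ { zero → refl ; (suc i) → refl }) (F G))
            (hyp (there (there (there (here refl)))))) h1
               ; (suc i) → refl= _ })
      (cast (wkF-subF (λ { zero → refl ; (suc zero) → refl ; (suc (suc i)) → refl }) (F H)) h2) h0))

  bound-eq : (σ : Fin n → Term m) →
             subT (subT (wkT ∘ σ) (B G) ▸ (wkT ∘ σ)) (B H) ≡ wkT (subT σ (subT (B G ▸ var) (B H)))
  bound-eq σ = sym (trans (cong wkT (subT-subT σ (B G ▸ var) (B H)))
    (trans (renT-subT suc _ (B H)) (subT-cong (λ { zero → renT-subT suc σ (B G) ; (suc i) → refl }) (B H))))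

  -- The unit from which composition is iterated. The bound of `g` serves twice: it bounds the
  -- quantifier over the intermediate value, and it replaces that value in the bound of `h`, which
  -- is sound by monotonicity of terms.
  letR : Rel n (λ ρ η → h (g ρ η ∷ᵉ ρ) η)
  letR = record
    { F      = formula
    ; F-Σ₁   = ex⪯ (wkT (B G)) (and (Σ₁-ren (ext suc) (F-Σ₁ G)) (Σ₁-ren swap (F-Σ₁ H)))
    ; B      = subT (B G ▸ var) (B H)
    ; tot    = λ σ → totE′ G σ (∃ᶠ formula) (totE′ H (v0 ▸ (wkT ∘ σ)) (∃ᶠ formula)
        (∃I′ _ formula v0 (intro _
          (cast (wkF-subF (λ { zero → refl ; (suc i) → refl }) (F G)) h1)
          (cast (subF-cong (λ { zero → refl ; (suc zero) → refl ; (suc (suc i)) → refl }) (F H)) h0))))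
    ; uni    = λ σ → unique σ
    ; bnd    = λ σ {y} d → elim σ d (cast (cong (wkT y ⪯_) (bound-eq σ)) (⊆-trans (bnd H _ h0)
        (⪯-mono (B H) (λ { zero → bnd G (wkT ∘ σ) h1 ; (suc i) → ⪯-refl _ }))))
    ; sem    = λ ρ η {y} →
        (λ (z , _ , p , q) → trans
          (f-cong H (λ { zero → proj₁ (sem G ρ η) (proj₁ (semR (F G) (λ { zero → refl ; (suc i) → refl }))
              p) ; (suc i) → refl }) η)
          (proj₁ (sem H (z ∷ᵉ ρ) η) (proj₁ (semR (F H) (λ
              { zero → refl ; (suc zero) → refl ; (suc (suc i)) → refl })) q))) ,
        (λ p → g ρ η ,
          len≤⇒1⊗⊑ _ _ (≤-trans (semBnd G ρ η) (≤-reflexive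
              (cong len (sym (trans (semWk (wkT (B G)) _ _) (semWk (B G) _ _)))))) ,
          proj₂ (semR (F G) (λ { zero → refl ; (suc i) → refl })) (proj₂ (sem G ρ η) refl) ,
          proj₂ (semR (F H) (λ { zero → refl ; (suc zero) → refl ; (suc (suc i)) → refl }))
              (proj₂ (sem H _ η) p))
    ; semBnd = λ ρ η → ≤-trans (semBnd H _ η) (≤-trans
        (semT-mono (B H) (λ { zero → semBnd G ρ η ; (suc i) → ≤-refl }))
        (≤-reflexive (cong len (sym (semT (B H) {ρ = ρ} {ρ′ = ⟦ B G ⟧ᵗ ρ ∷ᵉ ρ}
            (λ { zero → refl ; (suc i) → refl }))))))
    }

open Let using (letR)

append : {A : Set} → (Fin k → A) → (Fin m → A) → Fin (k + m) → A
append {zero}  a b = b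
append {suc k} a b = a zero ▸ append (a ∘ suc) b

append-↑ʳ : {A : Set} (a : Fin k → A) (b : Fin m → A) → ∀ i → append a b (k ↑ʳ i) ≡ b i
append-↑ʳ {zero} a b i  = refl
append-↑ʳ {suc k} a b i = append-↑ʳ (a ∘ suc) b i

append-↑ˡ : {A : Set} (a : Fin k → A) (b : Fin m → A) → ∀ i → append a b (i ↑ˡ m) ≡ a i
append-↑ˡ {suc k} a b zero    = refl
append-↑ˡ {suc k} a b (suc i) = append-↑ˡ (a ∘ suc) b i

-- The inner functions are plugged in one after another from the front. The original arguments wait
-- in the last `m` places, since each remaining `g i` still has to read them.
compR′ : ∀ k {m} {h : Fun (k + m)} {g : Fin k → Fun m} → Rel (k + m) h → (∀ i → Rel m (g i)) →
         Rel m (λ ρ η → h (append (λ i → g i ρ η) ρ) η)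
compR′ zero H G        = H
compR′ (suc k) {g = g} H G = Rel-resp
  (λ ρ η → f-cong H (λ { zero → f-cong (G zero) (append-↑ʳ (λ i → g (suc i) ρ η) ρ) η ; (suc i) → refl }) η)
  (compR′ k (letR (subR (λ i → var (k ↑ʳ i)) (G zero)) H) (G ∘ suc))

compR : {h : Fun k} {g : Fin k → Fun m} → Rel k h → (∀ i → Rel m (g i)) → Rel m (λ ρ η → h (λ i → g i ρ η) η)
compR {k} {m} {g = g} H G = Rel-resp (λ ρ η → f-cong H (append-↑ˡ (λ i → g i ρ η) ρ) η)
  (compR′ k (subR (λ i → var (i ↑ˡ m)) H) G)

-- Definition by cases

module If {n} (χ : Formula n) (χ-Σ₀ : Σᵇ₀ χ) (b : (Fin n → 𝕊) → 𝕆 → Bool)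
          (χ-sem : ∀ ρ η → (⟦ χ ⟧ᶠ η ρ → b ρ η ≡ true) × (b ρ η ≡ true → ⟦ χ ⟧ᶠ η ρ))
          {f g : Fun n} (R : Rel n f) (S : Rel n g) where

  -- The condition also occurs negated, and negation stays within Σᵇ₁ only for Σᵇ₀ formulas; hence
  -- the demand on `χ`.
  formula : Formula (suc n)
  formula = (wkF χ ∧ᶠ F R) ∨ᶠ ((¬ᶠ wkF χ) ∧ᶠ F S)

  at : (σ : Fin n → Term m) (y : Term m) → subF (y ▸ σ) (wkF χ) ≡ subF σ χ
  at σ y = subF-renF (λ _ → refl) χ

  thenI : (σ : Fin n → Term m) → Γ ⊢ subF σ χ → Γ ⊢ subF (y ▸ σ) (F R) → Γ ⊢ subF (y ▸ σ) formula
  thenI {y = y} σ c d = ∨I₁ (∧I (cast (sym (at σ y)) c) d)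

  elseI : (σ : Fin n → Term m) → Γ ⊢ ¬ᶠ subF σ χ → Γ ⊢ subF (y ▸ σ) (F S) → Γ ⊢ subF (y ▸ σ) formula
  elseI {y = y} σ c d = ∨I₂ (∧I (cast (cong ¬ᶠ_ (sym (at σ y))) c) d)

  thenE : (σ : Fin n → Term m) → Γ ⊢ subF (y ▸ σ) formula → Γ ⊢ subF σ χ → Γ ⊢ subF (y ▸ σ) (F R)
  thenE {y = y} σ d c = ∨E d (∧E₂ h0) (⊥E (⇒E (∧E₁ h0) (cast (sym (at σ y)) (wk₁ c))))

  elseE : (σ : Fin n → Term m) → Γ ⊢ subF (y ▸ σ) formula → Γ ⊢ ¬ᶠ subF σ χ → Γ ⊢ subF (y ▸ σ) (F S)
  elseE {y = y} σ d c = ∨E d (⊥E (⇒E (wk₁ c) (cast (at σ y) (∧E₁ h0)))) (∧E₂ h0)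

  ifR : Rel n (λ ρ η → if b ρ η then f ρ η else g ρ η)
  ifR = record
    { F      = formula
    ; F-Σ₁   = or (and (Σ₁-ren suc (base χ-Σ₀)) (F-Σ₁ R)) (and (base (imp wk-Σ₀ bot)) (F-Σ₁ S))
    ; B      = B R ⌢ B S
    ; tot    = λ σ → ∨E (excluded-middle (subF σ χ))
        (totE′ R σ (∃ᶠ formula) (∃I′ _ formula v0 (thenI _ (cast (wkF-subF (λ _ → refl) χ) h1) h0)))
        (totE′ S σ (∃ᶠ formula) (∃I′ _ formula v0 (elseI _ (cast (wkF-subF (λ _ → refl) (¬ᶠ χ)) h1) h0)))
    ; uni    = λ σ d e → ∨E (excluded-middle (subF σ χ))
        (uni R σ (thenE σ (wk₁ d) h0) (thenE σ (wk₁ e) h0))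
        (uni S σ (elseE σ (wk₁ d) h0) (elseE σ (wk₁ e) h0))
    ; bnd    = λ σ d → ∨E (excluded-middle (subF σ χ))
        (⊆-trans (bnd R σ (thenE σ (wk₁ d) h0)) (⪯-⌢ˡ _ _))
        (⊆-trans (bnd S σ (elseE σ (wk₁ d) h0)) (⪯-⌢ʳ _ _))
    ; sem    = λ ρ η → semIf ρ η (proj₁ (χ-sem ρ η)) (proj₂ (χ-sem ρ η)) , semIf⁻ ρ η (proj₁ (χ-sem ρ η))
        (proj₂ (χ-sem ρ η))
    ; semBnd = λ ρ η → ≤-trans (bound ρ η) (≤-reflexive (sym (len-++ (⟦ B R ⟧ᵗ ρ) (⟦ B S ⟧ᵗ ρ))))
    }
    where
    wk-Σ₀ : Σᵇ₀ (wkF χ)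
    wk-Σ₀ = subst Σᵇ₀ (sym (renF≡subF suc χ)) (Σ₀-sub (var ∘ suc) χ-Σ₀)
    semIf : ∀ ρ η {y} → (⟦ χ ⟧ᶠ η ρ → b ρ η ≡ true) → (b ρ η ≡ true → ⟦ χ ⟧ᶠ η ρ) →
            ⟦ formula ⟧ᶠ η (y ∷ᵉ ρ) → (if b ρ η then f ρ η else g ρ η) ≡ y
    semIf ρ η p q (inj₁ (c , r)) rewrite p (proj₁ (semR χ (λ _ → refl)) c) = proj₁ (sem R ρ η) r
    semIf ρ η p q (inj₂ (c , r)) with b ρ η
    ... | true  = ⊥-elim (c (proj₂ (semR χ (λ _ → refl)) (q refl)))
    ... | false = proj₁ (sem S ρ η) r
    semIf⁻ : ∀ ρ η {y} → (⟦ χ ⟧ᶠ η ρ → b ρ η ≡ true) → (b ρ η ≡ true → ⟦ χ ⟧ᶠ η ρ) →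
             (if b ρ η then f ρ η else g ρ η) ≡ y → ⟦ formula ⟧ᶠ η (y ∷ᵉ ρ)
    semIf⁻ ρ η p q e with b ρ η
    ... | true  = inj₁ (proj₂ (semR χ (λ _ → refl)) (q refl) , proj₂ (sem R ρ η) e)
    ... | false = inj₂ ((λ c → case (p (proj₁ (semR χ (λ _ → refl)) c))) , proj₂ (sem S ρ η) e)
      where
      case : ∀ {A : Set} → false ≡ true → A
      case ()
    bound : ∀ ρ η → len (if b ρ η then f ρ η else g ρ η) ≤ len (⟦ B R ⟧ᵗ ρ) + len (⟦ B S ⟧ᵗ ρ)
    bound ρ η with b ρ η
    ... | true  = ≤-trans (semBnd R ρ η) (m≤m+n _ _)
    ... | false = ≤-trans (semBnd S ρ η) (m≤n+m _ _)

open If using (ifR)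

-- Predecessor, truncation, conditional and query

initˢ : 𝕊 → 𝕊
initˢ ε       = ε
initˢ (u ∙ _) = u

snocOf : Formula 2
snocOf = (v0 ⌢ t0 ≐ v1) ∨ᶠ (v0 ⌢ t1 ≐ v1)

snocOfE : Γ ⊢ subF (y ▸ u ▸ none) snocOf → (∀ {c} → Bit c → (y ⌢ c ≐ u) ∷ Γ ⊢ ψ) → Γ ⊢ ψ
snocOfE d e = ∨E d (e 𝟘) (e 𝟙)

snocOfI : Bit c → Γ ⊢ subF (y ▸ (y ⌢ c) ▸ none) snocOf
snocOfI 𝟘 = ∨I₁ (refl= _)
snocOfI 𝟙 = ∨I₂ (refl= _)

snoc-injective : Bit c → Bit d → Γ ⊢ y ⌢ c ≐ u → Γ ⊢ z ⌢ d ≐ u → Γ ⊢ y ≐ z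
snoc-injective 𝟘 𝟘 p q = bit-injective 𝟘 (p ⟫ sym≐ q)
snoc-injective 𝟙 𝟙 p q = bit-injective 𝟙 (p ⟫ sym≐ q)
snoc-injective 𝟘 𝟙 p q = ⊥E (0≢1 (p ⟫ sym≐ q))
snoc-injective 𝟙 𝟘 p q = ⊥E (0≢1 (q ⟫ sym≐ p))

isInit : Formula 2
isInit = ((v1 ≐ tε) ∧ᶠ (v0 ≐ tε)) ∨ᶠ snocOf

isInit-unique : Γ ⊢ subF (y ▸ u ▸ none) isInit → Γ ⊢ subF (z ▸ u ▸ none) isInit → Γ ⊢ y ≐ z
isInit-unique {y = y} {u} {z} d e = ∨E d
  (∨E (wk₁ e) (∧E₂ h1 ⟫ sym≐ (∧E₂ h0)) (snocOfE h0 (λ b → ⊥E (bit≢ε b (h0 ⟫ ∧E₁ h2)))))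
  (∨E (wk₁ e)
    (snocOfE h1 (λ b → ⊥E (bit≢ε b (h0 ⟫ ∧E₁ h1))))
    (snocOfE h1 (λ b → snocOfE h1 (λ b′ → snoc-injective b b′ h1 h0))))

isInit-bound : Γ ⊢ subF (y ▸ u ▸ none) isInit → Γ ⊢ y ⪯ u
isInit-bound d = ∨E d (≐⇒⪯ (∧E₂ h0 ⟫ sym≐ (∧E₁ h0))) (snocOfE h0 (λ b → ⊆⇒⪯ (≐⌢⇒⊆ h0)))

-- A case distinction on the last letter, obtained by induction. The induction formula must carry a
-- bounded quantifier; the bound is discarded at the end.
isInit-total : ∀ (u : Term n) → Γ ⊢ subF (u ▸ none) (∃ᶠ isInit)
isInit-total u = ∃E′ (u ▸ none) ((v0 ⪯ v1) ∧ᶠ isInit)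
  (induct none (∃⪯ v0 isInit) (ex⪯ v0 (base (or (and (eq _ _) (eq _ _)) (or (eq _ _) (eq _ _)))))
    (witness tε (∨I₁ (∧I (refl= _) (refl= _))))
    (λ b → witness v0 (∨I₂ (snocOfI b))) u)
  (cast (sym (wkF-subF {σ = u ▸ none} (λ _ → refl) (∃ᶠ isInit)))
    (∃I′ (wkT ∘ (u ▸ none)) isInit v0 (∧E₂ h0)))
  where
  witness : ∀ {m} {u : Term m} {Γ} y → Γ ⊢ subF (y ▸ u ▸ none) isInit → Γ ⊢ subF (u ▸ none) (∃⪯ v0 isInit)
  witness {u = u} y d = ∃I′ (u ▸ none) ((v0 ⪯ v1) ∧ᶠ isInit) y (∧I (isInit-bound d) d)

initR : Rel 1 (λ ρ η → initˢ (ρ zero))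
initR = record
  { F      = isInit
  ; F-Σ₁   = base (or (and (eq _ _) (eq _ _)) (or (eq _ _) (eq _ _)))
  ; B      = v0
  ; tot    = λ σ → cast (subF-cong {σ = σ zero ▸ none} {τ = σ} (λ { zero → refl }) (∃ᶠ isInit))
      (isInit-total (σ zero))
  ; uni    = λ σ → isInit-unique
  ; bnd    = λ σ → isInit-bound
  ; sem    = λ ρ η → to (ρ zero) , from (ρ zero)
  ; semBnd = λ ρ η → bound (ρ zero)
  }
  where
  to : ∀ u {y} → ((u ≡ ε) × (y ≡ ε)) ⊎ ((y ∙ false ≡ u) ⊎ (y ∙ true ≡ u)) → initˢ u ≡ y
  to u (inj₁ (refl , refl)) = refl
  to u (inj₂ (inj₁ refl))   = refl
  to u (inj₂ (inj₂ refl))   = refl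
  from : ∀ u {y} → initˢ u ≡ y → ((u ≡ ε) × (y ≡ ε)) ⊎ ((y ∙ false ≡ u) ⊎ (y ∙ true ≡ u))
  from ε refl           = inj₁ (refl , refl)
  from (u ∙ false) refl = inj₂ (inj₁ refl)
  from (u ∙ true) refl  = inj₂ (inj₂ refl)
  bound : ∀ u → len (initˢ u) ≤ len u
  bound ε       = z≤n
  bound (u ∙ _) = n≤1+n _

-- The two clauses overlap when `w` and `t` have the same length; `whole`, in the proof of
-- uniqueness, shows that they then describe the same word.
isTrunc : Formula 3
isTrunc = ((v1 ⪯ v2) ∧ᶠ (v0 ≐ v1)) ∨ᶠ ((v0 ⊆ᵗ v1) ∧ᶠ (∥ v0 ∥ ≐ ∥ v2 ∥))

isTrunc-unique : Γ ⊢ subF (x ▸ w ▸ t ▸ none) isTrunc → Γ ⊢ subF (y ▸ w ▸ t ▸ none) isTrunc → Γ ⊢ x ≐ y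
isTrunc-unique d e = ∨E d
  (∨E (wk₁ e) (∧E₂ h1 ⟫ sym≐ (∧E₂ h0)) (∧E₂ h1 ⟫ sym≐ (whole (∧E₁ h1) h0)))
  (∨E (wk₁ e) (whole (∧E₁ h0) h1 ⟫ sym≐ (∧E₂ h0)) (prefix-unique (∧E₁ h1) (∧E₁ h0) (∧E₂ h1 ⟫ sym≐ (∧E₂ h0))))
  where
  whole : ∀ {m} {Γ} {w t x : Term m} → Γ ⊢ w ⪯ t → Γ ⊢ (x ⊆ᵗ w) ∧ᶠ (∥ x ∥ ≐ ∥ t ∥) → Γ ⊢ x ≐ w
  whole d e = ⊆-len (∧E₁ e) (⊆-antisym (⊆⇒⪯ (∧E₁ e)) (⊆-resp (refl= _) (sym≐ (∧E₂ e)) d))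

isTrunc-bound : Γ ⊢ subF (y ▸ w ▸ t ▸ none) isTrunc → Γ ⊢ y ⪯ t
isTrunc-bound d = ∨E d (⊆-trans (≐⇒⪯ (∧E₂ h0)) (∧E₁ h0)) (len≐⇒⪯ (∧E₂ h0))

isTrunc-total : ∀ (w t : Term n) → Γ ⊢ subF (w ▸ t ▸ none) (∃ᶠ isTrunc)
isTrunc-total w t = ∃E′ (w ▸ t ▸ none) ((v0 ⪯ v2) ∧ᶠ isTrunc)
  (induct (t ▸ none) bounded
    (ex⪯ v1 (base (or (and (pre _ _) (eq _ _)) (and (pre _ _) (eq _ _)))))
    (∨E (⪯-total tε t)
      (witness tε (∨I₁ (∧I h0 (refl= _))))
      (witness tε (∨I₂ (∧I (⊆-refl _) (⊆-antisym (⊆-trans (≐⇒⊆ (×ε _))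
          (⊆-resp (ε⌢ _) (ε⌢ _) (⌢-monoʳ _ (ε-⊆ _)))) h0)))))
    step w)
  (cast (sym (wkF-subF {σ = w ▸ t ▸ none} (λ _ → refl) (∃ᶠ isTrunc)))
    (∃I′ (wkT ∘ (w ▸ t ▸ none)) isTrunc v0 (∧E₂ h0)))
  where
  bounded : Formula 2
  bounded = ∃⪯ v1 isTrunc
  witness : ∀ {m} {w t : Term m} {Γ} y → Γ ⊢ subF (y ▸ w ▸ t ▸ none) isTrunc → Γ ⊢ subF (w ▸ t ▸ none) bounded
  witness {w = w} {t} y d = ∃I′ (w ▸ t ▸ none) ((v0 ⪯ v2) ∧ᶠ isTrunc) y (∧I (isTrunc-bound d) d)
  shorter : ∀ {m} {Γ} {w t y : Term m} {c} → Bit c → Γ ⊢ t ⪯ w → Γ ⊢ subF (y ▸ w ▸ t ▸ none) isTrunc →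
            Γ ⊢ subF (y ▸ (w ⌢ c) ▸ t ▸ none) isTrunc
  shorter b p d = ∨E d
    (∨I₂ (∧I (⊆-resp (sym≐ (∧E₂ h0)) (refl= _) (⊆-⌢ _ _)) (len-cong (∧E₂ h0) ⟫ ⊆-antisym (∧E₁ h0) (wk₁ p))))
    (∨I₂ (∧I (⊆-trans (∧E₁ h0) (⊆-⌢ _ _)) (∧E₂ h0)))
  step : ∀ {c} → Bit c → (subF (v0 ▸ (wkT ∘ (t ▸ none))) bounded ∷ _) ⊢ subF ((v0 ⌢ c) ▸ (wkT ∘ (t ▸ none)))
      bounded
  -- If `w ⌢ c` does not visibly fit, the length of `t` is a prefix of that of `w` with one more
  -- letter. Either it is already a prefix of the length of `w`, and the truncation of `w` is kept,
  -- or the lengths are equal and `w ⌢ c` is its own truncation.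
  step {c} b = ∨E (⪯-total (v0 ⌢ c) (wkT t))
    (witness (v0 ⌢ c) (∨I₁ (∧I h0 (refl= _))))
    (∨E (⊆-bit⇒ 𝟙 (⊆-resp (refl= _) (×-bit b _ _) h0))
      (∃E′ (v0 ▸ (wkT ∘ (t ▸ none))) ((v0 ⪯ v2) ∧ᶠ isTrunc) h2
        (cast (sym (wkF-subF {σ = (v0 ⌢ c) ▸ wkT t ▸ none} (λ _ → refl) bounded))
          (witness v0 (shorter (Bit-wk b) h1 (∧E₂ h0)))))
      (witness (v0 ⌢ c) (∨I₂ (∧I (⊆-refl _) (×-bit b _ _ ⟫ sym≐ h0)))))

truncR : Rel 2 (λ ρ η → ρ zero ∣ ρ (suc zero))
truncR = record
  { F      = isTrunc
  ; F-Σ₁   = base (or (and (pre _ _) (eq _ _)) (and (pre _ _) (eq _ _)))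
  ; B      = v1
  ; tot    = λ σ → cast (subF-cong {σ = σ zero ▸ σ (suc zero) ▸ none} {τ = σ}
      (λ { zero → refl ; (suc zero) → refl }) (∃ᶠ isTrunc)) (isTrunc-total (σ zero) (σ (suc zero)))
  ; uni    = λ σ → isTrunc-unique
  ; bnd    = λ σ → isTrunc-bound
  ; sem    = λ ρ η → to (ρ zero) (ρ (suc zero)) , from (ρ zero) (ρ (suc zero))
  ; semBnd = λ ρ η → truncLen-len≤ (ρ zero) _
  }
  where
  to : ∀ w z {y} → (((1ˢ ⊗ w) ⊑ (1ˢ ⊗ z)) × (y ≡ w)) ⊎ ((y ⊑ w) × (1ˢ ⊗ y ≡ 1ˢ ⊗ z)) → w ∣ z ≡ y
  to w z (inj₁ (p , refl))  = truncLen-id w _ (1⊗⊑⇒len≤ w z p)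
  to w z {y} (inj₂ (p , q)) = ⊑-unique (truncLen-⊑ w _) p
    (trans (truncLen-len w _ (subst (_≤ len w) (1⊗≡⇒len≡ y z q) (⊑⇒len≤ p))) (sym (1⊗≡⇒len≡ y z q)))
  from : ∀ w z {y} → w ∣ z ≡ y → (((1ˢ ⊗ w) ⊑ (1ˢ ⊗ z)) × (y ≡ w)) ⊎ ((y ⊑ w) × (1ˢ ⊗ y ≡ 1ˢ ⊗ z))
  from w z refl with ≤-total (len w) (len z)
  ... | inj₁ p = inj₁ (len≤⇒1⊗⊑ w z p , truncLen-id w _ p)
  ... | inj₂ p = inj₂ (truncLen-⊑ w _ , len≡⇒1⊗≡ _ z (truncLen-len w _ p))

truncToR : {f : Fun n} → Rel n f → (t : Term n) → Rel n (λ ρ η → f ρ η ∣ ⟦ t ⟧ᵗ ρ)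
truncToR {f = f} R t = Rel-resp (λ ρ η → cong (f ρ η ∣_) (semWk t _ ρ))
    (letR R (subR (v0 ▸ wkT t ▸ none) truncR))

isε : 𝕊 → Bool
isε ε       = true
isε (_ ∙ _) = false

ends0 : 𝕊 → Bool
ends0 (_ ∙ false) = true
ends0 _           = false

ε⊑ : ∀ x → ε ⊑ x
ε⊑ ε       = ⊑-refl
ε⊑ (x ∙ _) = ⊑-step (ε⊑ x)

ε++ : ∀ x → ε ++ˢ x ≡ x
ε++ ε       = refl
ε++ (x ∙ b) = cong (_∙ b) (ε++ x)

ifεR : (i : Fin n) {f g : Fun n} → Rel n f → Rel n g → Rel n (λ ρ η → if isε (ρ i) then f ρ η else g ρ η)
ifεR i = ifR (var i ≐ tε) (eq _ _) (λ ρ η → isε (ρ i)) (λ ρ η → to (ρ i) , from (ρ i))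
  where
  to : ∀ x → x ≡ ε → isε x ≡ true
  to x refl = refl
  from : ∀ x → isε x ≡ true → x ≡ ε
  from ε e = refl

-- The word before the last letter is sought among subwords, which keeps the test Σᵇ₀ as definition
-- by cases demands.
ifEnds0R : (i : Fin n) {f g : Fun n} → Rel n f → Rel n g → Rel n
    (λ ρ η → if ends0 (ρ i) then f ρ η else g ρ η)
ifEnds0R i = ifR (∃⊆* (var i) (v0 ⌢ t0 ≐ var (suc i))) (ex* _ (eq _ _)) (λ ρ η → ends0 (ρ i))
  (λ ρ η → (λ (_ , _ , e) → subst (λ x → ends0 x ≡ true) e refl) , from (ρ i))
  where
  from : ∀ x → ends0 x ≡ true →
         Σ 𝕊 λ y → (Σ 𝕊 λ z → (z ⊑ x) × ((z ++ˢ y) ⊑ x)) × (y ∙ false ≡ x)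
  from (x ∙ false) e = x , (ε , ε⊑ _ , subst (_⊑ (x ∙ false)) (sym (ε++ x)) (⊑-step ⊑-refl)) , refl

condR : Rel 4 ⟦ C ⟧
condR = Rel-resp (λ ρ η → agree (ρ zero)) (ifεR zero (termR v1) (ifEnds0R zero (termR v2) (termR v3)))
  where
  agree : ∀ x {y z₀ z₁} → (if isε x then y else (if ends0 x then z₀ else z₁)) ≡ cond x y z₀ z₁
  agree ε           = refl
  agree (x ∙ false) = refl
  agree (x ∙ true)  = refl

queryR : Rel 1 ⟦ Q ⟧
queryR = Rel-resp (λ ρ η → agree (η (ρ zero)))
  (ifR (Flip v0) (flp _) (λ ρ η → η (ρ zero)) (λ ρ η → id , id) (termR t1) (termR t0))
  where
  agree : ∀ b → (if b then bit true else bit false) ≡ bit b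
  agree false = refl
  agree true  = refl

-- The two clauses of a recursion merged into one step function of the previous value v,
-- the current word u and the parameters x.
module StepFunction {k} {g : Fun k} {h₀ h₁ : Fun (suc (suc k))}
                    (G : Rel k g) (H₀ : Rel (suc (suc k)) h₀) (H₁ : Rel (suc (suc k)) h₁) (t : Term (suc k))
                        where

  step : Fun (suc (suc k))
  step ρ η = if isε (ρ (suc zero)) then g (λ i → ρ (suc (suc i))) η else
             (if ends0 (ρ (suc zero)) then clause h₀ else clause h₁)
    where
    clause : Fun (suc (suc k)) → 𝕊
    clause h = h (ρ zero ▸ initˢ (ρ (suc zero)) ▸ (λ i → ρ (suc (suc i)))) η
               ∣ ⟦ t ⟧ᵗ (initˢ (ρ (suc zero)) ▸ (λ i → ρ (suc (suc i))))

  -- Argument 0 is the shortened word bound by `letR`; it precedes the previous value, the full word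
  -- and the parameters, so the first two must be exchanged for `h`.
  branch : {h : Fun (suc (suc k))} → Rel (suc (suc k)) h →
           Rel (suc (suc (suc k))) (λ ρ η → h (ρ (suc zero) ▸ ρ zero ▸ (λ i → ρ (suc (suc (suc i))))) η
                                            ∣ ⟦ t ⟧ᵗ (ρ zero ▸ (λ i → ρ (suc (suc (suc i))))))
  branch {h} H = Rel-resp (λ ρ η → cong₂ _∣_
      (f-cong H (λ { zero → refl ; (suc zero) → refl ; (suc (suc i)) → refl }) η)
      (trans (cong (λ s → ⟦ s ⟧ᵗ (λ i → ⟦ args i ⟧ᵗ ρ)) (renT≡subT suc t))
             (semT t (λ { zero → refl ; (suc i) → refl }))))
    (subR args (truncToR H (wkT t)))
    where
    args : Fin (suc (suc k)) → Term (suc (suc (suc k)))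
    args = v1 ▸ v0 ▸ (λ i → var (suc (suc (suc i))))

  stepR : Rel (suc (suc k)) step
  stepR = ifεR (suc zero) (subR (λ i → var (suc (suc i))) G)
    (letR (subR (λ _ → v1) initR) (ifEnds0R (suc (suc zero)) (branch H₀) (branch H₁)))

  stepBound : Term (suc k)
  stepBound = subT (λ i → var (suc i)) (B G) ⌢ (t ⌢ t)

  branch-bound : {h : Fun (suc (suc k))} (H : Rel (suc (suc k)) h) →
                 subT (v1 ▸ var) (B (branch H)) ≡ wkT t
  branch-bound H = trans (cong (λ s → subT (v1 ▸ var) (subT (v1 ▸ v0 ▸ (λ i → var (suc (suc (suc i))))) s))
      (trans (∷ᵉ-wkT (B H) var (wkT t)) (subT-var (wkT t))))
    (trans (cong (subT (v1 ▸ var)) (∷ᵉ-wkT v1 _ t))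
    (trans (subT-subT _ _ t) (trans (subT-cong (λ { zero → refl ; (suc i) → refl }) t)
        (sym (renT≡subT suc t)))))

  -- Truncation replaces the bounds of `h₀` and `h₁` by `t`, so the previous value does not occur in
  -- the bound of a step; the weakening on the right says exactly this. `t` appears twice because
  -- cases concatenate the bounds of their branches, and it is taken at the full word because that
  -- bounds its predecessor.
  stepR-bound : B stepR ≡ wkT stepBound
  stepR-bound = cong₂ _⌢_ (sym (renT-subT suc _ (B G))) (cong₂ _⌢_ (branch-bound H₀) (branch-bound H₁))

-- Tables of values

v5 : Term (suc (suc (suc (suc (suc (suc n))))))
v5 = wkT v4
v6 : Term (suc (suc (suc (suc (suc (suc (suc n)))))))
v6 = wkT v5

block : Term n → Term n → Term n
block v p = (v ⌢ t1) ⌢ (t0 ×ᵗ p)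

entryBody : Formula 6
entryBody = (v1 ⌢ block v5 v0 ⊆ᵗ v3) ∧ᶠ (∥ v1 ∥ ≐ ∥ v2 ×ᵗ v4 ∥) ∧ᶠ (∥ block v5 v0 ∥ ≐ ∥ v2 ∥)

-- With variables L, w, u, v: the |u|-th block of w, all blocks having length |L|, codes the value v.
entry : Formula 4
entry = ∃⪯ v1 (∃⪯ v2 entryBody)

entry-Σ₁ : Σᵇ₁ entry
entry-Σ₁ = ex⪯ v1 (ex⪯ v2 (base (and (pre _ _) (and (eq _ _) (eq _ _)))))

Entry : (L w u v : Term n) → Formula n
Entry L w u v = subF (L ▸ w ▸ u ▸ v ▸ none) entry

entryI : ∀ {L : Term n} s p → Γ ⊢ s ⌢ block v p ⊆ᵗ w → Γ ⊢ ∥ s ∥ ≐ ∥ L ×ᵗ u ∥ → Γ ⊢ ∥ block v p ∥ ≐ ∥ L ∥ →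
         Γ ⊢ Entry L w u v
entryI {v = v} {w} {u} {L} s p d e f =
  ∃I′ (L ▸ w ▸ u ▸ v ▸ none) ((v0 ⪯ v2) ∧ᶠ ∃⪯ v2 entryBody) s (∧I (⊆⇒⪯ (⊆-trans (⊆-⌢ _ _) d))
    (∃I′ (s ▸ L ▸ w ▸ u ▸ v ▸ none) ((v0 ⪯ v3) ∧ᶠ entryBody) p
      (∧I (⊆-trans (⊆-resp (×× 𝟘 _ _) (refl= _) (⪯-refl _)) (⊆-trans (⪯-⌢ʳ _ _) (⊆-trans (⪯-⌢ʳ _ _) (⊆⇒⪯ d))))
        (∧I d (∧I e f)))))

entryE : ∀ {L : Term n} → Γ ⊢ Entry L w u v →
         subF (v0 ▸ v1 ▸ wkT (wkT L) ▸ wkT (wkT w) ▸ wkT (wkT u) ▸ wkT (wkT v) ▸ none) entryBody ∷ map wkF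
             (map wkF Γ)
           ⊢ wkF (wkF ψ) → Γ ⊢ ψ
entryE {w = w} {u} {v} {ψ = ψ} {L} d e =
  ∃E′ (L ▸ w ▸ u ▸ v ▸ none) ((v0 ⪯ v2) ∧ᶠ ∃⪯ v2 entryBody) d
    (∃E′ (v0 ▸ (wkT ∘ (L ▸ w ▸ u ▸ v ▸ none))) ((v0 ⪯ v3) ∧ᶠ entryBody) {wkF ψ} (∧E₂ h0)
      (⇒E (wk₁ (wk₁ (⇒I e))) (∧E₂ h0)))

entry-mono : ∀ {L : Term n} → Γ ⊢ Entry L w u v → Γ ⊢ w ⊆ᵗ x → Γ ⊢ Entry L x u v
entry-mono {w = w} {u} {v} {x = x} {L} d e = use core (L ▸ w ▸ x ▸ u ▸ v ▸ none) (d ∷ e ∷ [])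
  where
  core : Entry v0 v1 v3 v4 ∷ (v1 ⊆ᵗ v2) ∷ [] ⊢ Entry v0 v2 v3 (v4 {0})
  core = entryE h0 (entryI v1 v0 (⊆-trans (∧E₁ h0) h2) (∧E₁ (∧E₂ h0)) (∧E₂ (∧E₂ h0)))

×-len : Γ ⊢ ∥ x ∥ ≐ ∥ y ∥ → Γ ⊢ z ×ᵗ x ≐ z ×ᵗ y
×-len d = sym≐ (×× 𝟙 _ _) ⟫ ×-cong (refl= _) d ⟫ ×× 𝟙 _ _

-- The index enters only through the product `L ×ᵗ u`, which depends on the length of `u`. Hence
-- `u ⌢ t1` can name the next block whatever the next letter of the recursion word is.
entry-index : ∀ {L : Term n} → Γ ⊢ Entry L w u v → Γ ⊢ ∥ u ∥ ≐ ∥ x ∥ → Γ ⊢ Entry L w x v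
entry-index {w = w} {u} {v} {x = x} {L} d e = use core (L ▸ w ▸ x ▸ u ▸ v ▸ none) (d ∷ e ∷ [])
  where
  core : Entry v0 v1 v3 v4 ∷ (∥ v3 ∥ ≐ ∥ v2 ∥) ∷ [] ⊢ Entry v0 v1 v2 (v4 {0})
  core = entryE h0 (entryI v1 v0 (∧E₁ h0) (∧E₁ (∧E₂ h0) ⟫ len-cong (×-len h2)) (∧E₂ (∧E₂ h0)))

entry-bound : ∀ {L : Term n} → Γ ⊢ Entry L w u v → Γ ⊢ v ⪯ L
entry-bound {w = w} {u} {v} {L} d = use core (L ▸ w ▸ u ▸ v ▸ none) (d ∷ [])
  where
  core : Entry v0 v1 v2 v3 ∷ [] ⊢ v3 {0} ⪯ v0
  core = entryE h0 (⊆-trans (⪯-⌢ˡ _ _) (⊆-trans (⪯-⌢ˡ _ _) (len≐⇒⪯ (∧E₂ (∧E₂ h0)))))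

-- In use, `p` is what remains of `∥ L ∥` after the prefix `∥ v ⌢ t1 ∥`, so the padding comes
-- directly from a proof that `v ⌢ t1` fits into `L`.
block-len : ∀ {L p : Term n} → Γ ⊢ ∥ v ⌢ t1 ∥ ⌢ p ≐ ∥ L ∥ → Γ ⊢ ∥ block v p ∥ ≐ ∥ L ∥
block-len d = len-⌢ _ _ ⟫ ⌢-cong (sym≐ (×× 𝟙 _ _)) (×× 𝟘 _ _) ⟫ sym≐ (len-⌢ _ _) ⟫ len-cong d ⟫ ×× 𝟙 _ _

blocks-suc : ∀ {L : Term n} → Γ ⊢ ∥ s ∥ ≐ ∥ L ×ᵗ u ∥ → Γ ⊢ ∥ x ∥ ≐ ∥ L ∥ → Γ ⊢ ∥ s ⌢ x ∥ ≐ ∥ L ×ᵗ (u ⌢ t1) ∥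
blocks-suc d e = len-⌢ _ _ ⟫ ⌢-cong d e ⟫ sym≐ (len-⌢ _ _) ⟫ len-cong (sym≐ (×-bit 𝟙 _ _))

commonBody : Formula 5
commonBody = (v0 ⊆ᵗ v2) ∧ᶠ (v0 ⊆ᵗ v3) ∧ᶠ (∥ v0 ∥ ≐ ∥ v1 ×ᵗ v4 ∥)

-- With variables L, w, w′, u: the first |u| blocks of w and w′ agree.
common : Formula 4
common = ∃⪯ v1 commonBody

common-Σ₁ : Σᵇ₁ common
common-Σ₁ = ex⪯ v1 (base (and (pre _ _) (and (pre _ _) (eq _ _))))

Common : (L w w′ u : Term n) → Formula n
Common L w w′ u = subF (L ▸ w ▸ w′ ▸ u ▸ none) common

commonI : ∀ {L w′ : Term n} a → Γ ⊢ a ⊆ᵗ w → Γ ⊢ a ⊆ᵗ w′ → Γ ⊢ ∥ a ∥ ≐ ∥ L ×ᵗ u ∥ → Γ ⊢ Common L w w′ u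
commonI {w = w} {u} {L} {w′} a d e f = ∃I′ (L ▸ w ▸ w′ ▸ u ▸ none) ((v0 ⪯ v2) ∧ᶠ commonBody) a
  (∧I (⊆⇒⪯ d) (∧I d (∧I e f)))

commonE : ∀ {L w′ : Term n} → Γ ⊢ Common L w w′ u →
          subF (v0 ▸ wkT L ▸ wkT w ▸ wkT w′ ▸ wkT u ▸ none) commonBody ∷ map wkF Γ ⊢ wkF ψ → Γ ⊢ ψ
commonE {w = w} {u} {L = L} {w′} d e = ∃E′ (L ▸ w ▸ w′ ▸ u ▸ none) ((v0 ⪯ v2) ∧ᶠ commonBody) d
  (⇒E (wk₁ (⇒I e)) (∧E₂ h0))

common-ε : ∀ (L w w′ : Term n) → Γ ⊢ Common L w w′ tε
common-ε L w w′ = commonI tε (⊆-resp (refl= _) (ε⌢ _) (⊆-⌢ _ _)) (⊆-resp (refl= _) (ε⌢ _) (⊆-⌢ _ _))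
  (len-cong (sym≐ (×ε _)))

common-index : ∀ {L w′ : Term n} → Γ ⊢ Common L w w′ u → Γ ⊢ ∥ u ∥ ≐ ∥ x ∥ → Γ ⊢ Common L w w′ x
common-index {w = w} {u} {x = x} {L} {w′} d e = use core (L ▸ w ▸ w′ ▸ u ▸ x ▸ none) (d ∷ e ∷ [])
  where
  core : Common v0 v1 v2 v3 ∷ (∥ v3 ∥ ≐ ∥ v4 ∥) ∷ [] ⊢ Common v0 v1 v2 (v4 {0})
  core = commonE h0 (commonI v0 (∧E₁ h0) (∧E₁ (∧E₂ h0)) (∧E₂ (∧E₂ h0) ⟫ len-cong (×-len h2)))

block-unique : ∀ {p v′ s′ p′ : Term n} → Γ ⊢ s ⌢ block v p ≐ s′ ⌢ block v′ p′ → Γ ⊢ ∥ s ∥ ≐ ∥ s′ ∥ → Γ ⊢ v ≐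
    v′
block-unique {Γ = Γ} {s} {v} {p} {v′} {s′} {p′} d e = ⌢-cancelˡ (values ⟫ ⌢-cong (sym≐ prefixes) (refl= _))
  where
  values : Γ ⊢ s ⌢ v ≐ s′ ⌢ v′
  values = marker-unique (sym≐ (assoc _ _ _ ⟫ ⌢-cong (assoc _ _ _) (refl= _)) ⟫ d ⟫ assoc _ _ _ ⟫ ⌢-cong
      (assoc _ _ _) (refl= _))
  prefixes : Γ ⊢ s ≐ s′
  prefixes = prefix-unique (⊆-⌢ _ _) (⊆-resp (refl= _) (sym≐ d) (⊆-⌢ _ _)) e

-- The shared prefix reaches to the end of block number |`u`|. Both coded blocks therefore end in
-- the same word, and `block-unique` decodes it.
entry-unique : ∀ {L w′ v′ : Term n} → Γ ⊢ Common L w w′ (u ⌢ t1) → Γ ⊢ Entry L w u v → Γ ⊢ Entry L w′ u v′ →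
    Γ ⊢ v ≐ v′
entry-unique {w = w} {u} {v} {L = L} {w′} {v′} d e f =
  use core (L ▸ w ▸ w′ ▸ u ▸ v ▸ v′ ▸ none) (d ∷ e ∷ f ∷ [])
  where
  core : Common v0 v1 v2 (v3 ⌢ t1) ∷ Entry v0 v1 v3 v4 ∷ Entry v0 v2 v3 v5 ∷ [] ⊢ v4 ≐ v5 {0}
  core = commonE h0 (entryE h2 (entryE (wk₁ (wk₁ h2)) (block-unique
    (prefix-unique (∧E₁ h1) (∧E₁ h2) (blocks-suc (∧E₁ (∧E₂ h1)) (∧E₂ (∧E₂ h1)) ⟫ sym≐ (∧E₂ (∧E₂ h2)))
      ⟫ sym≐ (prefix-unique (∧E₁ h0) (∧E₁ (∧E₂ h2)) (blocks-suc (∧E₁ (∧E₂ h0)) (∧E₂ (∧E₂ h0)) ⟫ sym≐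
          (∧E₂ (∧E₂ h2)))))
    (∧E₁ (∧E₂ h1) ⟫ sym≐ (∧E₁ (∧E₂ h0))))))

-- Equal values have equal codes: the number of padding zeros is fixed by the length of the value
-- and the block length. The prefix of `w` ending with its block is thus also a prefix of `w′`.
common-extend : ∀ {L w′ : Term n} → Γ ⊢ Common L w w′ u → Γ ⊢ Entry L w u v → Γ ⊢ Entry L w′ u v →
                Γ ⊢ Common L w w′ (u ⌢ t1)
common-extend {w = w} {u} {v} {L = L} {w′} d e f =
  use core (L ▸ w ▸ w′ ▸ u ▸ v ▸ none) (d ∷ e ∷ f ∷ [])
  where
  zeros : ∀ {p p′ : Term m} {Γ : List (Formula m)} {x L} → Γ ⊢ ∥ block x p ∥ ≐ ∥ L ∥ → Γ ⊢ ∥ block x p′ ∥ ≐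
      ∥ L ∥ → Γ ⊢ t0 ×ᵗ p ≐ t0 ×ᵗ p′
  zeros d e = ×-len (sym≐ (×× 𝟘 _ _) ⟫ len-cancelʳ (len-comm _ _ ⟫ sym≐ (len-⌢ _ _) ⟫ d ⟫ sym≐ e ⟫ len-⌢ _ _
      ⟫ len-comm _ _) ⟫ ×× 𝟘 _ _)
  core : Common v0 v1 v2 v3 ∷ Entry v0 v1 v3 v4 ∷ Entry v0 v2 v3 v4 ∷ [] ⊢ Common v0 v1 v2 (v3 {1} ⌢ t1)
  core = commonE h0 (entryE h2 (entryE (wk₁ (wk₁ h2)) (commonI (v3 ⌢ block (wkT (wkT (wkT v6))) v2)
    (∧E₁ h1)
    (⊆-resp (⌢-cong
        (prefix-unique (⊆-trans (⊆-⌢ _ _) (∧E₁ h0)) (∧E₁ (∧E₂ h2)) (∧E₁ (∧E₂ h0) ⟫ sym≐ (∧E₂ (∧E₂ h2)))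
          ⟫ prefix-unique (∧E₁ h2) (⊆-trans (⊆-⌢ _ _) (∧E₁ h1)) (∧E₂ (∧E₂ h2) ⟫ sym≐ (∧E₁ (∧E₂ h1))))
        (⌢-cong (refl= _) (zeros (∧E₂ (∧E₂ h0)) (∧E₂ (∧E₂ h1))))) (refl= _) (∧E₁ h0))
    (blocks-suc (∧E₁ (∧E₂ h1)) (∧E₂ (∧E₂ h1))))))

up² : map wkF (map wkF Γ) ⊢ φ → θ ∷ χ ∷ ψ ∷ map wkF (map wkF Γ) ⊢ φ
up² d = wk₁ (wk₁ (wk₁ d))

wkF-subF² : {σ : Fin k → Term m} {θ : Fin k → Term (suc (suc m))} →
            (∀ i → wkT (wkT (σ i)) ≡ θ i) → ∀ φ → wkF (wkF (subF σ φ)) ≡ subF θ φ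
wkF-subF² e φ = trans (cong wkF (wkF-subF (λ _ → refl) φ)) (wkF-subF e φ)

bit-len : Bit c → Γ ⊢ ∥ u ⌢ c ∥ ≐ ∥ u ⌢ t1 ∥
bit-len b = ×-bit b _ _ ⟫ sym≐ (×-bit 𝟙 _ _)

agree₃ : {A : Set} {a b c : A} {σ : Fin k → A} {τ : Fin (suc (suc (suc k))) → A} →
         τ zero ≡ a → τ (suc zero) ≡ b → τ (suc (suc zero)) ≡ c → (∀ i → τ (suc (suc (suc i))) ≡ σ i) →
         ∀ i → τ i ≡ (a ▸ b ▸ c ▸ σ) i
agree₃ p q r e zero                = p
agree₃ p q r e (suc zero)          = q
agree₃ p q r e (suc (suc zero))    = r
agree₃ p q r e (suc (suc (suc i))) = e i

#0 : Fin (suc n)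
#0 = zero
#1 : Fin (suc (suc n))
#1 = suc #0
#2 : Fin (suc (suc (suc n)))
#2 = suc #1
#3 : Fin (suc (suc (suc (suc n))))
#3 = suc #2
#4 : Fin (suc (suc (suc (suc (suc n)))))
#4 = suc #3

+4 : Fin k → Fin (suc (suc (suc (suc k))))
+4 i = suc (suc (suc (suc i)))
+5 : Fin k → Fin (suc (suc (suc (suc (suc k)))))
+5 i = suc (+4 i)

subF-renF₃ : (τ : Fin n → Term m) (a b c : Fin n) (ρ : Fin k → Fin n) (φ : Formula (suc (suc (suc k)))) →
             subF τ (renF (a ▸ b ▸ c ▸ ρ) φ) ≡ subF (τ a ▸ τ b ▸ τ c ▸ (τ ∘ ρ)) φ
subF-renF₃ τ a b c ρ = subF-renF
  (λ { zero → refl ; (suc zero) → refl ; (suc (suc zero)) → refl ; (suc (suc (suc i))) → refl })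

entry-≐ : ∀ {L : Term n} → Γ ⊢ Entry L w u v → Γ ⊢ v ≐ x → Γ ⊢ Entry L w u x
entry-≐ {w = w} {u} {v} {x} {L} d e = subF-≐ entry {σ = L ▸ w ▸ u ▸ v ▸ none} {τ = L ▸ w ▸ u ▸ x ▸ none}
    (λ { zero → refl= _ ; (suc zero) → refl= _ ; (suc (suc zero)) → refl= _ ; (suc (suc (suc zero))) → e }) d

wkEntry : ∀ {L : Term n} → wkF (Entry L w u v) ≡ Entry (wkT L) (wkT w) (wkT u) (wkT v)
wkEntry {w = w} {u} {v} {L} = wkF-subF {σ = L ▸ w ▸ u ▸ v ▸ none} {θ = wkT L ▸ wkT w ▸ wkT u ▸ wkT v ▸ none}
    (λ { zero → refl ; (suc zero) → refl ; (suc (suc zero)) → refl ; (suc (suc (suc zero))) → refl }) entry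

wkEntry² : ∀ {L : Term n} → wkF (wkF (Entry L w u v)) ≡ Entry (wkT (wkT L)) (wkT (wkT w)) (wkT (wkT u))
    (wkT (wkT v))
wkEntry² {w = w} {u} {v} {L} = wkF-subF² {σ = L ▸ w ▸ u ▸ v ▸ none}
    {θ = wkT (wkT L) ▸ wkT (wkT w) ▸ wkT (wkT u) ▸ wkT (wkT v) ▸ none}
        (λ { zero → refl ; (suc zero) → refl ; (suc (suc zero)) → refl ; (suc (suc (suc zero))) → refl })
            entry

wkCommon² : ∀ {L w′ : Term n} → wkF (wkF (Common L w w′ u)) ≡ Common (wkT (wkT L)) (wkT (wkT w))
    (wkT (wkT w′)) (wkT (wkT u))
wkCommon² {w = w} {u} {L} {w′} = wkF-subF² {σ = L ▸ w ▸ w′ ▸ u ▸ none}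
    {θ = wkT (wkT L) ▸ wkT (wkT w) ▸ wkT (wkT w′) ▸ wkT (wkT u) ▸ none}
        (λ { zero → refl ; (suc zero) → refl ; (suc (suc zero)) → refl ; (suc (suc (suc zero))) → refl })
            common

Entry-Σ₁ : ∀ (L w u v : Term n) → Σᵇ₁ (Entry L w u v)
Entry-Σ₁ L w u v = Σ₁-sub (L ▸ w ▸ u ▸ v ▸ none) entry-Σ₁

-- Steps and histories as formulas

module History {k} {s : Fun (suc (suc k))} (S : Rel (suc (suc k)) s) where

  -- `v1` is the previous value, stored in block |`u`|, and `v0` the value at `u`, stored in the
  -- next block; `v2`, `v3`, `v4` are the width, the table and `u`.
  stepBody : Formula (suc (suc (suc (suc (suc k)))))
  stepBody = Entry v2 v3 v4 v1 ∧ᶠ Entry v2 v3 (v4 ⌢ t1) v0 ∧ᶠ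
             renF (#0 ▸ #1 ▸ #4 ▸ +5) (F S)

  step : Formula (suc (suc (suc k)))
  step = ∃⪯ v0 (∃⪯ v1 stepBody)

  Step : (L w u : Term m) (σ : Fin k → Term m) → Formula m
  Step L w u σ = subF (L ▸ w ▸ u ▸ σ) step

  step-Σ₁ : Σᵇ₁ step
  step-Σ₁ = ex⪯ v0 (ex⪯ v1 (and (Entry-Σ₁ v2 v3 v4 v1) (and (Entry-Σ₁ v2 v3 (v4 ⌢ t1) v0)
      (Σ₁-ren _ (F-Σ₁ S)))))

  stepI : ∀ {L v′ : Term m} {σ : Fin k → Term m} → Γ ⊢ Entry L w u v′ → Γ ⊢ Entry L w (u ⌢ t1) v →
          Γ ⊢ subF (v ▸ v′ ▸ u ▸ σ) (F S) → Γ ⊢ Step L w u σ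
  stepI {w = w} {u} {v} {L = L} {v′} {σ} d e f =
    ∃I′ (L ▸ w ▸ u ▸ σ) ((v0 ⪯ v1) ∧ᶠ ∃⪯ v1 stepBody) v′ (∧I (entry-bound {w = w} {u} d)
      (∃I′ (v′ ▸ L ▸ w ▸ u ▸ σ) ((v0 ⪯ v2) ∧ᶠ stepBody) v (∧I (entry-bound {w = w} {u ⌢ t1} e)
        (∧I d (∧I e (cast (sym (subF-renF₃ (v ▸ v′ ▸ L ▸ w ▸ u ▸ σ) #0 #1 #4 +5 (F S))) f))))))

  stepE : ∀ {L : Term m} {σ : Fin k → Term m} → Γ ⊢ Step L w u σ →
          subF (v0 ▸ v1 ▸ wkT (wkT u) ▸ (wkT ∘ wkT ∘ σ)) (F S)
          ∷ Entry (wkT (wkT L)) (wkT (wkT w)) (wkT (wkT u) ⌢ t1) v0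
          ∷ Entry (wkT (wkT L)) (wkT (wkT w)) (wkT (wkT u)) v1 ∷ map wkF (map wkF Γ) ⊢ wkF (wkF ψ) → Γ ⊢ ψ
  stepE {w = w} {u} {ψ = ψ} {L} {σ} d e =
    ∃E′ (L ▸ w ▸ u ▸ σ) ((v0 ⪯ v1) ∧ᶠ ∃⪯ v1 stepBody) d
      (∃E′ (v0 ▸ (wkT ∘ (L ▸ w ▸ u ▸ σ))) ((v0 ⪯ v2) ∧ᶠ stepBody) {wkF ψ} (∧E₂ h0)
        (⇒E (⇒E (⇒E (wk₁ (wk₁ (⇒I (⇒I (⇒I e))))) (∧E₁ (∧E₂ h0))) (∧E₁ (∧E₂ (∧E₂ h0))))
          (cast (subF-renF₃ (v0 ▸ (wkT ∘ (v0 ▸ (wkT ∘ (L ▸ w ▸ u ▸ σ))))) #0 #1 #4 +5 (F S))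
              (∧E₂ (∧E₂ (∧E₂ h0))))))

  step-mono : ∀ {L : Term m} {σ : Fin k → Term m} → Γ ⊢ Step L w u σ → Γ ⊢ w ⊆ᵗ x → Γ ⊢ Step L x u σ
  step-mono {w = w} {u} {x = x} {L} {σ} d e = stepE d
    (cast (sym (wkF-subF² {σ = L ▸ x ▸ u ▸ σ} (agree₃ refl refl refl (λ _ → refl)) step))
      (stepI (entry-mono h2 (up² (up (up e)))) (entry-mono h1 (up² (up (up e)))) h0))

  wkStep : ∀ {L : Term m} {σ : Fin k → Term m} → wkF (Step L w u σ) ≡ Step (wkT L) (wkT w) (wkT u) (wkT ∘ σ)
  wkStep = wkF-subF (agree₃ refl refl refl (λ _ → refl)) step

  -- The universal quantifier permitted in Σᵇ₁ runs over subwords, so those that are not prefixes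
  -- are exempted here. A disjunction does this because `step` is Σᵇ₁ and may not stand under an
  -- implication.
  histBody : Formula (suc (suc (suc (suc k))))
  histBody = (¬ᶠ (v0 ⊆ᵗ v3)) ∨ᶠ renF (#1 ▸ #2 ▸ #0 ▸ +4) step

  -- With variables L, w, u and the parameters: w codes the value ε followed by the values at all prefixes of u.
  hist : Formula (suc (suc (suc k)))
  hist = (∥ v1 ∥ ≐ ∥ v0 ×ᵗ ((v2 ⌢ t1) ⌢ t1) ∥) ∧ᶠ Entry v0 v1 tε tε ∧ᶠ ∀⊆* v2 histBody

  hist-Σ₁ : Σᵇ₁ hist
  hist-Σ₁ = and (base (eq _ _)) (and (Entry-Σ₁ v0 v1 tε tε)
    (all* v2 (or (base (imp (pre _ _) bot)) (Σ₁-ren _ step-Σ₁))))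

  Hist : (L w u : Term m) (σ : Fin k → Term m) → Formula m
  Hist L w u σ = subF (L ▸ w ▸ u ▸ σ) hist

  wkHist : ∀ {L : Term m} {σ : Fin k → Term m} → wkF (Hist L w u σ) ≡ Hist (wkT L) (wkT w) (wkT u) (wkT ∘ σ)
  wkHist = wkF-subF (agree₃ refl refl refl (λ _ → refl)) hist

  histStep : ∀ {L : Term m} {σ : Fin k → Term m} → Γ ⊢ Hist L w u σ → Γ ⊢ x ⊆ᵗ u → Γ ⊢ Step L w x σ
  histStep {w = w} {u} {x = x} {L} {σ} d e = ∨E
    (⇒E (∀E′ (L ▸ w ▸ u ▸ σ) ((v0 ⊆* v3) ⇒ histBody) (∧E₂ (∧E₂ d)) x)
      (∃I′ (x ▸ L ▸ w ▸ u ▸ σ) ((v0 ⊆ᵗ v4) ∧ᶠ ((v0 ⌢ v1) ⊆ᵗ v4)) tε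
        (∧I (ε-⊆ u) (⊆-resp (sym≐ (ε⌢ x)) (refl= _) e))))
    (⊥E (⇒E h0 (wk₁ e)))
    (cast (subF-renF₃ (x ▸ L ▸ w ▸ u ▸ σ) #1 #2 #0 +4 step) h0)

  histI : ∀ {L : Term m} {σ : Fin k → Term m} → Γ ⊢ ∥ w ∥ ≐ ∥ L ×ᵗ ((u ⌢ t1) ⌢ t1) ∥ → Γ ⊢ Entry L w tε tε →
          (v0 ⊆ᵗ wkT u) ∷ map wkF Γ ⊢ Step (wkT L) (wkT w) v0 (wkT ∘ σ) → Γ ⊢ Hist L w u σ
  histI {w = w} {u} {L} {σ} d e f = ∧I d (∧I e
    (∀I′ (L ▸ w ▸ u ▸ σ) ((v0 ⊆* v3) ⇒ histBody) (⇒I (∨E (excluded-middle (v0 ⊆ᵗ wkT u))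
      (∨I₂ (cast (sym (subF-renF₃ (v0 ▸ (wkT ∘ (L ▸ w ▸ u ▸ σ))) #1 #2 #0 +4 step))
        (weaken (λ { (here p) → here p ; (there p) → there (there p) }) f)))
      (∨I₁ h0)))))

  step-≐ : ∀ {L : Term m} {σ : Fin k → Term m} → Γ ⊢ Step L w u σ → Γ ⊢ u ≐ x → Γ ⊢ Step L w x σ
  step-≐ d e = subF-≐ step (λ { zero → refl= _ ; (suc zero) → refl= _ ; (suc (suc zero)) → e ;
      (suc (suc (suc i))) → refl= _ }) d

  hist-ε : ∀ {L : Term m} {σ : Fin k → Term m} → Γ ⊢ ∥ w ∥ ≐ ∥ L ×ᵗ ((tε ⌢ t1) ⌢ t1) ∥ → Γ ⊢ Entry L w tε tε →
           Γ ⊢ Step L w tε σ → Γ ⊢ Hist L w tε σ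
  hist-ε {w = w} d e f = histI d e (step-≐ (cast wkStep (up₁ f)) (sym≐ (⊆ε⇒ h0)))

  -- A prefix of `u ⌢ c` is either a prefix of `u`, whose step survives the extension of the table,
  -- or the whole word, whose step is supplied.
  hist-snoc : ∀ {L : Term m} {σ : Fin k → Term m} → Bit c → Γ ⊢ Hist L w u σ → Γ ⊢ w ⊆ᵗ x →
              Γ ⊢ ∥ x ∥ ≐ ∥ L ×ᵗ (((u ⌢ c) ⌢ t1) ⌢ t1) ∥ → Γ ⊢ Step L x (u ⌢ c) σ → Γ ⊢ Hist L x (u ⌢ c) σ
  hist-snoc {x = x} b d e f g = histI f (entry-mono (∧E₁ (∧E₂ d)) e) (∨E (⊆-bit⇒ (Bit-wk b) h0)
    (step-mono (histStep (cast wkHist (wk₁ (up₁ d))) h0) (wk₁ (up₁ e)))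
    (step-≐ (cast wkStep (wk₁ (up₁ g))) (sym≐ h0)))

  -- If the steps of w and w′ at u start from the same value, they produce the same value.
  common-step : ∀ {L w′ : Term m} {σ : Fin k → Term m} → Γ ⊢ Common L w w′ (u ⌢ t1) →
                Γ ⊢ Step L w u σ → Γ ⊢ Step L w′ u σ → Γ ⊢ Common L w w′ ((u ⌢ t1) ⌢ t1)
  common-step {m} {Γ} {w} {u} {L} {w′} {σ} d e f =
    stepE e (cast (sym wkCommon²) (stepE {L = wkT (wkT L)} {σ = wkT ∘ wkT ∘ σ}
        (cast (wkF-subF² {σ = L ▸ w′ ▸ u ▸ σ} (agree₃ refl refl refl (λ _ → refl)) step) (up² (up (up f))))
        (cast (sym wkCommon²) (extend (up² (cast wkCommon² (up (up (up² (cast wkCommon² (up (up d))))))))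
          (up² (cast wkEntry² (up (up h2)))) (up² (cast wkEntry² (up (up h1))))
          (up² (cast (wkF-subF² {σ = v0 ▸ v1 ▸ wkT (wkT u) ▸ (wkT ∘ wkT ∘ σ)}
              (agree₃ refl refl refl (λ _ → refl)) (F S)) (up (up h0))))
          h2 h1 h0))))
    where
    extend : ∀ {m} {Γ : List (Formula m)} {L w w′ u v v₁ y y₁ : Term m} {σ : Fin k → Term m} →
             Γ ⊢ Common L w w′ (u ⌢ t1) →
             Γ ⊢ Entry L w u v → Γ ⊢ Entry L w (u ⌢ t1) y → Γ ⊢ subF (y ▸ v ▸ u ▸ σ) (F S) →
             Γ ⊢ Entry L w′ u v₁ → Γ ⊢ Entry L w′ (u ⌢ t1) y₁ → Γ ⊢ subF (y₁ ▸ v₁ ▸ u ▸ σ) (F S) →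
             Γ ⊢ Common L w w′ ((u ⌢ t1) ⌢ t1)
    extend c p q r p′ q′ r′ = common-extend c q (entry-≐ q′
      (uni′ S (λ { zero → sym≐ (entry-unique c p p′) ; (suc i) → refl= _ }) r′ r))

-- Existence and uniqueness of histories

module Recursion {k} {s : Fun (suc (suc k))} (S : Rel (suc (suc k)) s) (T : Term (suc k))
    (S-bound : B S ≡ wkT T) where

  open History S

  -- The bound is taken at the whole recursion word `Y`, so one width suits all its prefixes; the
  -- additional letter makes room for the marker.
  width : Term m → (Fin k → Term m) → Term m
  width Y σ = subT (Y ▸ σ) T ⌢ t1

  wk-width : ∀ {Y : Term m} {σ : Fin k → Term m} → wkT (width Y σ) ≡ width (wkT Y) (wkT ∘ σ)
  wk-width = cong (_⌢ t1) (trans (renT-subT suc _ T) (subT-cong (λ { zero → refl ; (suc i) → refl }) T))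

  value-bound : ∀ {v′ Y : Term m} {σ : Fin k → Term m} → Γ ⊢ subF (v ▸ v′ ▸ u ▸ σ) (F S) → Γ ⊢ u ⊆ᵗ Y →
                Γ ⊢ (v ⌢ t1) ⪯ width Y σ
  value-bound {v = v} {u} {v′} {Y} {σ} d e = ⪯-⌢ (⊆-trans
      (cast (cong (v ⪯_) (trans (cong (subT (v′ ▸ u ▸ σ)) S-bound) (∷ᵉ-wkT v′ (u ▸ σ) T)))
          (bnd S (v′ ▸ u ▸ σ) d))
      (⪯-mono T (λ { zero → ⊆⇒⪯ e ; (suc i) → ⪯-refl _ })))
    (⪯-refl t1)

  grownBody : Formula (suc (suc (suc (suc k))))
  grownBody = (v2 ⊆ᵗ v0) ∧ᶠ (∥ v0 ∥ ≐ ∥ v1 ×ᵗ ((v3 ⌢ t1) ⌢ t1) ∥) ∧ᶠ renF (#1 ▸ #0 ▸ #3 ▸ +4) step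

  -- The quantifier stays unbounded: the formula only hands a witness from one derivation to another
  -- and is never an induction formula.
  grown : Formula (suc (suc (suc k)))
  grown = ∃ᶠ grownBody

  Grown : (L w u : Term m) (σ : Fin k → Term m) → Formula m
  Grown L w u σ = subF (L ▸ w ▸ u ▸ σ) grown

  grownI : ∀ {L : Term m} {σ : Fin k → Term m} x → Γ ⊢ w ⊆ᵗ x → Γ ⊢ ∥ x ∥ ≐ ∥ L ×ᵗ ((u ⌢ t1) ⌢ t1) ∥ →
           Γ ⊢ Step L x u σ → Γ ⊢ Grown L w u σ
  grownI {w = w} {u} {L} {σ} x d e f = ∃I′ (L ▸ w ▸ u ▸ σ) grownBody x
    (∧I d (∧I e (cast (sym (subF-renF₃ (x ▸ L ▸ w ▸ u ▸ σ) #1 #0 #3 +4 step)) f)))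

  grownE : ∀ {L : Term m} {σ : Fin k → Term m} → Γ ⊢ Grown L w u σ →
           Step (wkT L) v0 (wkT u) (wkT ∘ σ) ∷ (∥ v0 ∥ ≐ ∥ wkT L ×ᵗ ((wkT u ⌢ t1) ⌢ t1) ∥)
           ∷ (wkT w ⊆ᵗ v0) ∷ map wkF Γ ⊢ wkF ψ → Γ ⊢ ψ
  grownE {w = w} {u} {L = L} {σ} d e = ∃E′ (L ▸ w ▸ u ▸ σ) grownBody d
    (⇒E (⇒E (⇒E (wk₁ (⇒I (⇒I (⇒I e)))) (∧E₁ h0)) (∧E₁ (∧E₂ h0)))
      (cast (subF-renF₃ (v0 ▸ (wkT ∘ (L ▸ w ▸ u ▸ σ))) #1 #0 #3 +4 step) (∧E₂ (∧E₂ h0))))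

  grow-by : ∀ {L v′ p : Term m} {σ : Fin k → Term m} → Γ ⊢ subF (v ▸ v′ ▸ u ▸ σ) (F S) →
            Γ ⊢ ∥ v ⌢ t1 ∥ ⌢ p ≐ ∥ L ∥ →
            Γ ⊢ ∥ w ∥ ≐ ∥ L ×ᵗ (u ⌢ t1) ∥ → Γ ⊢ Entry L w u v′ → Γ ⊢ Grown L w u σ
  grow-by {v = v} {u} {w} {L} {v′} {p} d e f g = grownI (w ⌢ block v p) (⊆-⌢ _ _) (blocks-suc f (block-len e))
    (stepI (entry-mono g (⊆-⌢ _ _)) (entryI w p (⊆-refl _) f (block-len e)) d)

  grow : ∀ {L v′ Y : Term m} {σ : Fin k → Term m} → L ≡ width Y σ → Γ ⊢ u ⊆ᵗ Y →
         Γ ⊢ ∥ w ∥ ≐ ∥ L ×ᵗ (u ⌢ t1) ∥ → Γ ⊢ Entry L w u v′ → Γ ⊢ Grown L w u σ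
  grow {m} {Γ = Γ} {u} {w} {L} {v′} {Y} {σ} refl d e f = totE′ S (v′ ▸ u ▸ σ) {τ = L ▸ w ▸ u ▸ σ} grown
    (⊆E (cast (cong ((v0 ⌢ t1) ⪯_) (sym wk-width)) (value-bound {v′ = wkT v′} {σ = wkT ∘ σ} value
        (wk₁ (up d))))
      (cast (sym (wkF-subF {σ = wkT ∘ (L ▸ w ▸ u ▸ σ)} (agree₃ refl refl refl (λ _ → refl)) grown))
        (grow-by {u = wkT (wkT u)} {L = wkT (wkT L)} {v′ = wkT (wkT v′)}
          (wk₁ (cast (wkF-subF {σ = v0 ▸ wkT v′ ▸ wkT u ▸ (wkT ∘ σ)} (agree₃ refl refl refl (λ _ → refl))
              (F S)) (up value)))
          h0 (wk₁ (up (wk₁ (up e)))) (wk₁ (cast wkEntry² (up (wk₁ (up f))))))))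
    where
    value : subF (v0 ▸ (wkT ∘ (v′ ▸ u ▸ σ))) (F S) ∷ map wkF Γ ⊢ subF (v0 ▸ wkT v′ ▸ wkT u ▸ (wkT ∘ σ)) (F S)
    value = cast (subF-cong (agree₃ refl refl refl (λ _ → refl)) (F S)) h0

  histsBody : Formula (suc (suc (suc (suc k))))
  histsBody = renF (#2 ▸ #0 ▸ #1 ▸ +4) hist

  -- With variables u, L, Y and the parameters: if u is a prefix of Y, it has a history.
  hists : Formula (suc (suc (suc k)))
  hists = (¬ᶠ (v0 ⊆ᵗ v2)) ∨ᶠ ∃⪯ (v1 ×ᵗ ((v2 ⌢ t1) ⌢ t1)) histsBody

  Hists : (u L Y : Term m) (σ : Fin k → Term m) → Formula m
  Hists u L Y σ = subF (u ▸ L ▸ Y ▸ σ) hists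

  wkHists : ∀ {L Y : Term m} {σ : Fin k → Term m} → wkF (Hists u L Y σ) ≡ Hists (wkT u) (wkT L) (wkT Y)
      (wkT ∘ σ)
  wkHists = wkF-subF (agree₃ refl refl refl (λ _ → refl)) hists

  hist-size : ∀ {L Y : Term m} {σ : Fin k → Term m} → Γ ⊢ Hist L w u σ → Γ ⊢ u ⊆ᵗ Y →
              Γ ⊢ w ⪯ (L ×ᵗ ((Y ⌢ t1) ⌢ t1))
  hist-size d e = ⊆-trans (len≐⇒⪯ (∧E₁ d)) (⪯-× (⪯-refl _) (⪯-⌢ (⪯-⌢ (⊆⇒⪯ e) (⪯-refl _)) (⪯-refl _)))

  histsI : ∀ {L Y : Term m} {σ : Fin k → Term m} → Γ ⊢ Hist L w u σ → Γ ⊢ u ⊆ᵗ Y → Γ ⊢ Hists u L Y σ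
  histsI {w = w} {u} {L} {Y} {σ} d e = ∨I₂ (∃I′ (u ▸ L ▸ Y ▸ σ)
      ((v0 ⪯ (v2 ×ᵗ ((v3 ⌢ t1) ⌢ t1))) ∧ᶠ histsBody) w
    (∧I (hist-size {w = w} {u} {L} {Y} {σ} d e) (cast (sym
        (subF-renF₃ (w ▸ u ▸ L ▸ Y ▸ σ) #2 #0 #1 +4 hist)) d)))

  histsE : ∀ {L Y : Term m} {σ : Fin k → Term m} → Γ ⊢ Hists u L Y σ → Γ ⊢ u ⊆ᵗ Y →
           Hist (wkT L) v0 (wkT u) (wkT ∘ σ) ∷ map wkF Γ ⊢ wkF ψ → Γ ⊢ ψ
  histsE {u = u} {L = L} {Y} {σ} d e f = ∨E d (⊥E (⇒E h0 (wk₁ e)))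
    (∃E′ (u ▸ L ▸ Y ▸ σ) ((v0 ⪯ (v2 ×ᵗ ((v3 ⌢ t1) ⌢ t1))) ∧ᶠ histsBody) h0
      (weaken-under (⇒E (wk₁ (⇒I f)) (cast (subF-renF₃ (v0 ▸ (wkT ∘ (u ▸ L ▸ Y ▸ σ))) #2 #0 #1 +4 hist)
          (∧E₂ h0)))))
    where
    weaken-under : ∀ {m} {Γ : List (Formula m)} {φ χ θ} → φ ∷ Γ ⊢ θ → φ ∷ χ ∷ Γ ⊢ θ
    weaken-under = weaken (λ { (here p) → here p ; (there p) → there (there p) })

  -- Block 0 fits because `width` ends in `t1`, so the code of ε, a bare marker, is no longer than
  -- the width. One growth step then appends the value at the empty prefix.
  hists-ε : ∀ {L Y : Term m} {σ : Fin k → Term m} → L ≡ width Y σ → Γ ⊢ Hists tε L Y σ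
  hists-ε {m} {Γ = Γ} {L} {Y} {σ} refl = ⊆E (⪯-⌢ {x = tε} (⊆-resp (sym≐ (×ε _)) (refl= _) (ε-⊆ _))
      (⪯-refl t1))
    (cast (sym wkHists) (grownE (grow wk-width (ε-⊆ _) (blocks-suc (len-cong (sym≐ (×ε _))) (block-len h0))
        first)
      (cast (sym wkHists) (histsI (hist-ε h1 (entry-mono (wk₁ (wk₁ (wk₁ (cast wkEntry (up first))))) h2) h0)
          (ε-⊆ _)))))
    where
    first : (∥ wkT (tε ⌢ t1) ∥ ⌢ v0 ≐ ∥ wkT L ∥) ∷ map wkF Γ ⊢ Entry (wkT L) (tε ⌢ block tε v0) tε tε
    first = entryI tε v0 (⊆-refl _) (len-cong (sym≐ (×ε _))) (block-len h0)

  -- The step of the old history at `u` itself puts the value at `u` into the last block; after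
  -- renaming the index from `u ⌢ t1` to `u ⌢ c`, this is the previous value from which the table
  -- grows.
  hists-snoc : ∀ {L Y : Term m} {σ : Fin k → Term m} → L ≡ width Y σ → Bit c →
               Γ ⊢ Hist L w u σ → Γ ⊢ u ⌢ c ⊆ᵗ Y → Γ ⊢ Hists (u ⌢ c) L Y σ
  hists-snoc {w = w} {u} {L} {Y} {σ} refl b d e = stepE (histStep d (⊆-refl _))
    (cast (sym (wkF-subF² (agree₃ refl refl refl (λ _ → refl)) hists))
      (grownE (grow (trans (cong wkT wk-width) wk-width) (up² (up (up e))) (up² (up (up size)))
          (entry-index h1 (sym≐ (bit-len (Bit-wk (Bit-wk b))))))
        (cast (sym wkHists) (histsI
          (hist-snoc (Bit-wk (Bit-wk (Bit-wk b)))
            (cast wkHist (wk₁ (wk₁ (wk₁ (up (up² (cast (wkF-subF² (agree₃ refl refl refl (λ _ → refl)) hist)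
                (up (up d)))))))))
            h2 h1 h0)
          (wk₁ (wk₁ (wk₁ (up (up² (up (up e)))))))))))
    where
    size : _ ⊢ ∥ w ∥ ≐ ∥ L ×ᵗ ((u ⌢ _) ⌢ t1) ∥
    size = ∧E₁ d ⟫ len-cong (×-len (len-⌢ _ _ ⟫ ⌢-cong (sym≐ (bit-len b)) (refl= _) ⟫ sym≐ (len-⌢ _ _)))

  hists-all : ∀ {L Y : Term m} {σ : Fin k → Term m} → L ≡ width Y σ → ∀ u → Γ ⊢ Hists u L Y σ
  hists-all {L = L} {Y} {σ} eqL = induct (L ▸ Y ▸ σ) hists
      (or (base (imp (pre _ _) bot)) (ex⪯ _ (Σ₁-ren _ hist-Σ₁)))
    (hists-ε eqL)
    (λ {c} b → cast (subF-cong {σ = (v0 ⌢ c) ▸ wkT L ▸ wkT Y ▸ (wkT ∘ σ)}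
        (λ { zero → refl ; (suc zero) → refl ; (suc (suc zero)) → refl ; (suc (suc (suc i))) → refl }) hists)
      (∨E (excluded-middle ((v0 ⌢ c) ⊆ᵗ wkT Y))
        (histsE (cast (subF-cong (agree₃ refl refl refl (λ _ → refl)) hists) h1) (⊆-trans (⊆-⌢ _ _) h0)
          (cast (sym wkHists) (hists-snoc (trans (cong (wkT ∘ wkT) eqL)
              (trans (cong wkT wk-width) wk-width)) (Bit-wk b) h0 h1)))
        (∨I₁ h0)))

  agreement : Formula 5
  agreement = (¬ᶠ (v0 ⊆ᵗ v4)) ∨ᶠ Common v1 v2 v3 ((v0 ⌢ t1) ⌢ t1)

  agreement-Σ₁ : Σᵇ₁ agreement
  agreement-Σ₁ = or (base (imp (pre _ _) bot)) (Σ₁-sub (v1 ▸ v2 ▸ v3 ▸ ((v0 ⌢ t1) ⌢ t1) ▸ none) common-Σ₁)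

  -- Block 0 codes ε in both tables, which starts the common prefix, and `common-step` lengthens it
  -- by a block at each prefix of `Y`. Taking the induction variable to be `Y` discards the negated
  -- disjunct.
  hist-common : ∀ {L w′ Y : Term m} {σ : Fin k → Term m} → Γ ⊢ Hist L w Y σ → Γ ⊢ Hist L w′ Y σ →
                Γ ⊢ Common L w w′ ((Y ⌢ t1) ⌢ t1)
  hist-common {w = w} {L} {w′} {Y} {σ} d e = ∨E
    (induct (L ▸ w ▸ w′ ▸ Y ▸ none) agreement agreement-Σ₁
      (∨I₂ (common-step (common-extend (common-ε L w w′) (∧E₁ (∧E₂ d)) (∧E₁ (∧E₂ e)))
        (histStep d (ε-⊆ Y)) (histStep e (ε-⊆ Y))))
      (λ {c} b → ∨E (excluded-middle ((v0 ⌢ c) ⊆ᵗ wkT Y))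
        (∨E h1 (⊥E (⇒E h0 (⊆-trans (⊆-⌢ _ _) h1)))
          (∨I₂ (common-step
            (common-index h0 (len-⌢ _ _ ⟫ ⌢-cong (sym≐ (bit-len b)) (refl= _) ⟫ sym≐ (len-⌢ _ _)))
            (histStep (cast wkHist (wk₁ (wk₁ (up₁ d)))) h1) (histStep (cast wkHist (wk₁ (wk₁ (up₁ e)))) h1))))
        (∨I₁ h0)) Y)
    (⊥E (⇒E h0 (⊆-refl Y))) h0

  valueBody : Formula (suc (suc (suc (suc k))))
  valueBody = renF (#2 ▸ #0 ▸ #3 ▸ +4) hist ∧ᶠ Entry v2 v0 (v3 ⌢ t1) v1

  -- With variables y, L, Y and the parameters: y is the value at Y in some history.
  value : Formula (suc (suc (suc k)))
  value = ∃⪯ (v1 ×ᵗ ((v2 ⌢ t1) ⌢ t1)) valueBody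

  Value : (y L Y : Term m) (σ : Fin k → Term m) → Formula m
  Value y L Y σ = subF (y ▸ L ▸ Y ▸ σ) value

  valueI : ∀ {L Y : Term m} {σ : Fin k → Term m} → Γ ⊢ Hist L w Y σ → Γ ⊢ Entry L w (Y ⌢ t1) y → Γ ⊢ Value y
      L Y σ
  valueI {w = w} {y = y} {L} {Y} {σ} d e = ∃I′ (y ▸ L ▸ Y ▸ σ)
      ((v0 ⪯ (v2 ×ᵗ ((v3 ⌢ t1) ⌢ t1))) ∧ᶠ valueBody) w
    (∧I (hist-size {w = w} {Y} {L} {Y} {σ} d (⊆-refl Y))
      (∧I (cast (sym (subF-renF₃ (w ▸ y ▸ L ▸ Y ▸ σ) #2 #0 #3 +4 hist)) d) e))

  valueE : ∀ {L Y : Term m} {σ : Fin k → Term m} → Γ ⊢ Value y L Y σ →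
           Entry (wkT L) v0 (wkT Y ⌢ t1) (wkT y) ∷ Hist (wkT L) v0 (wkT Y) (wkT ∘ σ) ∷ map wkF Γ ⊢ wkF ψ → Γ
               ⊢ ψ
  valueE {y = y} {L = L} {Y} {σ} d e = ∃E′ (y ▸ L ▸ Y ▸ σ) ((v0 ⪯ (v2 ×ᵗ ((v3 ⌢ t1) ⌢ t1))) ∧ᶠ valueBody) d
    (⇒E (⇒E (wk₁ (⇒I (⇒I e)))
      (cast (subF-renF₃ (v0 ▸ (wkT ∘ (y ▸ L ▸ Y ▸ σ))) #2 #0 #3 +4 hist) (∧E₁ (∧E₂ h0)))) (∧E₂ (∧E₂ h0)))

  value-total : ∀ {L Y : Term m} {σ : Fin k → Term m} → L ≡ width Y σ → Γ ⊢ subF (L ▸ Y ▸ σ) (∃ᶠ value)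
  value-total {L = L} {Y} {σ} eqL = histsE (hists-all eqL Y) (⊆-refl Y)
    (cast (sym (wkF-subF {σ = L ▸ Y ▸ σ} (λ _ → refl) (∃ᶠ value)))
    (stepE (histStep {w = v0} {L = wkT L} {σ = wkT ∘ σ} h0 (⊆-refl _))
      (cast (sym (wkF-subF² {σ = wkT ∘ (L ▸ Y ▸ σ)} (λ _ → refl) (∃ᶠ value)))
        (∃I′ (wkT ∘ wkT ∘ wkT ∘ (L ▸ Y ▸ σ)) value v0
          (cast (subF-cong {σ = v0 ▸ wkT (wkT (wkT L)) ▸ wkT (wkT (wkT Y)) ▸ (wkT ∘ wkT ∘ wkT ∘ σ)}
              (λ { zero → refl ; (suc zero) → refl ; (suc (suc zero)) → refl ; (suc (suc (suc i))) → refl })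
                  value)
            (valueI (cast (wkF-subF² {σ = wkT L ▸ v0 ▸ wkT Y ▸ (wkT ∘ σ)}
                (agree₃ refl refl refl (λ _ → refl)) hist)
                (up² (up (up h0)))) h1))))))

  value-unique : ∀ {L Y : Term m} {σ : Fin k → Term m} → Γ ⊢ Value y L Y σ → Γ ⊢ Value z L Y σ → Γ ⊢ y ≐ z
  value-unique {y = y} {z} {L} {Y} {σ} d e = valueE d (valueE {L = wkT L} {Y = wkT Y} {σ = wkT ∘ σ}
    (cast (wkF-subF {σ = z ▸ L ▸ Y ▸ σ} (agree₃ refl refl refl (λ _ → refl)) value) (wk₁ (wk₁ (up e))))
    (entry-unique (hist-common {σ = wkT ∘ wkT ∘ σ} (wk₁ (wk₁ (cast wkHist (up h1)))) h1)
        (wk₁ (wk₁ (cast wkEntry (up h0)))) h0))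

  value-size : ∀ {L Y : Term m} {σ : Fin k → Term m} → Γ ⊢ Value y L Y σ → Γ ⊢ y ⪯ L
  value-size {y = y} {L} {Y} d = valueE d (entry-bound {w = v0} {u = wkT Y ⌢ t1} {v = wkT y} {L = wkT L} h0)

  args : Fin (suc (suc k)) → Term (suc k)
  args = width v0 (var ∘ suc) ▸ v0 ▸ (var ∘ suc)

  recF : Formula (suc (suc k))
  recF = subF (exts args) value

  args-at : (σ : Fin (suc k) → Term m) → ∀ i → subT σ (args i) ≡
      (width (σ zero) (σ ∘ suc) ▸ σ zero ▸ (σ ∘ suc)) i
  args-at σ zero = cong (_⌢ t1) (trans (subT-subT σ _ T) (subT-cong (λ { zero → refl ; (suc i) → refl }) T))
  args-at σ (suc zero) = refl
  args-at σ (suc (suc i)) = refl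

  recF-at : (σ : Fin (suc k) → Term m) → Γ ⊢ subF (y ▸ σ) recF → Γ ⊢ Value y (width (σ zero) (σ ∘ suc))
      (σ zero) (σ ∘ suc)
  recF-at {y = y} σ = cast (subF-fuse (λ { zero → refl ; (suc i) → trans (∷ᵉ-wkT y σ (args i)) (args-at′ i)
      }) value)
    where
    args-at′ : ∀ i → subT σ (args i) ≡ (y ▸ (width (σ zero) (σ ∘ suc) ▸ σ zero ▸ (σ ∘ suc))) (suc i)
    args-at′ = args-at σ

  rec-total : (σ : Fin (suc k) → Term m) → Γ ⊢ subF σ (∃ᶠ recF)
  rec-total σ = cast (sym (subF-fuse (args-at σ) (∃ᶠ value))) (value-total refl)

  rec-unique : (σ : Fin (suc k) → Term m) → Γ ⊢ subF (y ▸ σ) recF → Γ ⊢ subF (z ▸ σ) recF → Γ ⊢ y ≐ z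
  rec-unique σ d e = value-unique {σ = σ ∘ suc} (recF-at σ d) (recF-at σ e)

  rec-bound : (σ : Fin (suc k) → Term m) → Γ ⊢ subF (y ▸ σ) recF → Γ ⊢ y ⪯ subT σ (args zero)
  rec-bound {y = y} σ d = cast (cong (y ⪯_) (sym (args-at σ zero))) (value-size {σ = σ ∘ suc} (recF-at σ d))

  rec-Σ₁ : Σᵇ₁ recF
  rec-Σ₁ = Σ₁-sub (exts args) (ex⪯ (v1 ×ᵗ ((v2 ⌢ t1) ⌢ t1))
      (and (Σ₁-ren _ hist-Σ₁) (Entry-Σ₁ v2 v0 (v3 ⌢ t1) v1)))

-- Recursion in the standard model

semR₃ : (e : Fin n → 𝕊) (a b c : Fin n) (ρ : Fin k → Fin n) (φ : Formula (suc (suc (suc k)))) {η : 𝕆} →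
        (⟦ renF (a ▸ b ▸ c ▸ ρ) φ ⟧ᶠ η e → ⟦ φ ⟧ᶠ η (e a ▸ e b ▸ e c ▸ (e ∘ ρ))) ×
        (⟦ φ ⟧ᶠ η (e a ▸ e b ▸ e c ▸ (e ∘ ρ)) → ⟦ renF (a ▸ b ▸ c ▸ ρ) φ ⟧ᶠ η e)
semR₃ e a b c ρ φ = semR φ
  (λ { zero → refl ; (suc zero) → refl ; (suc (suc zero)) → refl ; (suc (suc (suc i))) → refl })

_≟ˢ_ : (a b : 𝕊) → Dec (a ≡ b)
ε ≟ˢ ε             = yes refl
ε ≟ˢ (_ ∙ _)       = no λ ()
(_ ∙ _) ≟ˢ ε       = no λ ()
(a ∙ i) ≟ˢ (b ∙ j) with a ≟ˢ b | i ≟ j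
... | yes refl | yes refl = yes refl
... | no ¬p    | _        = no λ { refl → ¬p refl }
... | yes _    | no ¬q    = no λ { refl → ¬q refl }

-- Disjunctions are read constructively in the model, so a proof that the actual table satisfies
-- `hist` must choose a side of `histBody` for every subword.
_⊑?_ : (a b : 𝕊) → Dec (a ⊑ b)
a ⊑? b with a ≟ˢ b
a ⊑? b       | yes refl = yes ⊑-refl
a ⊑? ε       | no ¬p = no λ { ⊑-refl → ¬p refl }
a ⊑? (b ∙ i) | no ¬p with a ⊑? b
... | yes q = yes (⊑-step q)
... | no ¬q = no λ { ⊑-refl → ¬p refl ; (⊑-step q) → ¬q q }

++-cancelˡ : ∀ a b c → a ++ˢ b ≡ a ++ˢ c → len b ≡ len c → b ≡ c
++-cancelˡ a ε ε e l             = refl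
++-cancelˡ a (b ∙ i) (c ∙ j) e l = cong₂ _∙_ (++-cancelˡ a b c (cong initˢ e) (suc-injective l))
    (cong lastOf e)
  where
  lastOf : 𝕊 → Bool
  lastOf ε       = false
  lastOf (_ ∙ i) = i

0ˢ : 𝕊
0ˢ = ε ∙ false

blockˢ : 𝕊 → 𝕊 → 𝕊
blockˢ v p = (v ∙ true) ++ˢ (0ˢ ⊗ p)

blockˢ-injective : ∀ v v′ p p′ → blockˢ v p ≡ blockˢ v′ p′ → v ≡ v′
blockˢ-injective v v′ ε ε refl = refl
blockˢ-injective v v′ (p ∙ _) (p′ ∙ _) e = blockˢ-injective v v′ p p′ (cong initˢ e)
blockˢ-injective v v′ ε (p′ ∙ _) ()
blockˢ-injective v v′ (p ∙ _) ε ()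

len-blockˢ : ∀ v p → len (blockˢ v p) ≡ suc (len v) + len p
len-blockˢ v p = trans (len-++ (v ∙ true) (0ˢ ⊗ p)) (cong (suc (len v) +_)
    (trans (len-⊗ 0ˢ p) (+-comm (len p) 0)))

-- What `entry` denotes in the standard model, up to computation; components of a satisfied `step`
-- or `hist` can be used as such entries directly.
Entryˢ : (L w u v : 𝕊) → Set
Entryˢ L w u v =
  Σ 𝕊 λ s → ((1ˢ ⊗ s) ⊑ (1ˢ ⊗ w)) × Σ 𝕊 λ p → ((1ˢ ⊗ p) ⊑ (1ˢ ⊗ w)) ×
  ((s ++ˢ blockˢ v p) ⊑ w) × (1ˢ ⊗ s ≡ 1ˢ ⊗ (L ⊗ u)) × (1ˢ ⊗ blockˢ v p ≡ 1ˢ ⊗ L)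

Entryˢ-unique : ∀ {L w u u′ v v′} → Entryˢ L w u v → Entryˢ L w u′ v′ → len u ≡ len u′ → v ≡ v′
Entryˢ-unique {L} {w} {u} {u′} {v} {v′} (s , _ , p , _ , d , e , f) (s′ , _ , p′ , _ , d′ , e′ , f′) l =
  blockˢ-injective v v′ p p′ (++-cancelˡ s _ _ (trans same (cong (_++ˢ blockˢ v′ p′) (sym prefix))) widths)
  where
  starts : len s ≡ len s′
  starts = trans (trans (1⊗≡⇒len≡ s (L ⊗ u) e) (len-⊗ L u))
      (trans (cong (len L *_) l) (sym (trans (1⊗≡⇒len≡ s′ (L ⊗ u′) e′) (len-⊗ L u′))))
  widths : len (blockˢ v p) ≡ len (blockˢ v′ p′)
  widths = trans (1⊗≡⇒len≡ (blockˢ v p) L f) (sym (1⊗≡⇒len≡ (blockˢ v′ p′) L f′))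
  same : s ++ˢ blockˢ v p ≡ s′ ++ˢ blockˢ v′ p′
  same = ⊑-unique d d′ (trans (len-++ s _) (trans (cong₂ _+_ starts widths) (sym (len-++ s′ _))))
  prefix : s ≡ s′
  prefix = ⊑-unique (⊑-trans (⊑-++ s _) d) (⊑-trans (⊑-++ s′ _) d′) starts

Entryˢ-intro : ∀ {L w u v} s p → (s ++ˢ blockˢ v p) ⊑ w → len s ≡ len L * len u → len (blockˢ v p) ≡ len L →
    Entryˢ L w u v
Entryˢ-intro {L} {w} {u} {v} s p d e f =
  s , len≤⇒1⊗⊑ s w (⊑⇒len≤ (⊑-trans (⊑-++ s _) d)) ,
  p , len≤⇒1⊗⊑ p w (≤-trans size (⊑⇒len≤ d)) ,
  d , len≡⇒1⊗≡ s (L ⊗ u) (trans e (sym (len-⊗ L u))) , len≡⇒1⊗≡ (blockˢ v p) L f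
  where
  size : len p ≤ len (s ++ˢ blockˢ v p)
  size = ≤-trans (m≤n+m (len p) (suc (len v))) (≤-trans (≤-reflexive (sym (len-blockˢ v p)))
    (≤-trans (m≤n+m _ (len s)) (≤-reflexive (sym (len-++ s _)))))

zeros : ℕ → 𝕊
zeros zero    = ε
zeros (suc n) = zeros n ∙ false

len-zeros : ∀ n → len (zeros n) ≡ n
len-zeros zero    = refl
len-zeros (suc n) = cong suc (len-zeros n)

module RecursionSemantics {k} {s : Fun (suc (suc k))} (S : Rel (suc (suc k)) s) (T : Term (suc k))
    (S-bound : B S ≡ wkT T) where

  open History S
  open Recursion S T S-bound

  module _ (η : 𝕆) (x : Fin k → 𝕊) where

    mutual
      val : 𝕊 → 𝕊
      val u = s (prev u ▸ u ▸ x) η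

      -- The content of block number |`u`|: the value one letter earlier, with the conventional ε in
      -- block 0.
      prev : 𝕊 → 𝕊
      prev ε       = ε
      prev (u ∙ _) = val u

    Stepˢ : (L w u : 𝕊) → Set
    Stepˢ L w u = ⟦ step ⟧ᶠ η (L ▸ w ▸ u ▸ x)

    Histˢ : (L w u : 𝕊) → Set
    Histˢ L w u = ⟦ hist ⟧ᶠ η (L ▸ w ▸ u ▸ x)

    stepˢ : ∀ {L w Y} u → u ⊑ Y → Histˢ L w Y → Stepˢ L w u
    stepˢ {L} {w} {Y} u p (_ , _ , h) with h u (ε , ε⊑ Y , subst (_⊑ Y) (sym (ε++ u)) p)
    ... | inj₁ ¬p = ⊥-elim (¬p p)
    ... | inj₂ st = proj₁ (semR₃ (u ▸ L ▸ w ▸ Y ▸ x) #1 #2 #0 +4 step) st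

    -- Concerns any table satisfying `hist`. By recursion on `u`, the step at `u` starts from a
    -- correct previous value, and a block can be decoded in only one way.
    hist-sound : ∀ {L w Y} → Histˢ L w Y → ∀ u → u ⊑ Y → ∀ {v} → Entryˢ L w (u ∙ true) v → v ≡ val u
    hist-sound {L} {w} h u p e with stepˢ u p h
    ... | v′ , _ , v₁ , _ , e′ , e₁ , r = trans (Entryˢ-unique {L} {w} {u ∙ true} {u ∙ true} e e₁ refl)
      (trans (sym (proj₁ (sem S (v′ ▸ u ▸ x) η) (proj₁ (semR₃ (v₁ ▸ v′ ▸ L ▸ w ▸ u ▸ x) #0 #1 #4 +5 (F S))
          r)))
             (cong (λ z → s (z ▸ u ▸ x) η) (previous u p e′)))
      where
      previous : ∀ u → u ⊑ _ → ∀ {v′} → Entryˢ L w u v′ → v′ ≡ prev u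
      previous ε p e′       = Entryˢ-unique {L} {w} {ε} {ε} e′ (proj₁ (proj₂ h)) refl
      -- The product `L ⊗ (u ∙ b)` computes without looking at `b`, so the same components form an
      -- entry at `u ∙ true`.
      previous (u ∙ b) p (s , bs , p′ , bp , d , e , f) = hist-sound h u (⊑-trans (⊑-step ⊑-refl) p)
          (s , bs , p′ , bp , d , e , f)

    module _ (L Y : 𝕊) (fits : ∀ u → u ⊑ Y → suc (len (val u)) ≤ len L) where

      blk : 𝕊 → 𝕊
      blk v = blockˢ v (zeros (len L ∸ suc (len v)))

      len-blk : ∀ v → suc (len v) ≤ len L → len (blk v) ≡ len L
      len-blk v p = trans (len-blockˢ v _) (trans (cong (suc (len v) +_) (len-zeros _)) (m+[n∸m]≡n p))

      -- `table u` ends with the value before `u`. The full table for `Y` is therefore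
      -- `table (Y ∙ true)`, where the last letter is immaterial.
      table : 𝕊 → 𝕊
      table ε       = blk ε
      table (u ∙ _) = table u ++ˢ blk (val u)

      fits-prev : ∀ u → u ⊑ Y → suc (len (prev u)) ≤ len L
      fits-prev ε p       = ≤-trans (s≤s z≤n) (fits ε p)
      fits-prev (u ∙ b) p = fits u (⊑-trans (⊑-step ⊑-refl) p)

      len-table : ∀ u → u ⊑ Y → len (table u) ≡ len L * suc (len u)
      len-table ε p       = trans (len-blk ε (fits-prev ε p)) (sym (*-identityʳ (len L)))
      len-table (u ∙ b) p = trans (len-++ (table u) _) (trans
          (cong₂ _+_ (len-table u q) (len-blk (val u) (fits u q)))
        (trans (+-comm (len L * suc (len u)) (len L)) (sym (*-suc (len L) (suc (len u))))))
        where
        q : u ⊑ Y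
        q = ⊑-trans (⊑-step ⊑-refl) p

      table-mono : ∀ {u Z} b → u ⊑ Z → table (u ∙ b) ⊑ table (Z ∙ true)
      table-mono b ⊑-refl             = ⊑-refl
      table-mono b (⊑-step {y = y} p) = ⊑-trans (table-mono b p)
          (⊑-++ (table y ++ˢ blk (val y)) (blk (val (y ∙ _))))

      entry-table : ∀ u {w} → u ⊑ Y → table (u ∙ true) ⊑ w → Entryˢ L w (u ∙ true) (val u)
      entry-table u p q = Entryˢ-intro {u = u ∙ true} (table u) (zeros (len L ∸ suc (len (val u)))) q
          (len-table u p) (len-blk (val u) (fits u p))

      entry-prev : ∀ u {w} → u ⊑ Y → table u ⊑ w → Entryˢ L w u (prev u)
      entry-prev ε {w} p q   = Entryˢ-intro ε (zeros (len L ∸ suc zero))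
          (subst (_⊑ w) (sym (ε++ (blk ε))) q) (sym (*-zeroʳ (len L))) (len-blk ε (fits-prev ε p))
      entry-prev (u ∙ b) p q = Entryˢ-intro {u = u ∙ b} (table u) (zeros (len L ∸ suc (len (val u)))) q
          (len-table u r) (len-blk (val u) (fits u r))
        where
        r : u ⊑ Y
        r = ⊑-trans (⊑-step ⊑-refl) p

      Entryˢ-bound : ∀ {w u v} → Entryˢ L w u v → (1ˢ ⊗ v) ⊑ (1ˢ ⊗ L)
      Entryˢ-bound {v = v} (_ , _ , p , _ , _ , _ , f) = len≤⇒1⊗⊑ v L
          (≤-trans (⊑⇒len≤ (⊑-trans (⊑-step {b = true} ⊑-refl) (⊑-++ (v ∙ true) (0ˢ ⊗ p))))
              (≤-reflexive (1⊗≡⇒len≡ (blockˢ v p) L f)))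

      step-table : ∀ u → u ⊑ Y → Stepˢ L (table (Y ∙ true)) u
      step-table u p =
        prev u , Entryˢ-bound {u = u} before , val u , Entryˢ-bound {u = u ∙ true} after , before , after ,
        proj₂ (semR₃ (val u ▸ prev u ▸ L ▸ table (Y ∙ true) ▸ u ▸ x) #0 #1 #4 +5 (F S))
          (proj₂ (sem S (prev u ▸ u ▸ x) η) refl)
        where
        before : Entryˢ L (table (Y ∙ true)) u (prev u)
        before = entry-prev u p (⊑-trans (⊑-++ (table u) _) (table-mono true p))
        after : Entryˢ L (table (Y ∙ true)) (u ∙ true) (val u)
        after = entry-table u p (table-mono true p)

      len-whole : len (table (Y ∙ true)) ≡ len L * suc (suc (len Y))
      len-whole = trans (len-++ (table Y) _) (trans (cong₂ _+_ (len-table Y ⊑-refl)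
          (len-blk (val Y) (fits Y ⊑-refl)))
        (trans (+-comm (len L * suc (len Y)) (len L)) (sym (*-suc (len L) (suc (len Y))))))

      size-table : len (table (Y ∙ true)) ≡ len (L ⊗ (Y ∙ true ∙ true))
      size-table = trans len-whole (sym (len-⊗ L (Y ∙ true ∙ true)))

      hist-table : Histˢ L (table (Y ∙ true)) Y
      hist-table = len≡⇒1⊗≡ (table (Y ∙ true)) (L ⊗ (Y ∙ true ∙ true)) size-table ,
        entry-prev ε (ε⊑ Y) (⊑-trans (⊑-++ (blk ε) (blk (val ε))) (table-mono true (ε⊑ Y))) ,
        λ u _ → steps u
        where
        steps : ∀ u → (¬ (u ⊑ Y)) ⊎ _
        steps u with u ⊑? Y
        ... | no ¬p = inj₁ ¬p
        ... | yes p = inj₂ (proj₂ (semR₃ (u ▸ L ▸ table (Y ∙ true) ▸ Y ▸ x) #1 #2 #0 +4 step)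
            (step-table u p))

      value-table : ⟦ value ⟧ᶠ η (val Y ▸ L ▸ Y ▸ x)
      value-table = table (Y ∙ true) , len≤⇒1⊗⊑ (table (Y ∙ true)) (L ⊗ (Y ∙ true ∙ true))
          (≤-reflexive size-table) ,
        proj₂ (semR₃ (table (Y ∙ true) ▸ val Y ▸ L ▸ Y ▸ x) #2 #0 #3 +4 hist) hist-table ,
        entry-table Y ⊑-refl ⊑-refl

    value-sound : ∀ {y L Y} → ⟦ value ⟧ᶠ η (y ▸ L ▸ Y ▸ x) → y ≡ val Y
    value-sound {y} {L} {Y} (w , _ , h , e) =
      hist-sound (proj₁ (semR₃ (w ▸ y ▸ L ▸ Y ▸ x) #2 #0 #3 +4 hist) h) Y ⊑-refl e

    val-size : ∀ u → len (val u) ≤ len (⟦ T ⟧ᵗ (u ▸ x))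
    val-size u = ≤-trans (semBnd S (prev u ▸ u ▸ x) η)
      (≤-reflexive (cong len (trans (cong (λ t → ⟦ t ⟧ᵗ (prev u ▸ u ▸ x)) S-bound)
          (semWk T (prev u) (u ▸ x)))))

    val-fits : ∀ Y u → u ⊑ Y → suc (len (val u)) ≤ len (⟦ T ⟧ᵗ (Y ▸ x) ∙ true)
    val-fits Y u p = s≤s (≤-trans (val-size u) (semT-mono T (λ { zero → ⊑⇒len≤ p ; (suc i) → ≤-refl })))

  recR : Rel (suc k) (λ ρ η → val η (ρ ∘ suc) (ρ zero))
  recR = record
    { F      = recF
    ; F-Σ₁   = rec-Σ₁
    ; B      = args zero
    ; tot    = rec-total
    ; uni    = λ σ → rec-unique σ
    ; bnd    = λ σ → rec-bound σ
    ; sem    = λ ρ η {y} →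
        (λ p → sym (value-sound η (ρ ∘ suc) (proj₁ (semF value {σ = exts args} (env ρ y)) p))) ,
        (λ { refl → proj₂ (semF value {σ = exts args} (env ρ y))
            (value-table η (ρ ∘ suc) _ (ρ zero) (val-fits η (ρ ∘ suc) (ρ zero))) })
    ; semBnd = λ ρ η → ≤-trans (val-size η (ρ ∘ suc) (ρ zero)) (≤-trans (n≤1+n _)
        (≤-reflexive (cong (λ z → suc (len z)) (sym (semT T {ρ = ρ} (λ { zero → refl ; (suc i) → refl }))))))
    }
    where
    env : ∀ ρ y i → ⟦ exts args i ⟧ᵗ (y ∷ᵉ ρ) ≡ (y ▸ (⟦ T ⟧ᵗ (ρ zero ▸ (ρ ∘ suc)) ∙ true) ▸ ρ zero ▸
        (ρ ∘ suc)) i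
    env ρ y zero = refl
    env ρ y (suc zero) = trans (semWk (args zero) y ρ) (cong (_∙ true)
        (semT T {ρ = ρ} (λ { zero → refl ; (suc i) → refl })))
    env ρ y (suc (suc zero)) = refl
    env ρ y (suc (suc (suc i))) = refl

recR-POR : ∀ {k} {g : POR k} {h₀ h₁ : POR (suc (suc k))} (t : Term (suc k)) →
           Rel k ⟦ g ⟧ → Rel (suc (suc k)) ⟦ h₀ ⟧ → Rel (suc (suc k)) ⟦ h₁ ⟧ → Rel (suc k) ⟦ rec g h₀ h₁ t ⟧
recR-POR {k} {g} {h₀} {h₁} t G H₀ H₁ = Rel-resp (λ ρ η → agree η (λ i → ρ (suc i)) (ρ zero)) recR
  where
  open StepFunction G H₀ H₁ t
  open RecursionSemantics stepR stepBound stepR-bound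
  agree : ∀ η x u → val η x u ≡ recEval g h₀ h₁ t x η u
  agree η x ε           = refl
  agree η x (u ∙ false) = cong (_∣ ⟦ t ⟧ᵗ (u ▸ x))
    (f-cong H₀ (λ { zero → agree η x u ; (suc i) → refl }) η)
  agree η x (u ∙ true)  = cong (_∣ ⟦ t ⟧ᵗ (u ▸ x))
    (f-cong H₁ (λ { zero → agree η x u ; (suc i) → refl }) η)

-- From codes of functions to representing formulas

relation : (f : POR k) → Rel k ⟦ f ⟧
relation E               = termR tε
relation (P i)           = termR (var i)
relation S₀              = termR (v0 ⌢ t0)
relation S₁              = termR (v0 ⌢ t1)
relation C               = condR
relation Q               = queryR
relation (comp h g)      = compR (relation h) (λ i → relation (g i))
relation (rec g h₀ h₁ t) = recR-POR {g = g} {h₀} {h₁} t (relation g) (relation h₀) (relation h₁)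

∀ⁿI : ∀ n {φ : Formula n} → [] ⊢ φ → [] ⊢ ∀ⁿ n φ
∀ⁿI zero d    = d
∀ⁿI (suc n) d = ∀ⁿI n (∀I d)

num-value : ∀ s (ρ : Fin 0 → 𝕊) → ⟦ num s ⟧ᵗ ρ ≡ s
num-value ε ρ           = refl
num-value (s ∙ false) ρ = cong (_∙ false) (num-value s ρ)
num-value (s ∙ true) ρ  = cong (_∙ true) (num-value s ρ)

representable : {f : Fun k} → Rel k f → Σᵇ₁-Representable f
representable {k} {f} R = F R , F-Σ₁ R , ∀ⁿI k (cast (subF-var (∃ᶠ (F R))) (tot R var)) ,
  ∀ⁿI k (∀I (∀I (⇒I (uni R (λ i → var (suc (suc i)))
    (cast (trans (renF≡subF _ (F R)) (subF-cong (λ { zero → refl ; (suc i) → refl }) (F R))) (∧E₁ h0))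
    (cast (trans (renF≡subF _ (F R)) (subF-cong (λ { zero → refl ; (suc i) → refl }) (F R))) (∧E₂ h0)))))) ,
  λ σ τ η → (λ p → proj₂ (semF (F R) (env σ τ)) (proj₂ (sem R σ η) p)) ,
            (λ p → proj₁ (sem R σ η) (proj₁ (semF (F R) (env σ τ)) p))
  where
  env : ∀ σ τ i → ⟦ (num τ ∷ᵉ (λ j → num (σ j))) i ⟧ᵗ (λ ()) ≡ (τ ∷ᵉ σ) i
  env σ τ zero    = num-value τ _
  env σ τ (suc i) = num-value (σ i) _

mainTheorem2 : ∀ {k : ℕ} (f : POR k) → Σᵇ₁-Representable ⟦ f ⟧
mainTheorem2 f = representable (relation f)
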